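{- There is an absolute constant $n_0$ such that for all integers $n \geq n_0$, $$ES(n) \leq 2^{\,n + 6n^{2/3}\log n},$$ where $\log$ denotes the logarithm to base $2$.
   Context: A set of points in the plane $\mathbb{R}^2$ is in general position if no three of its points lie on a line. A finite set of points in the plane in general position is in convex position if its points are the vertices of a convex polygon (equivalently, no point of the set lies in the convex hull of the other points). For an integer $n \geq 3$, $ES(n)$ denotes the smallest integer such that any set of $ES(n)$ points in the plane in general position contains $n$ points in convex position (this integer exists for every $n\ge 3$ by a classical theorem of Erdős and Szekeres). -}

module Defs where

open import Data.Bool.Base using (if_then_else_)
open import Data.Empty using (⊥-elim)
open import Data.Fin.Base using (Fin)
open import Data.Integer.Base as ℤ using (ℤ; +_; -[1+_])
import Data.Integer.Properties as ℤ
import Data.Integer.Solver as ℤSolver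
open import Data.Nat.Base as ℕ using (ℕ; zero; suc; NonZero)
import Data.Nat.Properties as ℕ
open import Data.Nat.Solver using (module +-*-Solver)
open import Data.Product.Base using (_×_; _,_; proj₁; proj₂; ∃-syntax; Σ-syntax)
open import Data.Rational.Base as ℚ using (ℚ; 0ℚ; 1ℚ; ½; ↥_; ↧_; ↧ₙ_; ∣_∣)
import Data.Rational.Properties as ℚ
import Data.Rational.Solver as ℚSolver
open import Data.Rational.Unnormalised.Base as ℚᵘ using (mkℚᵘ)
import Data.Rational.Unnormalised.Properties as ℚᵘ
open import Data.Sum.Base using (_⊎_; inj₁; inj₂)
open import Data.Unit.Base using (⊤)
open import Data.Vec.Functional using (Vector; foldr; removeAt)
open import Function.Base using (_∘_)
open import Function.Definitions using (Injective)
open import Relation.Binary.PropositionalEquality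
  using (_≡_; _≢_; refl; sym; trans; cong; cong₂; subst; subst₂)
open import Relation.Nullary using (¬_; Dec; does; yes; no)

-- Real numbers: Cauchy sequences of rationals, with equality _≃_ and order read off from
-- the tails of the sequences.

record ℝ : Set where
  constructor mkℝ
  field
    seq    : ℕ → ℚ
    cauchy : ∀ ε → 0ℚ ℚ.< ε →
             ∃[ N ] (∀ m n → N ℕ.≤ m → N ℕ.≤ n → ∣ seq m ℚ.- seq n ∣ ℚ.≤ ε)

open ℝ public

infix 4 _≤ᴿ_ _<ᴿ_ _≃_ _#_

_≤ᴿ_ : ℝ → ℝ → Set
x ≤ᴿ y = ∀ ε → 0ℚ ℚ.< ε → ∃[ N ] (∀ n → N ℕ.≤ n → seq x n ℚ.≤ seq y n ℚ.+ ε)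

_<ᴿ_ : ℝ → ℝ → Set
x <ᴿ y = ∃[ ε ] (0ℚ ℚ.< ε × ∃[ N ] (∀ n → N ℕ.≤ n → seq x n ℚ.+ ε ℚ.≤ seq y n))

_≃_ : ℝ → ℝ → Set
x ≃ y = x ≤ᴿ y × y ≤ᴿ x

-- Apartness, the constructive form of x ≠ y.
_#_ : ℝ → ℝ → Set
x # y = x <ᴿ y ⊎ y <ᴿ x

-- Auxiliary facts about ℚ.

δ : ℕ → ℚ
δ k = + 1 ℚ./ suc k

0<δ : ∀ k → 0ℚ ℚ.< δ k
0<δ k = ℚ.positive⁻¹ (δ k) {{ℚ.normalize-pos 1 (suc k)}}

/-mono : ∀ a b j k → a ℕ.* suc k ℕ.≤ b ℕ.* suc j → + a ℚ./ suc j ℚ.≤ + b ℚ./ suc k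
/-mono a b j k h = ℚ.toℚᵘ-cancel-≤
  (ℚᵘ.≤-respˡ-≃ (ℚᵘ.≃-sym (ℚ.toℚᵘ-fromℚᵘ (mkℚᵘ (+ a) j)))
  (ℚᵘ.≤-respʳ-≃ (ℚᵘ.≃-sym (ℚ.toℚᵘ-fromℚᵘ (mkℚᵘ (+ b) k)))
  (ℚᵘ.*≤* (subst₂ ℤ._≤_ (ℤ.pos-* a (suc k)) (ℤ.pos-* b (suc j)) (ℤ.+≤+ h)))))

/-0≤ : ∀ a j → 0ℚ ℚ.≤ + a ℚ./ suc j
/-0≤ a j = /-mono 0 a 0 j ℕ.z≤n

/-+ : ∀ a b j → + (a ℕ.+ b) ℚ./ suc j ≡ + a ℚ./ suc j ℚ.+ + b ℚ./ suc j
/-+ a b j = ℚ.toℚᵘ-injective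
  (ℚᵘ.≃-trans (ℚ.toℚᵘ-fromℚᵘ (mkℚᵘ (+ (a ℕ.+ b)) j))
  (ℚᵘ.≃-trans core
  (ℚᵘ.≃-trans (ℚᵘ.+-cong (ℚᵘ.≃-sym (ℚ.toℚᵘ-fromℚᵘ (mkℚᵘ (+ a) j)))
                         (ℚᵘ.≃-sym (ℚ.toℚᵘ-fromℚᵘ (mkℚᵘ (+ b) j))))
  (ℚᵘ.≃-sym (ℚ.toℚᵘ-homo-+ (+ a ℚ./ suc j) (+ b ℚ./ suc j))))))
  where
  open ℤSolver.+-*-Solver
  core : mkℚᵘ (+ (a ℕ.+ b)) j ℚᵘ.≃ mkℚᵘ (+ a) j ℚᵘ.+ mkℚᵘ (+ b) j
  core = ℚᵘ.*≡* (trans (cong (ℤ._* (+ (suc j ℕ.* suc j))) (ℤ.pos-+ a b))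
    (trans (cong ((+ a ℤ.+ + b) ℤ.*_) (ℤ.pos-* (suc j) (suc j)))
    (solve 3 (λ a b s → (a :+ b) :* (s :* s) := (a :* s :+ b :* s) :* s)
       refl (+ a) (+ b) (+ suc j))))

/-* : ∀ a b j k →
      + (a ℕ.* b) ℚ./ (suc j ℕ.* suc k) ≡ (+ a ℚ./ suc j) ℚ.* (+ b ℚ./ suc k)
/-* a b j k = ℚ.toℚᵘ-injective
  (ℚᵘ.≃-trans (ℚ.toℚᵘ-fromℚᵘ (mkℚᵘ (+ (a ℕ.* b)) (k ℕ.+ j ℕ.* suc k)))
  (ℚᵘ.≃-trans core
  (ℚᵘ.≃-trans (ℚᵘ.*-cong (ℚᵘ.≃-sym (ℚ.toℚᵘ-fromℚᵘ (mkℚᵘ (+ a) j)))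
                         (ℚᵘ.≃-sym (ℚ.toℚᵘ-fromℚᵘ (mkℚᵘ (+ b) k))))
  (ℚᵘ.≃-sym (ℚ.toℚᵘ-homo-* (+ a ℚ./ suc j) (+ b ℚ./ suc k))))))
  where
  core : mkℚᵘ (+ (a ℕ.* b)) (k ℕ.+ j ℕ.* suc k) ℚᵘ.≃ mkℚᵘ (+ a) j ℚᵘ.* mkℚᵘ (+ b) k
  core = ℚᵘ.*≡* (cong (ℤ._* (+ (suc j ℕ.* suc k))) (ℤ.pos-* a b))

/-diag : ∀ j → + suc j ℚ./ suc j ≡ 1ℚ
/-diag j = ℚ.≤-antisym (/-mono (suc j) 1 j 0 (ℕ.≤-reflexive (ℕ.*-comm (suc j) 1)))
                       (/-mono 1 (suc j) 0 j (ℕ.≤-reflexive (ℕ.*-comm 1 (suc j))))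

δ-anti : ∀ {j k} → j ℕ.≤ k → δ k ℚ.≤ δ j
δ-anti {j} {k} j≤k = /-mono 1 1 k j (ℕ.*-monoʳ-≤ 1 (ℕ.s≤s j≤k))

archimedes : ∀ ε → 0ℚ ℚ.< ε → ∃[ k ] (δ k ℚ.≤ ε)
archimedes ε@(ℚ.mkℚ (+ suc n) k _) _ =
  k , subst (δ k ℚ.≤_) (ℚ.fromℚᵘ-toℚᵘ ε) (/-mono 1 (suc n) k k (ℕ.*-monoˡ-≤ (suc k) (ℕ.s≤s (ℕ.z≤n {n}))))
archimedes (ℚ.mkℚ (+ zero) _ _) (ℚ.*<* h) = ⊥-elim (ℤ.<-irrefl refl h)
archimedes (ℚ.mkℚ -[1+ _ ] _ _) (ℚ.*<* ())

0<-+ : ∀ {p q} → 0ℚ ℚ.≤ p → 0ℚ ℚ.< q → 0ℚ ℚ.< p ℚ.+ q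
0<-+ = ℚ.+-mono-≤-<

0≤-* : ∀ {p q} → 0ℚ ℚ.≤ p → 0ℚ ℚ.≤ q → 0ℚ ℚ.≤ p ℚ.* q
0≤-* {p} {q} h k = ℚ.nonNegative⁻¹ (p ℚ.* q)
  {{ℚ.nonNeg*nonNeg⇒nonNeg p {{ℚ.nonNegative h}} q {{ℚ.nonNegative k}}}}

*-mono : ∀ {p q r s} → 0ℚ ℚ.≤ r → 0ℚ ℚ.≤ q → p ℚ.≤ q → r ℚ.≤ s → p ℚ.* r ℚ.≤ q ℚ.* s
*-mono {p} {q} {r} {s} 0≤r 0≤q p≤q r≤s = ℚ.≤-trans
  (ℚ.*-monoʳ-≤-nonNeg r {{ℚ.nonNegative 0≤r}} p≤q)
  (ℚ.*-monoˡ-≤-nonNeg q {{ℚ.nonNegative 0≤q}} r≤s)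

archimedes* : ∀ ε K → 0ℚ ℚ.< ε → 0ℚ ℚ.< K → ∃[ k ] (δ k ℚ.* K ℚ.≤ ε)
archimedes* ε K 0<ε 0<K = k ,
  ℚ.≤-trans (ℚ.*-monoʳ-≤-nonNeg K {{ℚ.pos⇒nonNeg K}} (proj₂ arch))
    (ℚ.≤-reflexive (trans (ℚ.*-assoc ε (ℚ.1/ K) K)
      (trans (cong (ε ℚ.*_) (ℚ.*-inverseˡ K)) (ℚ.*-identityʳ ε))))
  where
  instance
    posK : ℚ.Positive K
    posK = ℚ.positive 0<K
    nzK : ℚ.NonZero K
    nzK = ℚ.pos⇒nonZero K
  arch = archimedes (ε ℚ.* ℚ.1/ K)
    (ℚ.positive⁻¹ _ {{ℚ.pos*pos⇒pos ε {{ℚ.positive 0<ε}} (ℚ.1/ K) {{ℚ.1/pos⇒pos K}}}})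
  k = proj₁ arch

∣-∣-≤ : ∀ {p q ε} → p ℚ.≤ q ℚ.+ ε → q ℚ.≤ p ℚ.+ ε → ∣ p ℚ.- q ∣ ℚ.≤ ε
∣-∣-≤ {p} {q} {ε} h k with ℚ.∣p∣≡p∨∣p∣≡-p (p ℚ.- q)
... | inj₁ e = subst (ℚ._≤ ε) (sym e)
    (ℚ.≤-trans (ℚ.+-monoˡ-≤ (ℚ.- q) h)
      (ℚ.≤-reflexive (solve 2 (λ q ε → q :+ ε :- q := ε) refl q ε)))
  where open ℚSolver.+-*-Solver
... | inj₂ e = subst (ℚ._≤ ε) (sym (trans e (solve 2 (λ p q → :- (p :- q) := q :- p) refl p q)))
    (ℚ.≤-trans (ℚ.+-monoˡ-≤ (ℚ.- p) k)
      (ℚ.≤-reflexive (solve 2 (λ q ε → q :+ ε :- q := ε) refl p ε)))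
  where open ℚSolver.+-*-Solver

≤∣∣ : ∀ p → p ℚ.≤ ∣ p ∣
≤∣∣ p with ℚ.≤-total 0ℚ p
... | inj₁ h = ℚ.≤-reflexive (sym (ℚ.0≤p⇒∣p∣≡p h))
... | inj₂ h = ℚ.≤-trans h (ℚ.0≤∣p∣ p)

≤-from-∣-∣ : ∀ {p q ε} → ∣ p ℚ.- q ∣ ℚ.≤ ε → p ℚ.≤ q ℚ.+ ε
≤-from-∣-∣ {p} {q} {ε} h = ℚ.≤-trans
  (ℚ.≤-reflexive (solve 2 (λ p q → p := q :+ (p :- q)) refl p q))
  (ℚ.+-monoʳ-≤ q (ℚ.≤-trans (≤∣∣ (p ℚ.- q)) h))
  where open ℚSolver.+-*-Solver

-- Arithmetic of ℝ, termwise on sequences.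

infixl 6 _+ᴿ_
infixl 7 _*ᴿ_

fromℚ : ℚ → ℝ
seq    (fromℚ q) _ = q
cauchy (fromℚ q) ε 0<ε =
  0 , λ _ _ _ _ → subst (λ z → ∣ z ∣ ℚ.≤ ε) (sym (ℚ.+-inverseʳ q)) (ℚ.<⇒≤ 0<ε)

fromℕ : ℕ → ℝ
fromℕ n = fromℚ (+ n ℚ./ 1)

0ᴿ 1ᴿ : ℝ
0ᴿ = fromℕ 0
1ᴿ = fromℕ 1

_+ᴿ_ : ℝ → ℝ → ℝ
seq    (x +ᴿ y) n = seq x n ℚ.+ seq y n
cauchy (x +ᴿ y) ε 0<ε = proj₁ cx ℕ.⊔ proj₁ cy , λ m n hm hn → ℚ.≤-trans
    (ℚ.≤-reflexive (cong ∣_∣ (solve 4 (λ a b c d → a :+ b :- (c :+ d) := a :- c :+ (b :- d)) refl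
      (seq x m) (seq y m) (seq x n) (seq y n))))
    (ℚ.≤-trans (ℚ.∣p+q∣≤∣p∣+∣q∣ (seq x m ℚ.- seq x n) (seq y m ℚ.- seq y n))
    (ℚ.≤-trans (ℚ.+-mono-≤
        (proj₂ cx m n (ℕ.m⊔n≤o⇒m≤o _ _ hm) (ℕ.m⊔n≤o⇒m≤o _ _ hn))
        (proj₂ cy m n (ℕ.m⊔n≤o⇒n≤o (proj₁ cx) _ hm) (ℕ.m⊔n≤o⇒n≤o (proj₁ cx) _ hn)))
      (ℚ.≤-reflexive (solve 1 (λ e → con ½ :* e :+ con ½ :* e := e) refl ε))))
  where
  open ℚSolver.+-*-Solver
  0<½ε : 0ℚ ℚ.< ½ ℚ.* ε
  0<½ε = ℚ.positive⁻¹ _ {{ℚ.pos*pos⇒pos ½ ε {{ℚ.positive 0<ε}}}}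
  cx = cauchy x (½ ℚ.* ε) 0<½ε
  cy = cauchy y (½ ℚ.* ε) 0<½ε

bounded : ∀ x → ∃[ B ] (0ℚ ℚ.< B × ∃[ N ] (∀ n → N ℕ.≤ n → ∣ seq x n ∣ ℚ.≤ B))
bounded x with cauchy x 1ℚ (ℚ.positive⁻¹ 1ℚ)
... | N , h = ∣ seq x N ∣ ℚ.+ 1ℚ , 0<-+ (ℚ.0≤∣p∣ (seq x N)) (ℚ.positive⁻¹ 1ℚ) , N ,
  λ n hn → ℚ.≤-trans
    (ℚ.≤-reflexive (cong ∣_∣ (solve 2 (λ a b → a := b :+ (a :- b)) refl (seq x n) (seq x N))))
    (ℚ.≤-trans (ℚ.∣p+q∣≤∣p∣+∣q∣ (seq x N) (seq x n ℚ.- seq x N))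
      (ℚ.+-monoʳ-≤ ∣ seq x N ∣ (h n N hn ℕ.≤-refl)))
  where open ℚSolver.+-*-Solver

_*ᴿ_ : ℝ → ℝ → ℝ
seq    (x *ᴿ y) n = seq x n ℚ.* seq y n
cauchy (x *ᴿ y) ε 0<ε = (Nx ℕ.⊔ Ny) ℕ.⊔ (Mx ℕ.⊔ My) , λ m n hm hn → ℚ.≤-trans
    (ℚ.≤-reflexive (cong ∣_∣ (solve 4
      (λ a b c d → a :* b :- c :* d := a :* (b :- d) :+ (a :- c) :* d) refl
      (seq x m) (seq y m) (seq x n) (seq y n))))
    (ℚ.≤-trans
      (ℚ.∣p+q∣≤∣p∣+∣q∣ (seq x m ℚ.* (seq y m ℚ.- seq y n)) ((seq x m ℚ.- seq x n) ℚ.* seq y n))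
    (ℚ.≤-trans (ℚ.≤-reflexive (cong₂ ℚ._+_
        (ℚ.∣p*q∣≡∣p∣*∣q∣ (seq x m) (seq y m ℚ.- seq y n))
        (ℚ.∣p*q∣≡∣p∣*∣q∣ (seq x m ℚ.- seq x n) (seq y n))))
    (ℚ.≤-trans (ℚ.+-mono-≤
        (*-mono (ℚ.0≤∣p∣ (seq y m ℚ.- seq y n)) (ℚ.<⇒≤ 0<Bx)
           (bx m (ℕ.m⊔n≤o⇒m≤o Nx Ny (hN hm)))
           (cy m n (ℕ.m⊔n≤o⇒n≤o Mx My (hM hm)) (ℕ.m⊔n≤o⇒n≤o Mx My (hM hn))))
        (*-mono (ℚ.0≤∣p∣ (seq y n)) (ℚ.<⇒≤ (0<δ k))
           (cx m n (ℕ.m⊔n≤o⇒m≤o Mx My (hM hm)) (ℕ.m⊔n≤o⇒m≤o Mx My (hM hn)))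
           (by n (ℕ.m⊔n≤o⇒n≤o Nx Ny (hN hn)))))
    (ℚ.≤-trans (ℚ.≤-reflexive (solve 3
        (λ a b e → a :* e :+ e :* b := e :* (a :+ b)) refl Bx By (δ k)))
      (proj₂ small)))))
  where
  open ℚSolver.+-*-Solver
  Bx    = proj₁ (bounded x)
  0<Bx  = proj₁ (proj₂ (bounded x))
  Nx    = proj₁ (proj₂ (proj₂ (bounded x)))
  bx    = proj₂ (proj₂ (proj₂ (bounded x)))
  By    = proj₁ (bounded y)
  0<By  = proj₁ (proj₂ (bounded y))
  Ny    = proj₁ (proj₂ (proj₂ (bounded y)))
  by    = proj₂ (proj₂ (proj₂ (bounded y)))
  small = archimedes* ε (Bx ℚ.+ By) 0<ε (0<-+ (ℚ.<⇒≤ 0<Bx) 0<By)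
  k     = proj₁ small
  Mx    = proj₁ (cauchy x (δ k) (0<δ k))
  cx    = proj₂ (cauchy x (δ k) (0<δ k))
  My    = proj₁ (cauchy y (δ k) (0<δ k))
  cy    = proj₂ (cauchy y (δ k) (0<δ k))
  hN : ∀ {n} → (Nx ℕ.⊔ Ny) ℕ.⊔ (Mx ℕ.⊔ My) ℕ.≤ n → Nx ℕ.⊔ Ny ℕ.≤ n
  hN = ℕ.m⊔n≤o⇒m≤o (Nx ℕ.⊔ Ny) (Mx ℕ.⊔ My)
  hM : ∀ {n} → (Nx ℕ.⊔ Ny) ℕ.⊔ (Mx ℕ.⊔ My) ℕ.≤ n → Mx ℕ.⊔ My ℕ.≤ n
  hM = ℕ.m⊔n≤o⇒n≤o (Nx ℕ.⊔ Ny) (Mx ℕ.⊔ My)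

-- The largest m ≤ bound satisfying P, or 0 if there is none.

greatest : {P : ℕ → Set} → (∀ m → Dec (P m)) → (bound : ℕ) → ℕ
greatest P? zero      = zero
greatest P? (suc b) = if does (P? (suc b)) then suc b else greatest P? b

greatest-holds : {P : ℕ → Set} (P? : ∀ m → Dec (P m)) → ∀ b → P 0 → P (greatest P? b)
greatest-holds P? zero    p0 = p0
greatest-holds P? (suc b) p0 with P? (suc b)
... | yes p = p
... | no  _ = greatest-holds P? b p0

greatest-max : {P : ℕ → Set} (P? : ∀ m → Dec (P m)) → ∀ b m → m ℕ.≤ b → P m → m ℕ.≤ greatest P? b
greatest-max P? zero    m h p = h
greatest-max P? (suc b) m h p with P? (suc b)
... | yes _ = h
... | no ¬p with ℕ.m≤n⇒m<n∨m≡n h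
...   | inj₁ (ℕ.s≤s m≤b) = greatest-max P? b m m≤b p
...   | inj₂ refl        = ⊥-elim (¬p p)

greatest-fails : {P : ℕ → Set} (P? : ∀ m → Dec (P m)) → ∀ b →
                 (∀ m → P m → m ℕ.≤ b) → ¬ P (suc (greatest P? b))
greatest-fails P? b bd p = ℕ.<-irrefl refl (greatest-max P? b _ (bd _ p) p)

-- log₂ n is the limit of ⌊log₂ (n ^ (k + 1))⌋ / (k + 1).

⌊log₂^⌋ : (n : ℕ) .{{_ : NonZero n}} → ℕ → ℕ
⌊log₂^⌋ n s = greatest (λ a → 2 ℕ.^ a ℕ.≤? n ℕ.^ s) (n ℕ.^ s)

n<2^n : ∀ n → n ℕ.< 2 ℕ.^ n
n<2^n zero    = ℕ.s≤s ℕ.z≤n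
n<2^n (suc n) = subst (suc (suc n) ℕ.≤_) (cong (2 ℕ.^ n ℕ.+_) (sym (ℕ.+-identityʳ _)))
  (ℕ.+-mono-≤ (ℕ.m^n>0 2 n) (n<2^n n))

⌊log₂⌋-lower : ∀ n .{{_ : NonZero n}} s → 2 ℕ.^ ⌊log₂^⌋ n s ℕ.≤ n ℕ.^ s
⌊log₂⌋-lower n s = greatest-holds (λ a → 2 ℕ.^ a ℕ.≤? n ℕ.^ s) (n ℕ.^ s) (ℕ.m^n>0 n s)

⌊log₂⌋-upper : ∀ n .{{_ : NonZero n}} s → n ℕ.^ s ℕ.< 2 ℕ.^ suc (⌊log₂^⌋ n s)
⌊log₂⌋-upper n s = ℕ.≰⇒> (greatest-fails (λ a → 2 ℕ.^ a ℕ.≤? n ℕ.^ s) (n ℕ.^ s)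
  (λ m h → ℕ.<⇒≤ (ℕ.<-≤-trans (n<2^n m) h)))

log₂-step : ∀ n .{{_ : NonZero n}} j k →
  + (⌊log₂^⌋ n (suc k)) ℚ./ suc k ℚ.≤ + (⌊log₂^⌋ n (suc j)) ℚ./ suc j ℚ.+ δ j
log₂-step n j k = subst (+ a ℚ./ suc k ℚ.≤_) (trans (cong (λ z → + z ℚ./ suc j) (sym (ℕ.+-comm b 1))) (/-+ b 1 j))
  (/-mono a (suc b) k j (ℕ.≮⇒≥ λ h → ℕ.<⇒≱ (lt) (ℕ.^-monoʳ-≤ 2 (ℕ.<⇒≤ h))))
  where
  a = ⌊log₂^⌋ n (suc k)
  b = ⌊log₂^⌋ n (suc j)
  open ℕ.≤-Reasoning
  lt : 2 ℕ.^ (a ℕ.* suc j) ℕ.< 2 ℕ.^ (suc b ℕ.* suc k)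
  lt = begin-strict
    2 ℕ.^ (a ℕ.* suc j)          ≡⟨ ℕ.^-*-assoc 2 a (suc j) ⟨
    (2 ℕ.^ a) ℕ.^ suc j          ≤⟨ ℕ.^-monoˡ-≤ (suc j) (⌊log₂⌋-lower n (suc k)) ⟩
    (n ℕ.^ suc k) ℕ.^ suc j      ≡⟨ ℕ.^-*-assoc n (suc k) (suc j) ⟩
    n ℕ.^ (suc k ℕ.* suc j)      ≡⟨ cong (n ℕ.^_) (ℕ.*-comm (suc k) (suc j)) ⟩
    n ℕ.^ (suc j ℕ.* suc k)      ≡⟨ ℕ.^-*-assoc n (suc j) (suc k) ⟨
    (n ℕ.^ suc j) ℕ.^ suc k      <⟨ ℕ.^-monoˡ-< (suc k) (⌊log₂⌋-upper n (suc j)) ⟩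
    (2 ℕ.^ suc b) ℕ.^ suc k      ≡⟨ ℕ.^-*-assoc 2 (suc b) (suc k) ⟩
    2 ℕ.^ (suc b ℕ.* suc k)      ∎

log₂ : (n : ℕ) .{{_ : NonZero n}} → ℝ
seq    (log₂ n) k = + (⌊log₂^⌋ n (suc k)) ℚ./ suc k
cauchy (log₂ n) ε 0<ε = D , λ i j hi hj → ∣-∣-≤ (step j i hj) (step i j hi)
  where
  D = proj₁ (archimedes ε 0<ε)
  step : ∀ j k → D ℕ.≤ j → seq (log₂ n) k ℚ.≤ seq (log₂ n) j ℚ.+ ε
  step j k hj = ℚ.≤-trans (log₂-step n j k)
    (ℚ.+-monoʳ-≤ (seq (log₂ n) j) (ℚ.≤-trans (δ-anti hj) (proj₂ (archimedes ε 0<ε))))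

-- Real powers b ^ x of a base b ≥ 1: the limit of ⌊(k + 1) b ^ xₖ⌋ / (k + 1).

pos neg : ℤ → ℕ
pos (+ n)    = n
pos -[1+ n ] = 0
neg (+ n)    = 0
neg -[1+ n ] = suc n

-- m ≤ s · b ^ r for r = p / q, raised to the power q and cleared of negative exponents.
Below : (s b : ℕ) → ℚ → (m : ℕ) → Set
Below s b r m =
  m ℕ.^ ↧ₙ r ℕ.* b ℕ.^ neg (↥ r) ℕ.≤ s ℕ.^ ↧ₙ r ℕ.* b ℕ.^ pos (↥ r)

below? : ∀ s b r m → Dec (Below s b r m)
below? s b r m = m ℕ.^ ↧ₙ r ℕ.* b ℕ.^ neg (↥ r) ℕ.≤? s ℕ.^ ↧ₙ r ℕ.* b ℕ.^ pos (↥ r)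

-- s · b ^ pos (↥ r) is an upper bound for s · b ^ r, used to delimit the search.
⌊·^⌋ : (s b : ℕ) → ℚ → ℕ
⌊·^⌋ s b r = greatest (below? s b r) (s ℕ.* b ℕ.^ pos (↥ r))

^-distribʳ-* : ∀ a b n → (a ℕ.* b) ℕ.^ n ≡ a ℕ.^ n ℕ.* b ℕ.^ n
^-distribʳ-* a b zero    = refl
^-distribʳ-* a b (suc n) = trans (cong (a ℕ.* b ℕ.*_) (^-distribʳ-* a b n))
  (solve 4 (λ a b c d → a :* b :* (c :* d) := a :* c :* (b :* d)) refl a b (a ℕ.^ n) (b ℕ.^ n))
  where open +-*-Solver

^-cancel-≤ : ∀ n .{{_ : NonZero n}} {a b} → a ℕ.^ n ℕ.≤ b ℕ.^ n → a ℕ.≤ b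
^-cancel-≤ n h = ℕ.≮⇒≥ λ b<a → ℕ.<⇒≱ (ℕ.^-monoˡ-< n b<a) h

⌊·^⌋-lower : ∀ s b r → Below s b r (⌊·^⌋ s b r)
⌊·^⌋-lower s b r@(ℚ.mkℚ _ _ _) = greatest-holds (below? s b r) (s ℕ.* b ℕ.^ pos (↥ r)) ℕ.z≤n

⌊·^⌋-upper : ∀ s b .{{_ : NonZero b}} r → ¬ (Below s b r (suc (⌊·^⌋ s b r)))
⌊·^⌋-upper s b r@(ℚ.mkℚ p q-1 _) = greatest-fails (below? s b r) (s ℕ.* b ℕ.^ pos p) bd
  where
  open ℕ.≤-Reasoning
  q = suc q-1
  bd : ∀ m → Below s b r m → m ℕ.≤ s ℕ.* b ℕ.^ pos p
  bd m h = ^-cancel-≤ q (begin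
    m ℕ.^ q                                ≤⟨ ℕ.m≤m*n _ _ {{ℕ.m^n≢0 b (neg p)}} ⟩
    m ℕ.^ q ℕ.* b ℕ.^ neg p                ≤⟨ h ⟩
    s ℕ.^ q ℕ.* b ℕ.^ pos p                ≤⟨ ℕ.*-monoʳ-≤ (s ℕ.^ q) (ℕ.m≤m*n _ _ {{ℕ.m^n≢0 _ q-1 {{ℕ.m^n≢0 b (pos p)}}}}) ⟩
    s ℕ.^ q ℕ.* (b ℕ.^ pos p) ℕ.^ q        ≡⟨ ^-distribʳ-* s (b ℕ.^ pos p) q ⟨
    (s ℕ.* b ℕ.^ pos p) ℕ.^ q              ∎)

bernoulli : ∀ d c n → d ℕ.^ n ℕ.* (d ℕ.+ n ℕ.* c) ℕ.≤ d ℕ.* (d ℕ.+ c) ℕ.^ n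
bernoulli d c zero = ℕ.≤-reflexive (solve 1 (λ d → con 1 :* (d :+ con 0) := d :* con 1) refl d)
  where open +-*-Solver
bernoulli d c (suc n) = begin
  d ℕ.* d ℕ.^ n ℕ.* (d ℕ.+ (c ℕ.+ n ℕ.* c))
    ≤⟨ ℕ.m≤m+n _ (d ℕ.^ n ℕ.* (n ℕ.* c ℕ.* c)) ⟩
  d ℕ.* d ℕ.^ n ℕ.* (d ℕ.+ (c ℕ.+ n ℕ.* c)) ℕ.+ d ℕ.^ n ℕ.* (n ℕ.* c ℕ.* c)
    ≡⟨ solve 4 (λ d c n D → d :* D :* (d :+ (c :+ n :* c)) :+ D :* (n :* c :* c)
                  := (d :+ c) :* (D :* (d :+ n :* c))) refl d c n (d ℕ.^ n) ⟩
  (d ℕ.+ c) ℕ.* (d ℕ.^ n ℕ.* (d ℕ.+ n ℕ.* c))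
    ≤⟨ ℕ.*-monoʳ-≤ (d ℕ.+ c) (bernoulli d c n) ⟩
  (d ℕ.+ c) ℕ.* (d ℕ.* (d ℕ.+ c) ℕ.^ n)
    ≡⟨ solve 3 (λ d e E → e :* (d :* E) := d :* (e :* E)) refl d (d ℕ.+ c) ((d ℕ.+ c) ℕ.^ n) ⟩
  d ℕ.* ((d ℕ.+ c) ℕ.* (d ℕ.+ c) ℕ.^ n) ∎
  where
  open +-*-Solver
  open ℕ.≤-Reasoning

-- (1 + c / d) ^ d ≥ 1 + c
bernoulli-root : ∀ d .{{_ : NonZero d}} c → d ℕ.^ d ℕ.* suc c ℕ.≤ (d ℕ.+ c) ℕ.^ d
bernoulli-root d c = ℕ.*-cancelˡ-≤ d (ℕ.≤-trans
  (ℕ.≤-reflexive (solve 3 (λ d c D → d :* (D :* (con 1 :+ c)) := D :* (d :+ d :* c)) refl d c (d ℕ.^ d)))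
  (bernoulli d c d))
  where open +-*-Solver

private
  clearˡ : ∀ a b B t D → (a ℤ.- b) ℤ.* (t ℤ.* D) ℤ.+ (b ℤ.* (t ℤ.* D) ℤ.+ B) ≡ a ℤ.* (t ℤ.* D) ℤ.+ B
  clearˡ = solve 5 (λ a b B t D →
    (a :- b) :* (t :* D) :+ (b :* (t :* D) :+ B) := a :* (t :* D) :+ B) refl
    where open ℤSolver.+-*-Solver

  clearʳ : ∀ A B b s t D →
    ((A ℤ.- B) ℤ.* D ℤ.+ + 1 ℤ.* t) ℤ.* s ℤ.+ (b ℤ.* (t ℤ.* D) ℤ.+ B ℤ.* (s ℤ.* D))
    ≡ A ℤ.* (s ℤ.* D) ℤ.+ s ℤ.* t ℤ.+ b ℤ.* (t ℤ.* D)
  clearʳ = solve 6 (λ A B b s t D →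
    ((A :- B) :* D :+ con (+ 1) :* t) :* s :+ (b :* (t :* D) :+ B :* (s :* D))
      := A :* (s :* D) :+ s :* t :+ b :* (t :* D)) refl
    where open ℤSolver.+-*-Solver

  pos-neg : ∀ i → i ≡ + pos i ℤ.- + neg i
  pos-neg (+ n)    = sym (ℤ.+-identityʳ (+ n))
  pos-neg -[1+ n ] = refl

  pos-*₃ : ∀ a b c → + (a ℕ.* (b ℕ.* c)) ≡ + a ℤ.* (+ b ℤ.* + c)
  pos-*₃ a b c = trans (ℤ.pos-* a (b ℕ.* c)) (cong (+ a ℤ.*_) (ℤ.pos-* b c))

  -- p / s ≤ P / t + 1 / D in terms of natural numbers
  clear : ∀ p P s t D → p ℤ.* + (t ℕ.* D) ℤ.≤ (P ℤ.* + D ℤ.+ + 1 ℤ.* + t) ℤ.* + s →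
    pos p ℕ.* (t ℕ.* D) ℕ.+ neg P ℕ.* (s ℕ.* D)
    ℕ.≤ pos P ℕ.* (s ℕ.* D) ℕ.+ s ℕ.* t ℕ.+ neg p ℕ.* (t ℕ.* D)
  clear p P s t D h = ℤ.drop‿+≤+ (subst₂ ℤ._≤_
      (trans (clearˡ (+ pos p) (+ neg p) (+ neg P ℤ.* (+ s ℤ.* + D)) (+ t) (+ D)) (sym lhs))
      (trans (clearʳ (+ pos P) (+ neg P) (+ neg p) (+ s) (+ t) (+ D)) (sym rhs))
      (ℤ.+-monoˡ-≤ (+ neg p ℤ.* (+ t ℤ.* + D) ℤ.+ + neg P ℤ.* (+ s ℤ.* + D))
        (subst₂ ℤ._≤_
          (cong₂ ℤ._*_ (pos-neg p) (ℤ.pos-* t D))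
          (cong (λ z → (z ℤ.* + D ℤ.+ + 1 ℤ.* + t) ℤ.* + s) (pos-neg P)) h)))
    where
    lhs : + (pos p ℕ.* (t ℕ.* D) ℕ.+ neg P ℕ.* (s ℕ.* D))
          ≡ + pos p ℤ.* (+ t ℤ.* + D) ℤ.+ + neg P ℤ.* (+ s ℤ.* + D)
    lhs = trans (ℤ.pos-+ (pos p ℕ.* (t ℕ.* D)) (neg P ℕ.* (s ℕ.* D)))
      (cong₂ ℤ._+_ (pos-*₃ (pos p) t D) (pos-*₃ (neg P) s D))
    rhs : + (pos P ℕ.* (s ℕ.* D) ℕ.+ s ℕ.* t ℕ.+ neg p ℕ.* (t ℕ.* D))
          ≡ + pos P ℤ.* (+ s ℤ.* + D) ℤ.+ + s ℤ.* + t ℤ.+ + neg p ℤ.* (+ t ℤ.* + D)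
    rhs = trans (ℤ.pos-+ (pos P ℕ.* (s ℕ.* D) ℕ.+ s ℕ.* t) (neg p ℕ.* (t ℕ.* D)))
      (cong₂ ℤ._+_
        (trans (ℤ.pos-+ (pos P ℕ.* (s ℕ.* D)) (s ℕ.* t))
          (cong₂ ℤ._+_ (pos-*₃ (pos P) s D) (ℤ.pos-* s t)))
        (pos-*₃ (neg p) t D))

≤+δ⇒ℕ : ∀ r r′ d → r ℚ.≤ r′ ℚ.+ δ d →
  pos (↥ r) ℕ.* (↧ₙ r′ ℕ.* suc d) ℕ.+ neg (↥ r′) ℕ.* (↧ₙ r ℕ.* suc d)
  ℕ.≤ pos (↥ r′) ℕ.* (↧ₙ r ℕ.* suc d) ℕ.+ ↧ₙ r ℕ.* ↧ₙ r′ ℕ.+ neg (↥ r) ℕ.* (↧ₙ r′ ℕ.* suc d)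
≤+δ⇒ℕ r@record{} r′@record{} d h = clear (↥ r) (↥ r′) (↧ₙ r) (↧ₙ r′) (suc d) (ℚᵘ.drop-*≤* hᵘ)
  where
  hᵘ : ℚ.toℚᵘ r ℚᵘ.≤ ℚ.toℚᵘ r′ ℚᵘ.+ mkℚᵘ (+ 1) d
  hᵘ = ℚᵘ.≤-respʳ-≃
    (ℚᵘ.≃-trans (ℚ.toℚᵘ-homo-+ r′ (δ d)) (ℚᵘ.+-congʳ (ℚ.toℚᵘ r′) (ℚ.toℚᵘ-fromℚᵘ (mkℚᵘ (+ 1) d))))
    (ℚ.toℚᵘ-mono-≤ h)

private
  interchange : ∀ a b c d → a ℕ.* b ℕ.* (c ℕ.* d) ≡ a ℕ.* c ℕ.* (b ℕ.* d)
  interchange = solve 4 (λ a b c d → a :* b :* (c :* d) := a :* c :* (b :* d)) refl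
    where open +-*-Solver

  ^-scale : ∀ m b e f n → (m ℕ.^ e ℕ.* b ℕ.^ f) ℕ.^ n ≡ m ℕ.^ (e ℕ.* n) ℕ.* b ℕ.^ (f ℕ.* n)
  ^-scale m b e f n = trans (^-distribʳ-* (m ℕ.^ e) (b ℕ.^ f) n)
    (cong₂ ℕ._*_ (ℕ.^-*-assoc m e n) (ℕ.^-*-assoc b f n))

-- If m ≤ s · b ^ r and t · b ^ r′ ≤ n with r ≤ r′ + 1 / D, then m / s ≤ (n / t) (1 + c / D),
-- where b = 1 + c; q, q′ are the denominators and p ± , P ± the signed parts of the numerators.
power-core : ∀ c D .{{_ : NonZero D}} m s n t q q′ .{{_ : NonZero q}} .{{_ : NonZero q′}} p⁺ p⁻ P⁺ P⁻ →
  m ℕ.^ q ℕ.* suc c ℕ.^ p⁻ ℕ.≤ s ℕ.^ q ℕ.* suc c ℕ.^ p⁺ →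
  t ℕ.^ q′ ℕ.* suc c ℕ.^ P⁺ ℕ.≤ n ℕ.^ q′ ℕ.* suc c ℕ.^ P⁻ →
  p⁺ ℕ.* (q′ ℕ.* D) ℕ.+ P⁻ ℕ.* (q ℕ.* D) ℕ.≤ P⁺ ℕ.* (q ℕ.* D) ℕ.+ q ℕ.* q′ ℕ.+ p⁻ ℕ.* (q′ ℕ.* D) →
  m ℕ.* t ℕ.* D ℕ.≤ s ℕ.* n ℕ.* (D ℕ.+ c)
power-core c D m s n t q q′ p⁺ p⁻ P⁺ P⁻ below above h =
  ^-cancel-≤ E {{ℕ.m*n≢0 (q ℕ.* q′) D {{ℕ.m*n≢0 q q′}}}} (begin
    (m ℕ.* t ℕ.* D) ℕ.^ E              ≡⟨ ^-distribʳ-* (m ℕ.* t) D E ⟩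
    (m ℕ.* t) ℕ.^ E ℕ.* D ℕ.^ E        ≤⟨ ℕ.*-monoˡ-≤ (D ℕ.^ E) step₁ ⟩
    (s ℕ.* n) ℕ.^ E ℕ.* b ℕ.^ (q ℕ.* q′) ℕ.* D ℕ.^ E
      ≡⟨ ℕ.*-assoc ((s ℕ.* n) ℕ.^ E) _ _ ⟩
    (s ℕ.* n) ℕ.^ E ℕ.* (b ℕ.^ (q ℕ.* q′) ℕ.* D ℕ.^ E)
      ≤⟨ ℕ.*-monoʳ-≤ ((s ℕ.* n) ℕ.^ E) step₂ ⟩
    (s ℕ.* n) ℕ.^ E ℕ.* (D ℕ.+ c) ℕ.^ E ≡⟨ ^-distribʳ-* (s ℕ.* n) (D ℕ.+ c) E ⟨
    (s ℕ.* n ℕ.* (D ℕ.+ c)) ℕ.^ E      ∎)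
  where
  open ℕ.≤-Reasoning
  open +-*-Solver using (solve; _:*_; _:+_; _:=_)
  b = suc c
  Q = q ℕ.* q′
  E = Q ℕ.* D
  x = p⁺ ℕ.* (q′ ℕ.* D)
  y = p⁻ ℕ.* (q′ ℕ.* D)
  X = P⁺ ℕ.* (q ℕ.* D)
  Y = P⁻ ℕ.* (q ℕ.* D)
  E₁ : q ℕ.* (q′ ℕ.* D) ≡ E
  E₁ = sym (ℕ.*-assoc q q′ D)
  E₂ : q′ ℕ.* (q ℕ.* D) ≡ E
  E₂ = solve 3 (λ q r d → r :* (q :* d) := q :* r :* d) refl q q′ D
  below′ : m ℕ.^ E ℕ.* b ℕ.^ y ℕ.≤ s ℕ.^ E ℕ.* b ℕ.^ x
  below′ = subst (λ e → m ℕ.^ e ℕ.* b ℕ.^ y ℕ.≤ s ℕ.^ e ℕ.* b ℕ.^ x) E₁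
    (subst₂ ℕ._≤_ (^-scale m b q p⁻ (q′ ℕ.* D)) (^-scale s b q p⁺ (q′ ℕ.* D))
      (ℕ.^-monoˡ-≤ (q′ ℕ.* D) below))
  above′ : t ℕ.^ E ℕ.* b ℕ.^ X ℕ.≤ n ℕ.^ E ℕ.* b ℕ.^ Y
  above′ = subst (λ e → t ℕ.^ e ℕ.* b ℕ.^ X ℕ.≤ n ℕ.^ e ℕ.* b ℕ.^ Y) E₂
    (subst₂ ℕ._≤_ (^-scale t b q′ P⁺ (q ℕ.* D)) (^-scale n b q′ P⁻ (q ℕ.* D))
      (ℕ.^-monoˡ-≤ (q ℕ.* D) above))
  step₁ : (m ℕ.* t) ℕ.^ E ℕ.≤ (s ℕ.* n) ℕ.^ E ℕ.* b ℕ.^ Q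
  step₁ = ℕ.*-cancelʳ-≤ _ _ (b ℕ.^ (X ℕ.+ y)) {{ℕ.m^n≢0 b (X ℕ.+ y)}} (begin
    (m ℕ.* t) ℕ.^ E ℕ.* b ℕ.^ (X ℕ.+ y)
      ≡⟨ cong₂ ℕ._*_ (^-distribʳ-* m t E)
           (trans (cong (b ℕ.^_) (ℕ.+-comm X y)) (ℕ.^-distribˡ-+-* b y X)) ⟩
    m ℕ.^ E ℕ.* t ℕ.^ E ℕ.* (b ℕ.^ y ℕ.* b ℕ.^ X)
      ≡⟨ interchange (m ℕ.^ E) (t ℕ.^ E) (b ℕ.^ y) (b ℕ.^ X) ⟩
    m ℕ.^ E ℕ.* b ℕ.^ y ℕ.* (t ℕ.^ E ℕ.* b ℕ.^ X)
      ≤⟨ ℕ.*-mono-≤ below′ above′ ⟩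
    s ℕ.^ E ℕ.* b ℕ.^ x ℕ.* (n ℕ.^ E ℕ.* b ℕ.^ Y)
      ≡⟨ interchange (s ℕ.^ E) (b ℕ.^ x) (n ℕ.^ E) (b ℕ.^ Y) ⟩
    s ℕ.^ E ℕ.* n ℕ.^ E ℕ.* (b ℕ.^ x ℕ.* b ℕ.^ Y)
      ≡⟨ cong₂ ℕ._*_ (^-distribʳ-* s n E) (ℕ.^-distribˡ-+-* b x Y) ⟨
    (s ℕ.* n) ℕ.^ E ℕ.* b ℕ.^ (x ℕ.+ Y)
      ≤⟨ ℕ.*-monoʳ-≤ ((s ℕ.* n) ℕ.^ E) (ℕ.^-monoʳ-≤ b h) ⟩
    (s ℕ.* n) ℕ.^ E ℕ.* b ℕ.^ (X ℕ.+ Q ℕ.+ y)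
      ≡⟨ cong (λ z → (s ℕ.* n) ℕ.^ E ℕ.* b ℕ.^ z)
           (solve 3 (λ X Q y → X :+ Q :+ y := Q :+ (X :+ y)) refl X Q y) ⟩
    (s ℕ.* n) ℕ.^ E ℕ.* b ℕ.^ (Q ℕ.+ (X ℕ.+ y))
      ≡⟨ cong ((s ℕ.* n) ℕ.^ E ℕ.*_) (ℕ.^-distribˡ-+-* b Q (X ℕ.+ y)) ⟩
    (s ℕ.* n) ℕ.^ E ℕ.* (b ℕ.^ Q ℕ.* b ℕ.^ (X ℕ.+ y))
      ≡⟨ ℕ.*-assoc ((s ℕ.* n) ℕ.^ E) (b ℕ.^ Q) (b ℕ.^ (X ℕ.+ y)) ⟨
    (s ℕ.* n) ℕ.^ E ℕ.* b ℕ.^ Q ℕ.* b ℕ.^ (X ℕ.+ y) ∎)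
  step₂ : b ℕ.^ Q ℕ.* D ℕ.^ E ℕ.≤ (D ℕ.+ c) ℕ.^ E
  step₂ = begin
    b ℕ.^ Q ℕ.* D ℕ.^ E               ≡⟨ ℕ.*-comm (b ℕ.^ Q) (D ℕ.^ E) ⟩
    D ℕ.^ E ℕ.* b ℕ.^ Q               ≡⟨ cong (λ e → D ℕ.^ e ℕ.* b ℕ.^ Q) (ℕ.*-comm Q D) ⟩
    D ℕ.^ (D ℕ.* Q) ℕ.* b ℕ.^ Q       ≡⟨ cong (ℕ._* b ℕ.^ Q) (ℕ.^-*-assoc D D Q) ⟨
    (D ℕ.^ D) ℕ.^ Q ℕ.* b ℕ.^ Q       ≡⟨ ^-distribʳ-* (D ℕ.^ D) b Q ⟨
    (D ℕ.^ D ℕ.* b) ℕ.^ Q             ≤⟨ ℕ.^-monoˡ-≤ Q (bernoulli-root D c) ⟩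
    ((D ℕ.+ c) ℕ.^ D) ℕ.^ Q           ≡⟨ ℕ.^-*-assoc (D ℕ.+ c) D Q ⟩
    (D ℕ.+ c) ℕ.^ (D ℕ.* Q)           ≡⟨ cong ((D ℕ.+ c) ℕ.^_) (ℕ.*-comm D Q) ⟩
    (D ℕ.+ c) ℕ.^ E                   ∎

-- The k-th approximation to b ^ x when r is the k-th approximation to x.
approx : ℕ → ℕ → ℚ → ℚ
approx b k r = + (⌊·^⌋ (suc k) b r) ℚ./ suc k

approx-step : ∀ c j k d r r′ → r ℚ.≤ r′ ℚ.+ δ d →
  approx (suc c) k r ℚ.≤ (approx (suc c) j r′ ℚ.+ δ j) ℚ.* (1ℚ ℚ.+ (+ c ℚ./ 1) ℚ.* δ d)
approx-step c j k d r r′ h = subst (approx (suc c) k r ℚ.≤_) e≡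
  (/-mono m (suc n ℕ.* (suc d ℕ.+ c)) k (d ℕ.+ j ℕ.* suc d) (begin
    m ℕ.* (suc j ℕ.* suc d)               ≡⟨ ℕ.*-assoc m (suc j) (suc d) ⟨
    m ℕ.* suc j ℕ.* suc d
      ≤⟨ power-core c (suc d) m (suc k) (suc n) (suc j) (↧ₙ r) (↧ₙ r′)
           (pos (↥ r)) (neg (↥ r)) (pos (↥ r′)) (neg (↥ r′))
           (⌊·^⌋-lower (suc k) (suc c) r)
           (ℕ.<⇒≤ (ℕ.≰⇒> (⌊·^⌋-upper (suc j) (suc c) r′)))
           (≤+δ⇒ℕ r r′ d h) ⟩
    suc k ℕ.* suc n ℕ.* (suc d ℕ.+ c)     ≡⟨ ℕ.*-assoc (suc k) (suc n) (suc d ℕ.+ c) ⟩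
    suc k ℕ.* (suc n ℕ.* (suc d ℕ.+ c))   ≡⟨ ℕ.*-comm (suc k) (suc n ℕ.* (suc d ℕ.+ c)) ⟩
    suc n ℕ.* (suc d ℕ.+ c) ℕ.* suc k     ∎))
  where
  open ℕ.≤-Reasoning
  m = ⌊·^⌋ (suc k) (suc c) r
  n = ⌊·^⌋ (suc j) (suc c) r′
  c/d : + c ℚ./ suc d ≡ (+ c ℚ./ 1) ℚ.* δ d
  c/d = trans (cong₂ (λ u v → (+ u ℚ./ suc v)) (sym (ℕ.*-identityʳ c)) (sym (ℕ.+-identityʳ d))) (/-* c 1 0 d)
  e≡ : + (suc n ℕ.* (suc d ℕ.+ c)) ℚ./ (suc j ℕ.* suc d)
       ≡ (approx (suc c) j r′ ℚ.+ δ j) ℚ.* (1ℚ ℚ.+ (+ c ℚ./ 1) ℚ.* δ d)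
  e≡ = trans (/-* (suc n) (suc d ℕ.+ c) j d) (cong₂ ℚ._*_
    (trans (cong (λ z → + z ℚ./ suc j) (sym (ℕ.+-comm n 1))) (/-+ n 1 j))
    (trans (/-+ (suc d) c d) (cong₂ ℚ._+_ (/-diag d) c/d)))

infixr 8 _^ᴿ_

_^ᴿ_ : (b : ℕ) .{{_ : NonZero b}} → ℝ → ℝ
seq    (b ^ᴿ x) k = approx b k (seq x k)
cauchy (suc c ^ᴿ x) ε 0<ε = N , λ i j hi hj → ∣-∣-≤ (step j i hj hi) (step i j hi hj)
  where
  open ℚSolver.+-*-Solver
  e : ℕ → ℚ
  e k = approx (suc c) k (seq x k)
  C = + c ℚ./ 1
  0≤C : 0ℚ ℚ.≤ C
  0≤C = /-0≤ c 0
  factor : ℕ → ℚ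
  factor d = 1ℚ ℚ.+ C ℚ.* δ d
  0≤e+δ : ∀ j → 0ℚ ℚ.≤ e j ℚ.+ δ j
  0≤e+δ j = ℚ.+-mono-≤ (/-0≤ (⌊·^⌋ (suc j) (suc c) (seq x j)) j) (ℚ.<⇒≤ (0<δ j))
  N₀ = proj₁ (cauchy x (δ 0) (0<δ 0))
  B = (e N₀ ℚ.+ δ N₀) ℚ.* factor 0
  0≤B : 0ℚ ℚ.≤ B
  0≤B = 0≤-* (0≤e+δ N₀)
    (ℚ.+-mono-≤ (ℚ.<⇒≤ (ℚ.positive⁻¹ 1ℚ)) (0≤-* 0≤C (ℚ.<⇒≤ (0<δ 0))))
  e≤B : ∀ k → N₀ ℕ.≤ k → e k ℚ.≤ B
  e≤B k hk = approx-step c N₀ k 0 (seq x k) (seq x N₀)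
    (≤-from-∣-∣ (proj₂ (cauchy x (δ 0) (0<δ 0)) k N₀ hk ℕ.≤-refl))
  K = C ℚ.* (B ℚ.+ 1ℚ) ℚ.+ 1ℚ
  0<K : 0ℚ ℚ.< K
  0<K = 0<-+ (0≤-* 0≤C (ℚ.<⇒≤ (0<-+ 0≤B (ℚ.positive⁻¹ 1ℚ)))) (ℚ.positive⁻¹ 1ℚ)
  small = archimedes* ε K 0<ε 0<K
  D = proj₁ small
  N₁ = proj₁ (cauchy x (δ D) (0<δ D))
  N = N₀ ℕ.⊔ (N₁ ℕ.⊔ D)
  ≥N₀ : ∀ {i} → N ℕ.≤ i → N₀ ℕ.≤ i
  ≥N₀ = ℕ.m⊔n≤o⇒m≤o N₀ (N₁ ℕ.⊔ D)
  ≥N₁ : ∀ {i} → N ℕ.≤ i → N₁ ℕ.≤ i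
  ≥N₁ h = ℕ.m⊔n≤o⇒m≤o N₁ D (ℕ.m⊔n≤o⇒n≤o N₀ (N₁ ℕ.⊔ D) h)
  ≥D : ∀ {i} → N ℕ.≤ i → D ℕ.≤ i
  ≥D h = ℕ.m⊔n≤o⇒n≤o N₁ D (ℕ.m⊔n≤o⇒n≤o N₀ (N₁ ℕ.⊔ D) h)
  δ≤1 : ∀ j → δ j ℚ.≤ 1ℚ
  δ≤1 j = δ-anti {0} {j} ℕ.z≤n
  step : ∀ j k → N ℕ.≤ j → N ℕ.≤ k → e k ℚ.≤ e j ℚ.+ ε
  step j k hj hk = ℚ.≤-trans
    (approx-step c j k D (seq x k) (seq x j)
      (≤-from-∣-∣ (proj₂ (cauchy x (δ D) (0<δ D)) k j (≥N₁ hk) (≥N₁ hj))))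
    (ℚ.≤-trans (ℚ.≤-reflexive (solve 4
        (λ a b C d → (a :+ b) :* (con 1ℚ :+ C :* d) := a :+ (b :+ (C :* d) :* (a :+ b)))
        refl (e j) (δ j) C (δ D)))
    (ℚ.+-monoʳ-≤ (e j)
      (ℚ.≤-trans (ℚ.+-mono-≤ (δ-anti (≥D hj))
          (*-mono (0≤e+δ j) (0≤-* 0≤C (ℚ.<⇒≤ (0<δ D))) ℚ.≤-refl
            (ℚ.+-mono-≤ (e≤B j (≥N₀ hj)) (δ≤1 j))))
        (ℚ.≤-trans (ℚ.≤-reflexive (solve 3
            (λ d C B → d :+ C :* d :* (B :+ con 1ℚ) := d :* (C :* (B :+ con 1ℚ) :+ con 1ℚ))
            refl (δ D) C B))
          (proj₂ small)))))

-- Planar point configurations. "≠" on ℝ is read as apartness throughout.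

record Point : Set where
  constructor mkPoint
  field
    xᶜ yᶜ : ℝ

open Point public

_#ᴾ_ : Point → Point → Set
p #ᴾ q = xᶜ p # xᶜ q ⊎ yᶜ p # yᶜ q

-- The line a x + b y = c with (a , b) ≠ (0 , 0).
record Line : Set where
  field
    a b c         : ℝ
    nondegenerate : a # 0ᴿ ⊎ b # 0ᴿ

_Misses_ : Line → Point → Set
ℓ Misses p = Line.a ℓ *ᴿ xᶜ p +ᴿ Line.b ℓ *ᴿ yᶜ p # Line.c ℓ

Distinct : ∀ {N} → Vector Point N → Set
Distinct p = ∀ i j → i ≢ j → p i #ᴾ p j

-- No line passes through three points: each line misses one of any three.
GeneralPosition : ∀ {N} → Vector Point N → Set
GeneralPosition p = ∀ i j k → i ≢ j → j ≢ k → i ≢ k → (ℓ : Line) →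
  ℓ Misses p i ⊎ ℓ Misses p j ⊎ ℓ Misses p k

sumᴿ : ∀ {m} → Vector ℝ m → ℝ
sumᴿ = foldr _+ᴿ_ 0ᴿ

InConvexHull : ∀ {m} → Vector Point m → Point → Set
InConvexHull {m} p q = Σ[ w ∈ Vector ℝ m ]
  (∀ j → 0ᴿ ≤ᴿ w j) ×
  sumᴿ w ≃ 1ᴿ ×
  sumᴿ (λ j → w j *ᴿ xᶜ (p j)) ≃ xᶜ q ×
  sumᴿ (λ j → w j *ᴿ yᶜ (p j)) ≃ yᶜ q

ConvexPosition : ∀ {m} → Vector Point m → Set
ConvexPosition {zero}  p = ⊤
ConvexPosition {suc m} p = ∀ i → ¬ InConvexHull (removeAt p i) (p i)

-- Any N points in general position contain n points in convex position.
Forces : (n N : ℕ) → Set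
Forces n N = (p : Vector Point N) → Distinct p → GeneralPosition p →
  Σ[ f ∈ (Fin n → Fin N) ] Injective _≡_ _≡_ f × ConvexPosition (p ∘ f)

-- N = ES(n)
IsES : (n N : ℕ) → Set
IsES n N = Forces n N × (∀ M → Forces n M → N ℕ.≤ M)

-- ES(n) ≤ b. A least N with Forces n N cannot in general be computed from one that is merely
-- known to satisfy it, so the existence of ES(n) is rendered by some N ≤ b with Forces n N
-- alongside the bound on ES(n) itself. Classically, as ES(n) exists, each conjunct is
-- equivalent to ES(n) ≤ b.
ES[_]≤_ : ℕ → ℝ → Set
ES[ n ]≤ b = (∃[ N ] Forces n N × fromℕ N ≤ᴿ b) × (∀ N → IsES n N → fromℕ N ≤ᴿ b)

{-# OPTIONS --safe #-}

-- Suk's proof, written in terms of the orientations of triples of points.  Every transversal of a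
-- partition into blocks contains a large cap or cup.  Averaging over the transversals fixes every
-- second point of one such cap, x₀, x₁, …, so that most of the sets Tᵢ of points by which it can be
-- extended between xᵢ and xᵢ₊₁ are large.  Order the points of Tᵢ by p ≺ q if q lies in the triangle
-- spanned by p and the segment xᵢ₋₁ xᵢ₊₂.  If Tᵢ has a large antichain, then it contains an n-gon or
-- a cap all of whose secants miss the segment; such caps from Tᵢ with sufficiently distant indices i
-- combine to a single cap.  Otherwise many consecutive Tᵢ have large chains.  Among chains, a cup in
-- Tᵢ and a cap in Tᵢ₊₁ combine to a convex polygon, so that unless there is an n-gon, the size of the
-- cups grows with i.  Real points enter only through rational approximations which are so close that
-- the orientations are those of the points themselves.
module Submission where

open import Defs
open import Data.Bool.Base using (if_then_else_)
open import Data.Empty using (⊥-elim)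
open import Data.Fin.Base as Fin using (Fin; zero; suc; toℕ)
import Data.Fin.Properties as Fin
open import Data.Integer.Base as ℤ using (+_)
import Data.Integer.Properties as ℤ
open import Data.List.Base as List using (List; []; _∷_; _++_; length; map; filter; lookup; allFin)
open import Data.List.Membership.Propositional using (_∈_; find)
open import Data.List.Membership.Propositional.Properties using (∈-filter⁻; ∈-lookup)
import Data.List.Membership.DecPropositional as DecMembership
import Data.List.Properties as List
open import Data.List.Relation.Unary.All as All using (All; []; _∷_)
import Data.List.Relation.Unary.All.Properties as All
open import Data.List.Relation.Unary.AllPairs as AllPairs using (AllPairs; []; _∷_)
import Data.List.Relation.Unary.AllPairs.Properties as AllPairs
open import Data.List.Relation.Unary.Any using (here; there)
open import Data.Nat.Base
  using (ℕ; zero; suc; _+_; _*_; _∸_; _^_; _≤_; _<_; _≥_; _>_; z≤n; s≤s; NonZero; _⊔_)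
import Data.Nat.Properties as ℕ
open import Algebra.Properties.Semiring.Sum ℕ.+-*-semiring
  using (sum; sum-cong-≗; ∑-comm; *-distribˡ-sum; *-distribʳ-sum)
open import Data.Nat.Solver using (module +-*-Solver)
open import Data.Product.Base using (Σ-syntax; ∃-syntax; _×_; _,_; proj₁; proj₂)
open import Data.Rational.Base as ℚ using (ℚ; 0ℚ; 1ℚ; _/_)
import Data.Rational.Properties as ℚ
import Data.Rational.Solver as ℚSolver
open import Data.Rational.Unnormalised.Base using (mkℚᵘ)
import Data.Rational.Unnormalised.Properties as ℚᵘ
open import Data.Sum.Base using (_⊎_; inj₁; inj₂; [_,_]′)
open import Data.Unit.Base using (⊤; tt)
open import Data.Vec.Base as Vec using (Vec; []; _∷_)
open import Data.Vec.Functional using (Vector; removeAt)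
import Data.Vec.Properties as Vec
open import Function.Base using (_∘_; flip)
open import Function.Definitions using (Injective)
open import Relation.Binary.Definitions using (tri<; tri≈; tri>)
open import Relation.Binary.PropositionalEquality
  using (_≡_; _≢_; refl; sym; trans; cong; cong₂; subst; subst₂; ≢-sym)
open import Relation.Nullary using (¬_; Dec; yes; no; does; contradiction)
open import Relation.Nullary.Decidable using (map′; _×-dec_; _→-dec_; ¬?)

-- The exponent is a balance. If antichains supply caps of `s` points and cups grow by `d` from one
-- set to the next, about `n / s` blocks of about `n / d` sets are needed, so the comb has about
-- `n² / (s d)` teeth. Extracting it costs a number of bits proportional to its length; a chain
-- needs about `2 ^ (n + d)` points; forcing a cap of `s` or a cup of `n` points costs about
-- `s log n` bits. With `c` the integer cube root of `n`, taking `s`, `d` and the length all of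
-- order `c²` leaves `n` plus a multiple of `c² log n`. No coordinate axis is needed: points are
-- sorted by angle around an extreme point, and a cup read backwards is counterclockwise like a cap,
-- so a comb obtained from either has the same form. The sign of a real number cannot be decided.
-- General position supplies the signs through apartness, and as there are finitely many triples,
-- one stage of the sequences settles them all.

-- Lists

AllTriples : {A : Set} → (A → A → A → Set) → List A → Set
AllTriples R []       = ⊤
AllTriples R (x ∷ xs) = AllPairs (R x) xs × AllTriples R xs

AllTriples-map : {A B : Set} {R : B → B → B → Set} {f : A → B} (xs : List A) →
  AllTriples (λ x y z → R (f x) (f y) (f z)) xs → AllTriples R (map f xs)
AllTriples-map []       _       = tt
AllTriples-map (x ∷ xs) (p , t) = AllPairs.map⁺ p , AllTriples-map xs t

AllTriples-++ : {A : Set} {R : A → A → A → Set} (xs ys : List A) →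
  AllTriples R xs → AllTriples R ys →
  AllPairs (λ x y → All (R x y) ys) xs → All (λ x → AllPairs (R x) ys) xs →
  AllTriples R (xs ++ ys)
AllTriples-++ []       ys _       u _        _        = u
AllTriples-++ (x ∷ xs) ys (p , t) u (h ∷ hs) (k ∷ ks) =
  AllPairs.++⁺ p k h , AllTriples-++ xs ys t u hs ks

allTriples? : {A : Set} {R : A → A → A → Set} → (∀ x y z → Dec (R x y z)) →
  ∀ xs → Dec (AllTriples R xs)
allTriples? R? []       = yes tt
allTriples? R? (x ∷ xs) = AllPairs.allPairs? (R? x) xs ×-dec allTriples? R? xs

AllPairs-lookup : {A : Set} {R : A → A → Set} (xs : List A) → AllPairs R xs →
  ∀ {i j} → i Fin.< j → R (lookup xs i) (lookup xs j)
AllPairs-lookup (x ∷ xs) (p ∷ ps) {zero}  {suc j} _         = All.lookup p (∈-lookup j)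
AllPairs-lookup (x ∷ xs) (p ∷ ps) {suc i} {suc j} (s≤s i<j) = AllPairs-lookup xs ps i<j

AllTriples-lookup : {A : Set} {R : A → A → A → Set} (xs : List A) → AllTriples R xs →
  ∀ {i j k} → i Fin.< j → j Fin.< k → R (lookup xs i) (lookup xs j) (lookup xs k)
AllTriples-lookup (x ∷ xs) (p , t) {zero}  {suc j} {suc k} _         (s≤s j<k) =
  AllPairs-lookup xs p j<k
AllTriples-lookup (x ∷ xs) (p , t) {suc i} {suc j} {suc k} (s≤s i<j) (s≤s j<k) =
  AllTriples-lookup xs t i<j j<k

AllPairs-universal : {A : Set} {P : A → Set} {R : A → A → Set} → (∀ {x y} → P x → P y → R x y) →
  ∀ {xs} → All P xs → AllPairs R xs
AllPairs-universal f []         = []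
AllPairs-universal f (px ∷ pxs) = All.map (f px) pxs ∷ AllPairs-universal f pxs

AllPairs-mapWith : {A : Set} {P : A → Set} {R S : A → A → Set} →
  (∀ {x y} → P x → P y → R x y → S x y) → ∀ {xs} → All P xs → AllPairs R xs → AllPairs S xs
AllPairs-mapWith f []         []       = []
AllPairs-mapWith f (px ∷ pxs) (r ∷ rs) =
  All.zipWith (λ (py , rxy) → f px py rxy) (pxs , r) ∷ AllPairs-mapWith f pxs rs

length-filter-split : {A : Set} {P : A → Set} (P? : ∀ x → Dec (P x)) (xs : List A) →
  length xs ≡ length (filter P? xs) + length (filter (¬? ∘ P?) xs)
length-filter-split P? []       = refl
length-filter-split P? (x ∷ xs) with P? x
... | yes _ = cong suc (length-filter-split P? xs)
... | no  _ = trans (cong suc (length-filter-split P? xs)) (sym (ℕ.+-suc _ _))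

+-≤-split : ∀ a b {x y} → a + b ≤ x + y → a ≤ x ⊎ b ≤ y
+-≤-split a b {x} {y} h with a ℕ.≤? x | b ℕ.≤? y
... | yes p | _     = inj₁ p
... | no  _ | yes q = inj₂ q
... | no  p | no  q = contradiction h (ℕ.<⇒≱ (ℕ.+-mono-< (ℕ.≰⇒> p) (ℕ.≰⇒> q)))

anyList? : ∀ {M} k {P : List (Fin M) → Set} → (∀ u → Dec (P u)) →
  Dec (∃[ u ] (P u × length u ≡ k))
anyList? zero    P? = map′ (λ p → [] , p , refl) (λ where ([] , p , _) → p) (P? [])
anyList? (suc k) P? = map′
  (λ (x , u , p , e) → x ∷ u , p , cong suc e)
  (λ where (x ∷ u , p , e) → x , u , p , ℕ.suc-injective e)
  (Fin.any? (λ x → anyList? k (λ u → P? (x ∷ u))))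

module _ {A : Set} (Good : A → Set) (R : A → A → Set)
  (R-trans : ∀ {x y z} → Good x → Good y → Good z → R x y → R y z → R x z)
  (R-total : ∀ {x y} → Good x → Good y → x ≢ y → R x y ⊎ R y x) where

  -- `R` is a linear order only among `Good` elements because it will be an angular order, which is
  -- linear only within a half-plane. The clause quantifying over `P` stands in for being a
  -- permutation.
  insert : ∀ x xs → Good x → All Good xs → All (x ≢_) xs → AllPairs R xs →
    ∃[ ys ] (AllPairs R ys × (∀ {P : A → Set} → P x → All P xs → All P ys) ×
             length ys ≡ suc (length xs))
  insert x []       gx _        _          _        =
    x ∷ [] , [] ∷ [] , (λ px _ → px ∷ []) , refl
  insert x (y ∷ xs) gx (gy ∷ g) (x≢y ∷ nq) (r ∷ rs) with R-total gx gy x≢y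
  ... | inj₁ xy = x ∷ y ∷ xs
                , (xy ∷ All.zipWith (λ (gz , yz) → R-trans gx gy gz xy yz) (g , r)) ∷ r ∷ rs
                , _∷_ , refl
  ... | inj₂ yx with insert x xs gx g nq rs
  ...   | ys , sorted , all , len =
    y ∷ ys , all yx r ∷ sorted , (λ where px (py ∷ pxs) → py ∷ all px pxs) , cong suc len

  sort : ∀ xs → All Good xs → AllPairs _≢_ xs →
    ∃[ ys ] (AllPairs R ys × (∀ {P : A → Set} → All P xs → All P ys) × length ys ≡ length xs)
  sort []       _        _        = [] , [] , (λ _ → []) , refl
  sort (x ∷ xs) (gx ∷ g) (nq ∷ u) with sort xs g u
  ... | ys , sorted , all , len with insert x ys gx (all g) (all nq) sorted
  ...   | zs , sorted′ , all′ , len′ =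
    zs , sorted′ , (λ where (px ∷ pxs) → all′ px (all pxs)) , trans len′ (cong suc len)


module _ {A : Set} (Good : A → Set) (R : A → A → Set) (R? : ∀ x y → Dec (R x y))
  (R-trans : ∀ {x y z} → Good x → Good y → Good z → R x y → R y z → R x z) where

  private
    minimal? : ∀ xs x → Dec (All (λ y → ¬ R y x) xs)
    minimal? xs x = All.all? (λ y → ¬? (R? y x)) xs

    below : ∀ {x} xs → ¬ All (λ y → ¬ R y x) xs → ∃[ y ] (y ∈ xs × R y x)
    below {x} xs h with All.¬All⇒Any¬ (λ y → ¬? (R? y x)) xs h
    ... | any with find any
    ...   | y , y∈ , ¬¬r with R? y x
    ...     | yes r = y , y∈ , r
    ...     | no ¬r = contradiction ¬r ¬¬r

  -- The minimal elements form an antichain. If there are fewer than `a` of them, the rest is still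
  -- long enough for the induction, and a chain found there starts at a non-minimal element, which
  -- has a predecessor to put in front. `S` carries the order of the list over to the antichain.
  mirsky⁺ : ∀ a c (xs : List A) → All Good xs → a * suc c ≤ length xs → {S : A → A → Set} →
    AllPairs S xs →
    (∃[ ys ] (AllPairs S ys × AllPairs (λ x y → ¬ R x y × ¬ R y x) ys ×
              All (_∈ xs) ys × a ≤ length ys)) ⊎
    (∃[ ys ] (AllPairs R ys × All (_∈ xs) ys × suc c ≤ length ys))
  mirsky⁺ a zero    []           g h s = inj₁ ([] , [] , [] , [] , subst (_≤ 0) (ℕ.*-identityʳ a) h)
  mirsky⁺ a zero    (x ∷ xs)     g h s = inj₂ (x ∷ [] , [] ∷ [] , here refl ∷ [] , s≤s z≤n)
  mirsky⁺ a (suc c) xs           g h s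
    with +-≤-split a (a * suc c) (subst₂ _≤_ (ℕ.*-suc a (suc c)) (length-filter-split (minimal? xs) xs) h)
  ... | inj₁ many = inj₁ (mins , AllPairs.filter⁺ (minimal? xs) s ,
      antichain , All.tabulate (proj₁ ∘ ∈-filter⁻ (minimal? xs)) , many)
    where
    mins = filter (minimal? xs) xs
    antichain : AllPairs (λ x y → ¬ R x y × ¬ R y x) mins
    antichain = AllPairs-universal
      (λ (x∈ , mx) (y∈ , my) → All.lookup my x∈ , All.lookup mx y∈)
      (All.tabulate {xs = mins} (∈-filter⁻ (minimal? xs)))
  ... | inj₂ few with mirsky⁺ a c (filter (¬? ∘ minimal? xs) xs)
                        (All.filter⁺ (¬? ∘ minimal? xs) g) few (AllPairs.filter⁺ (¬? ∘ minimal? xs) s)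
  ...   | inj₁ (ys , sys , anti , ys∈ , len) =
    inj₁ (ys , sys , anti , All.map (proj₁ ∘ ∈-filter⁻ (¬? ∘ minimal? xs)) ys∈ , len)
  ...   | inj₂ (y ∷ ys , r ∷ rs , y∈ ∷ ys∈ , len)
    with ∈-filter⁻ (¬? ∘ minimal? xs) {xs = xs} y∈
  ...     | y∈xs , notMin with below xs notMin
  ...       | z , z∈ , zy =
    inj₂ (z ∷ y ∷ ys
      , (zy ∷ All.zipWith (λ (w∈ , yw) → R-trans (good z∈) (good y∈xs) (good (inXs w∈)) zy yw)
          (ys∈ , r)) ∷ r ∷ rs
      , z∈ ∷ y∈xs ∷ All.map inXs ys∈ , s≤s len)
    where
    good : ∀ {x} → x ∈ xs → Good x
    good = All.lookup g
    inXs : ∀ {w} → w ∈ filter (¬? ∘ minimal? xs) xs → w ∈ xs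
    inXs = proj₁ ∘ ∈-filter⁻ (¬? ∘ minimal? xs)

  mirsky : ∀ a c (xs : List A) → All Good xs → a * c ≤ length xs → {S : A → A → Set} →
    AllPairs S xs →
    (∃[ ys ] (AllPairs S ys × AllPairs (λ x y → ¬ R x y × ¬ R y x) ys ×
              All (_∈ xs) ys × a ≤ length ys)) ⊎
    (∃[ ys ] (AllPairs R ys × All (_∈ xs) ys × c ≤ length ys))
  mirsky a zero    xs _ _ _ = inj₂ ([] , [] , [] , z≤n)
  mirsky a (suc c) xs g h s = mirsky⁺ a c xs g h s

-- Cups and caps

-- cupCapBound k l points force a cap of 2 + k or a cup of 2 + l points.
cupCapBound : ℕ → ℕ → ℕ
cupCapBound zero    l       = 2
cupCapBound (suc k) zero    = 2
cupCapBound (suc k) (suc l) = cupCapBound k (suc l) + cupCapBound (suc k) l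

cupCapBound≤2^ : ∀ k l → cupCapBound k l ≤ 2 ^ suc (k + l)
cupCapBound≤2^ zero    l       = ℕ.*-monoʳ-≤ 2 (ℕ.m^n>0 2 l)
cupCapBound≤2^ (suc k) zero    = ℕ.*-monoʳ-≤ 2 (ℕ.m^n>0 2 (suc k + 0))
cupCapBound≤2^ (suc k) (suc l) = ℕ.+-mono-≤ (cupCapBound≤2^ k (suc l))
  (ℕ.≤-trans (cupCapBound≤2^ (suc k) l) (ℕ.≤-reflexive (trans
    (cong (2 ^_) (cong suc (sym (ℕ.+-suc k l)))) (sym (ℕ.+-identityʳ _)))))

-- `cupCapBound k l` is twice the binomial coefficient of `k + l` over `k`. The power of two above
-- suits a fixed sum `k + l`; the present bound is for `k` far below `l` and is the source of the
-- logarithm in the exponent.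
cupCapBound≤^ : ∀ k l → cupCapBound k l ≤ 2 * suc l ^ k
cupCapBound≤^ zero    l       = ℕ.≤-refl
cupCapBound≤^ (suc k) zero    = ℕ.*-monoʳ-≤ 2 (ℕ.m^n>0 1 (suc k))
cupCapBound≤^ (suc k) (suc l) = begin
  cupCapBound k (suc l) + cupCapBound (suc k) l          ≤⟨ ℕ.+-mono-≤ (cupCapBound≤^ k (suc l))
      (cupCapBound≤^ (suc k) l) ⟩
  2 * b ^ k + 2 * (a * a ^ k)          ≤⟨ ℕ.+-monoʳ-≤ (2 * b ^ k)
      (ℕ.*-monoʳ-≤ 2 (ℕ.*-monoʳ-≤ a (ℕ.^-monoˡ-≤ k (ℕ.n≤1+n a)))) ⟩
  2 * b ^ k + 2 * (a * b ^ k)          ≡⟨ ℕ.*-distribˡ-+ 2 (b ^ k) (a * b ^ k) ⟨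
  2 * (b * b ^ k)                      ∎
  where
  open ℕ.≤-Reasoning
  a = suc l
  b = suc (suc l)

module _ {M : ℕ} (C : Fin M → Fin M → Fin M → Set) (C? : ∀ i j k → Dec (C i j k))
  (C-total : ∀ {i j k} → i Fin.< j → j Fin.< k → C i j k ⊎ C k j i) where

  module _ (_≺_ : Fin M → Fin M → Set)
    (C-trans₁ : ∀ {a b c d} → a ≺ b → b ≺ c → c ≺ d → C a b c → C b c d → C a b d)
    (C-trans₂ : ∀ {a b c d} → a ≺ b → b ≺ c → c ≺ d → C a b c → C b c d → C a c d) where

    -- One new consecutive triple suffices: `C-trans₁` replaces its last point by any later one,
    -- then `C-trans₂` does the same for its middle point. Keeping `_≺_` abstract serves caps with
    -- `<` and cups with `>`.
    extend : ∀ {b a c xs} → b ≺ a → AllPairs _≺_ (a ∷ c ∷ xs) → AllTriples C (a ∷ c ∷ xs) →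
      C b a c → AllTriples C (b ∷ a ∷ c ∷ xs)
    extend {b} {a} {c} {xs} ba ((ac ∷ axs) ∷ (cxs ∷ s)) (q ∷ p , t) h = (first ∷ rest) , q ∷ p , t
      where
      first : All (C b a) (c ∷ xs)
      first = h ∷ All.zipWith (λ (cz , acz) → C-trans₁ ba ac cz h acz) (cxs , q)
      go : ∀ ys → All (a ≺_) ys → AllPairs _≺_ ys → All (C b a) ys → AllPairs (C a) ys →
        AllPairs (C b) ys
      go []       _          _        _        _        = []
      go (y ∷ ys) (ay ∷ ays) (l ∷ ls) (h ∷ hs) (q ∷ qs) =
        All.zipWith (λ (yz , ayz) → C-trans₂ ba ay yz h ayz) (l , q) ∷ go ys ays ls hs qs
      rest : AllPairs (C b) (c ∷ xs)
      rest = go (c ∷ xs) (ac ∷ axs) (cxs ∷ s) first (q ∷ p)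

  module _
    (up₁ : ∀ {a b c d} → a Fin.< b → b Fin.< c → c Fin.< d → C a b c → C b c d → C a b d)
    (up₂ : ∀ {a b c d} → a Fin.< b → b Fin.< c → c Fin.< d → C a b c → C b c d → C a c d)
    (down₁ : ∀ {a b c d} → a Fin.> b → b Fin.> c → c Fin.> d → C a b c → C b c d → C a b d)
    (down₂ : ∀ {a b c d} → a Fin.> b → b Fin.> c → c Fin.> d → C a b c → C b c d → C a c d) where

    -- Cups are listed from right to left, so that their triples are oriented like those of caps.
    Cap Cup : List (Fin M) → List (Fin M) → Set
    Cap xs u = AllPairs Fin._<_ u × AllTriples C u × All (_∈ xs) u
    Cup xs u = AllPairs Fin._>_ u × AllTriples C u × All (_∈ xs) u

    private
      Ends : List (Fin M) → ℕ → Fin M → Set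
      Ends xs l a = ∃[ u ] (Cup xs (a ∷ u) × length u ≡ l)

      ends? : ∀ xs l a → Dec (Ends xs l a)
      ends? xs l a = anyList? l (λ u → AllPairs.allPairs? (flip Fin._<?_) (a ∷ u) ×-dec
        allTriples? C? (a ∷ u) ×-dec All.all? (λ x → DecMembership._∈?_ Fin._≟_ x xs) (a ∷ u))

    -- The Erdős-Szekeres induction separates the right ends `a` of cups with `2 + l` points from
    -- the other points. Among the others a cup of that size would contradict the choice. Among the
    -- ends, a cap starting at `a` meets a cup ending at `a`, and the orientation of the triple
    -- formed by `a` and its two neighbours tells which of the two can be prolonged.
    cups-caps : ∀ k l xs → AllPairs Fin._<_ xs → cupCapBound k l ≤ length xs →
      (∃[ u ] (Cap xs u × length u ≡ 2 + k)) ⊎ (∃[ u ] (Cup xs u × length u ≡ 2 + l))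
    cups-caps zero l (x ∷ y ∷ _) ((x<y ∷ _) ∷ _) _ =
      inj₁ (x ∷ y ∷ [] , ((x<y ∷ []) ∷ [] ∷ [] , (([] ∷ []) , [] , tt) , here refl ∷ there
          (here refl) ∷ []) , refl)
    cups-caps (suc k) zero (x ∷ y ∷ _) ((x<y ∷ _) ∷ _) _ =
      inj₂ (y ∷ x ∷ [] , ((x<y ∷ []) ∷ [] ∷ [] , (([] ∷ []) , [] , tt) , there (here refl) ∷ here refl ∷
          []) , refl)
    cups-caps zero l [] _ ()
    cups-caps zero l (_ ∷ []) _ (s≤s ())
    cups-caps (suc k) zero [] _ ()
    cups-caps (suc k) zero (_ ∷ []) _ (s≤s ())
    cups-caps (suc k) (suc l) xs s h
      with +-≤-split (cupCapBound k (suc l)) (cupCapBound (suc k) l)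
             (subst (cupCapBound (suc k) (suc l) ≤_) (length-filter-split (ends? xs (suc l)) xs) h)
    ... | inj₂ many with cups-caps (suc k) l (filter (¬? ∘ ends? xs (suc l)) xs)
                          (AllPairs.filter⁺ (¬? ∘ ends? xs (suc l)) s) many
    ...   | inj₁ (u , (su , tu , u∈) , len) =
      inj₁ (u , (su , tu , All.map (proj₁ ∘ ∈-filter⁻ (¬? ∘ ends? xs (suc l))) u∈) , len)
    ...   | inj₂ (a ∷ u , (su , tu , a∈ ∷ u∈) , len) =
      contradiction
        (u , (su , tu , All.map (proj₁ ∘ ∈-filter⁻ (¬? ∘ ends? xs (suc l))) (a∈ ∷ u∈)) , ℕ.suc-injective
            len)
        (proj₂ (∈-filter⁻ (¬? ∘ ends? xs (suc l)) {xs = xs} a∈))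
    cups-caps (suc k) (suc l) xs s h | inj₁ many
      with cups-caps k (suc l) (filter (ends? xs (suc l)) xs)
                          (AllPairs.filter⁺ (ends? xs (suc l)) s) many
    ...   | inj₂ (u , (su , tu , u∈) , len) =
      inj₂ (u , (su , tu , All.map (proj₁ ∘ ∈-filter⁻ (ends? xs (suc l))) u∈) , len)
    ...   | inj₁ (a ∷ c ∷ u , ((ac ∷ au) ∷ su , tu , a∈ ∷ u∈) , len)
      with ∈-filter⁻ (ends? xs (suc l)) {xs = xs} a∈
    ...     | a∈xs , b ∷ v , ((ba ∷ av) ∷ sv , tv , _ ∷ b∈ ∷ v∈) , len′ with C-total ba ac
    ...       | inj₁ bac = inj₁ (b ∷ a ∷ c ∷ u ,
      ((ba ∷ All.map (Fin.<-trans ba) (ac ∷ au)) ∷ (ac ∷ au) ∷ su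
      , extend Fin._<_ up₁ up₂ ba ((ac ∷ au) ∷ su) tu bac
      , b∈ ∷ All.map (proj₁ ∘ ∈-filter⁻ (ends? xs (suc l))) (a∈ ∷ u∈)) , cong suc len)
    ...       | inj₂ cab with All.map (proj₁ ∘ ∈-filter⁻ (ends? xs (suc l)) {xs = xs}) u∈
    ...         | c∈ ∷ _ = inj₂ (c ∷ a ∷ b ∷ v ,
      ((ac ∷ All.map (λ z<a → Fin.<-trans z<a ac) (ba ∷ av)) ∷ (ba ∷ av) ∷ sv
      , extend Fin._>_ down₁ down₂ ac ((ba ∷ av) ∷ sv) tv cab
      , c∈ ∷ a∈xs ∷ b∈ ∷ v∈) , cong (λ z → suc (suc z)) len′)

-- The fields gp₁ to gp₄ are instances of the Grassmann–Plücker relation around the point o.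
record Orientation (N : ℕ) : Set₁ where
  field
    Ccw   : Fin N → Fin N → Fin N → Set
    ccw?  : ∀ a b c → Dec (Ccw a b c)
    cyc   : ∀ {a b c} → Ccw a b c → Ccw b c a
    asym  : ∀ {a b c} → Ccw a b c → ¬ Ccw b a c
    total : ∀ {a b c} → a ≢ b → b ≢ c → a ≢ c → Ccw a b c ⊎ Ccw b a c
    gp₁   : ∀ {o s p q r} → Ccw o s p → Ccw o s q → Ccw o s r → Ccw o p q → Ccw o q r → Ccw o p r
    gp₂   : ∀ {o s p q r} → Ccw s o p → Ccw s o q → Ccw s o r → Ccw o p q → Ccw o q r → Ccw o p r
    gp₃   : ∀ {o s p q r} → Ccw o s p → Ccw o p q → Ccw o q s → Ccw o s r → Ccw o p r → Ccw o r q
    gp₄   : ∀ {o s p q r} → Ccw o s p → Ccw o p q → Ccw o q s → Ccw o r s → Ccw o r p → Ccw o q r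

module Chirotope {N : ℕ} (O : Orientation N) where
  open Orientation O public

  cyc² : ∀ {a b c} → Ccw a b c → Ccw c a b
  cyc² = cyc ∘ cyc

  ccw⇒≢ : ∀ {a b c} → Ccw a b c → a ≢ b
  ccw⇒≢ h refl = asym h h

  total′ : ∀ {a b c} → a ≢ b → b ≢ c → a ≢ c → Ccw a b c ⊎ Ccw c b a
  total′ ab bc ac with total ab bc ac
  ... | inj₁ h = inj₁ h
  ... | inj₂ h = inj₂ (cyc² h)

  module _ {M} (t : Fin N) (q : Fin M → Fin N)
    (sorted : ∀ {i j} → i Fin.< j → Ccw t (q i) (q j)) where

    private
      C : Fin M → Fin M → Fin M → Set
      C i j k = Ccw (q i) (q j) (q k)

      q-≢ : ∀ {i j} → i Fin.< j → q i ≢ q j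
      q-≢ i<j = ccw⇒≢ (cyc (sorted i<j))

      C-total : ∀ {i j k} → i Fin.< j → j Fin.< k → C i j k ⊎ C k j i
      C-total i<j j<k = total′ (q-≢ i<j) (q-≢ j<k) (q-≢ (Fin.<-trans i<j j<k))

      up₁ : ∀ {a b c d} → a Fin.< b → b Fin.< c → c Fin.< d → C a b c → C b c d → C a b d
      up₁ ab bc cd h k = cyc² (gp₁ k (cyc (sorted bc)) (cyc h)
        (cyc (sorted (Fin.<-trans bc cd))) (cyc² (sorted ab)))

      up₂ : ∀ {a b c d} → a Fin.< b → b Fin.< c → c Fin.< d → C a b c → C b c d → C a c d
      up₂ ab bc cd h k = cyc² (gp₂ k (cyc (sorted bc)) (cyc h)
        (cyc (sorted cd)) (cyc² (sorted (Fin.<-trans ab bc))))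

      down₁ : ∀ {a b c d} → a Fin.> b → b Fin.> c → c Fin.> d → C a b c → C b c d → C a b d
      down₁ ab bc cd h k = cyc² (gp₃ (cyc² (sorted bc)) (cyc h) (cyc (sorted ab))
        (cyc² (sorted (Fin.<-trans cd bc))) k)

      down₂ : ∀ {a b c d} → a Fin.> b → b Fin.> c → c Fin.> d → C a b c → C b c d → C a c d
      down₂ ab bc cd h k = cyc² (gp₄ (cyc (sorted bc)) (cyc² (sorted cd)) (cyc k)
        (cyc² h) (cyc (sorted (Fin.<-trans bc ab))))

    -- The angular order around `t` replaces the order from left to right, as if `t` were at
    -- infinity. Three points of a cap are in convex position together with `t`, whereas the middle
    -- one of three points of a cup lies in the triangle of `t` and the other two. Hence caps need
    -- `gp₁` and `gp₂`, and cups `gp₃` and `gp₄`.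
    indexed-cups-caps : ∀ k l → cupCapBound k l ≤ M →
      (∃[ u ] (AllPairs Fin._<_ u × AllTriples C u × length u ≡ 2 + k)) ⊎
      (∃[ u ] (AllPairs Fin._>_ u × AllTriples C u × length u ≡ 2 + l))
    indexed-cups-caps k l h
      with cups-caps C (λ i j k → ccw? (q i) (q j) (q k)) C-total up₁ up₂ down₁ down₂ k l
             (allFin M) (AllPairs.tabulate⁺-< (λ i<j → i<j))
             (subst (cupCapBound k l ≤_) (sym (List.length-tabulate {n = M} (λ i → i))) h)
    ... | inj₁ (u , (s , t , _) , len) = inj₁ (u , s , t , len)
    ... | inj₂ (u , (s , t , _) , len) = inj₂ (u , s , t , len)

  Polygon : List (Fin N) → Set
  Polygon = AllTriples Ccw

  list-cups-caps : ∀ t k l {R : Fin N → Fin N → Set} {P : Fin N → Set} xs →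
    AllPairs (Ccw t) xs → AllPairs R xs → All P xs → cupCapBound k l ≤ length xs →
    (∃[ u ] (Polygon u × AllPairs R u × All P u × length u ≡ 2 + k)) ⊎
    (∃[ u ] (Polygon u × AllPairs (flip R) u × All P u × length u ≡ 2 + l))
  list-cups-caps t k l {R} {P} xs s r p h
    with indexed-cups-caps t (lookup xs) (AllPairs-lookup xs s) k l h
  ... | inj₁ (u , s′ , t′ , len) = inj₁ (map (lookup xs) u , AllTriples-map u t′
      , AllPairs.map⁺ (AllPairs.map (λ i<j → AllPairs-lookup xs r i<j) s′)
      , All.map⁺ (All.universal (λ i → All.lookup p (∈-lookup i)) u)
      , trans (List.length-map (lookup xs) u) len)
  ... | inj₂ (u , s′ , t′ , len) = inj₂ (map (lookup xs) u , AllTriples-map u t′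
      , AllPairs.map⁺ (AllPairs.map (λ i<j → AllPairs-lookup xs r i<j) s′)
      , All.map⁺ (All.universal (λ i → All.lookup p (∈-lookup i)) u)
      , trans (List.length-map (lookup xs) u) len)

-- Combs

-- The points x 0, T 0, x 1, T 1, …, x K occur in this order on a convex chain, for every choice of a
-- single point from one of the sets T i.
record Comb {N : ℕ} (O : Orientation N) (K : ℕ) : Set₁ where
  open Chirotope O
  field
    x   : ℕ → Fin N
    T   : ℕ → Fin N → Set
    xxx : ∀ {a b c} → a < b → b < c → c ≤ K → Ccw (x a) (x b) (x c)
    xxy : ∀ {a b i y} → a < b → b ≤ i → i ≤ K → T i y → Ccw (x a) (x b) y
    xyx : ∀ {a b i y} → a ≤ i → i < b → b ≤ K → T i y → Ccw (x a) y (x b)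
    yxx : ∀ {a b i y} → i < a → a < b → b ≤ K → T i y → Ccw y (x a) (x b)

module Combs {N : ℕ} (O : Orientation N) {K : ℕ} (comb : Comb O K) where
  open Chirotope O
  open Comb comb

  private
    n<1+n : ∀ {n} → n < suc n
    n<1+n = ℕ.≤-refl
    n<3+n : ∀ {n} → suc n < 3 + n
    n<3+n = s≤s (s≤s (ℕ.n≤1+n _))
    ≤-pred : ∀ {m n} → suc m ≤ n → m ≤ n
    ≤-pred = ℕ.<⇒≤

  -- A comb controls only one varying point at a time. Two of them are compared by a
  -- Grassmann-Plücker relation through a tooth between them, with a further tooth as reference
  -- direction. The bounds on the indices in this and the next lemmas make room for these auxiliary
  -- teeth.
  xyy : ∀ {a i j y z} → 1 ≤ a → a ≤ i → i < j → j ≤ K → T i y → T j z → Ccw (x a) y z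
  xyy {suc a} _ a≤i i<j j≤K y z = gp₂
    (xxy n<1+n a≤i (ℕ.<⇒≤ (ℕ.<-≤-trans i<j j≤K)) y)
    (xxx n<1+n (s≤s a≤i) (ℕ.≤-trans i<j j≤K))
    (xxy n<1+n (ℕ.≤-trans a≤i (ℕ.<⇒≤ i<j)) j≤K z)
    (xyx a≤i n<1+n (ℕ.≤-trans i<j j≤K) y)
    (xxy (s≤s a≤i) i<j j≤K z)

  yyx : ∀ {i j b y z} → i < j → j < b → suc b ≤ K → T i y → T j z → Ccw y z (x b)
  yyx i<j j<b b<K y z = cyc (gp₁
    (cyc (yxx (ℕ.<-trans i<j j<b) n<1+n b<K y))
    (cyc (xxx j<b n<1+n b<K))
    (cyc (yxx j<b n<1+n b<K z))
    (cyc² (yxx i<j j<b (ℕ.<⇒≤ b<K) y))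
    (cyc² (xyx ℕ.≤-refl j<b (ℕ.<⇒≤ b<K) z)))

  yxy : ∀ {i c j y z} → i < c → c < j → j ≤ K → T i y → T j z → Ccw y (x c) z
  yxy i<c c<j j≤K y z = cyc² (gp₁
    (xxy n<1+n c<j j≤K z)
    (cyc (xxx i<c n<1+n (ℕ.≤-trans c<j j≤K)))
    (cyc (yxx i<c n<1+n (ℕ.≤-trans c<j j≤K) y))
    (cyc (xxy i<c (ℕ.<⇒≤ c<j) j≤K z))
    (cyc² (xyx ℕ.≤-refl i<c (ℕ.<⇒≤ (ℕ.<-≤-trans c<j j≤K)) y)))

  -- Seen from `p`, the tooth `x (suc j)` lies between `q` and `r`. The condition `suc j < k` leaves
  -- room for it and for its successor, which `yxy` uses.
  yyy : ∀ {i j k p q r} → 1 ≤ i → i < j → suc j < k → k ≤ K → T i p → T j q → T k r → Ccw p q r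
  yyy 1≤i i<j j<k k≤K p q r = gp₂
    (xyy 1≤i ℕ.≤-refl i<j (ℕ.<⇒≤ j<K) p q)
    (xyx ℕ.≤-refl (s≤s (ℕ.<⇒≤ i<j)) j<K p)
    (xyy 1≤i ℕ.≤-refl (ℕ.<-trans i<j (ℕ.<⇒≤ j<k)) k≤K p r)
    (yyx i<j n<1+n (ℕ.≤-trans j<k k≤K) p q)
    (yxy (s≤s (ℕ.<⇒≤ i<j)) j<k k≤K p r)
    where j<K = ℕ.≤-trans (ℕ.<⇒≤ j<k) k≤K

  -- T (1 + i) is viewed from the endpoints of the segment x i, x (3 + i): q lies inside the triangle
  -- x i, p, x (3 + i) if Inside i p q, and the line p q misses the segment if Outside i p q.
  Inside Outside : ℕ → Fin N → Fin N → Set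
  Inside  i p q = Ccw (x i) p q × Ccw q p (x (3 + i))
  Outside i p q = Ccw (x i) p q × Ccw p q (x (3 + i))

  module _ {i} (1≤i : 1 ≤ i) (bd : 4 + i ≤ K) where

    private
      l r : Fin N
      l = x i
      r = x (3 + i)
      Tᵢ = T (suc i)
      bd₁ : suc i ≤ K
      bd₁ = ≤-pred (≤-pred (≤-pred bd))

    lyr : ∀ {y} → Tᵢ y → Ccw l y r
    lyr = xyx (ℕ.n≤1+n i) n<3+n (≤-pred bd)

    -- Seen from `p`, the end `r` of the segment lies between `q` and `z`.
    outside-right : ∀ {p q z j} → Tᵢ p → Tᵢ q → Outside i p q → 4 + i ≤ j → j ≤ K → T j z →
      Ccw p q z
    outside-right p q (lpq , pqr) i<j j≤K z = gp₂ lpq (lyr p)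
      (xyy 1≤i (ℕ.n≤1+n i) (ℕ.≤-trans n<3+n (≤-pred i<j)) j≤K p z) pqr
      (yxy n<3+n i<j j≤K p z)

    outside-left : ∀ {p q z h} → Tᵢ p → Tᵢ q → Outside i p q → h < i → T h z → Ccw z p q
    outside-left p q (lpq , pqr) h<i z = cyc (gp₁
      (cyc (yyx (ℕ.<-trans h<i n<1+n) n<3+n bd z q))
      (cyc (lyr q)) (cyc pqr)
      (cyc² (yxy h<i n<1+n bd₁ z q)) (cyc² lpq))

    -- Otherwise the directions from `p` to `r`, `q` and `z` would follow in this order, putting `z`
    -- on the inner side of the line from `p` to `r`; but `p`, `z`, `r` is a convex chain. This is
    -- why the segment reaches one tooth further than `T (1 + i)`: its end `r` comes after the
    -- neighbouring set `T (2 + i)`.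
    inside-right : ∀ {p q z} → Tᵢ p → Tᵢ q → Inside i p q → T (2 + i) z → Ccw q p z
    inside-right p q (lpq , qpr) z
      with total (ccw⇒≢ qpr) (ccw⇒≢ (cyc (lyz p))) (ccw⇒≢ (cyc (lyz q)))
      where
      lyz : ∀ {y} → Tᵢ y → Ccw l y _
      lyz y = xyy 1≤i (ℕ.n≤1+n i) n<1+n (≤-pred (≤-pred bd)) y z
    ... | inj₁ qpz = qpz
    ... | inj₂ pqz = contradiction
      (cyc² (gp₂ (lyr p) lpq (xyy 1≤i (ℕ.n≤1+n i) n<1+n (≤-pred (≤-pred bd)) p z) (cyc qpr) pqz))
      (asym (yyx n<1+n n<1+n bd p z))

    private
      -- The tooth next to `l` is a reference direction that confines the set to a half-plane as
      -- seen from `l`, so the angular order there is transitive; likewise at `r` below.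
      ll-trans : ∀ {p q s} → Tᵢ p → Tᵢ q → Tᵢ s → Ccw l p q → Ccw l q s → Ccw l p s
      ll-trans p q s = gp₁ (lxy p) (lxy q) (lxy s)
        where
        lxy : ∀ {y} → Tᵢ y → Ccw l (x (suc i)) y
        lxy = xxy n<1+n ℕ.≤-refl bd₁

      rr-trans : ∀ {p q s} → Tᵢ p → Tᵢ q → Tᵢ s → Ccw q p r → Ccw s q r → Ccw s p r
      rr-trans p q s qpr sqr = cyc (gp₂ (xry s) (xry q) (xry p) (cyc² sqr) (cyc² qpr))
        where
        xry : ∀ {y} → Tᵢ y → Ccw (x (2 + i)) r y
        xry y = cyc (yxx n<1+n n<1+n (≤-pred bd) y)

      inside-trans : ∀ {p q s} → Tᵢ p → Tᵢ q → Tᵢ s → Inside i p q → Inside i q s → Inside i p s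
      inside-trans p q s (lpq , qpr) (lqs , sqr) = ll-trans p q s lpq lqs , rr-trans p q s qpr sqr

      ll-total : ∀ {p q} → Tᵢ p → Tᵢ q → p ≢ q → Ccw l p q ⊎ Ccw l q p
      ll-total p q p≢q
        with total (ccw⇒≢ (lyr p)) p≢q (ccw⇒≢ (lyr q))
      ... | inj₁ lpq = inj₁ lpq
      ... | inj₂ plq = inj₂ (cyc plq)

      ¬inside : ∀ {p q} → Tᵢ p → Tᵢ q → Ccw l p q → ¬ Inside i p q → Outside i p q
      ¬inside p q lpq h
        with total (ccw⇒≢ (cyc lpq)) (ccw⇒≢ (cyc (lyr q))) (ccw⇒≢ (cyc (lyr p)))
      ... | inj₁ pqr = lpq , pqr
      ... | inj₂ qpr = contradiction (lpq , qpr) h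

      inside? : ∀ p q → Dec (Inside i p q)
      inside? p q = ccw? l p q ×-dec ccw? q p r

    -- Sorting around `l` first fixes the orientation at `l` for every pair of the list. Then only
    -- the orientation at `r` is open, and not being `Inside` means being `Outside`.
    dichotomy : ∀ a c xs → All Tᵢ xs → AllPairs _≢_ xs → a * c ≤ length xs →
      (∃[ ys ] (AllPairs (Outside i) ys × All Tᵢ ys × a ≤ length ys)) ⊎
      (∃[ ys ] (AllPairs (Inside i) ys × All Tᵢ ys × c ≤ length ys))
    dichotomy a c xs t u h with sort Tᵢ (Ccw l) ll-trans ll-total xs t u
    ... | ys , sorted , all , len
      with mirsky Tᵢ (Inside i) inside? inside-trans a c ys (all t) (subst (_ ≤_) (sym len) h) sorted
    ...   | inj₁ (zs , szs , anti , zs∈ , long) = inj₁ (zs ,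
      AllPairs-mapWith (λ p q (lpq , ¬pq , _) → ¬inside p q lpq ¬pq) tzs (AllPairs.zip (szs , anti))
      , tzs , long)
      where tzs = All.map (All.lookup (all t)) zs∈
    ...   | inj₂ (zs , ins , zs∈ , long) = inj₂ (zs , ins , All.map (All.lookup (all t)) zs∈ , long)

  -- The mirror image of `inside-right`: the left end `x (suc i)` of the segment belonging to
  -- `T (2 + i)` comes before `T (1 + i)`.
  inside-left : ∀ {i} → 1 ≤ i → 5 + i ≤ K → ∀ {y p q} → T (1 + i) y → T (2 + i) p → T (2 + i) q →
    Inside (suc i) p q → Ccw y p q
  inside-left {i} 1≤i bd {y} {p} {q} ty tp tq (lpq , qpr)
    with total′ (ccw⇒≢ (cyc (lyz tp))) (ccw⇒≢ (cyc lpq)) (ccw⇒≢ (cyc (lyz tq)))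
    where
    lyz : ∀ {z} → T (2 + i) z → Ccw (x (suc i)) y z
    lyz = xyy (s≤s z≤n) ℕ.≤-refl n<1+n (≤-pred (≤-pred (≤-pred bd))) ty
  ... | inj₁ ypq = ypq
  ... | inj₂ qpy = contradiction
    (gp₁ (cyc (yyx n<1+n n<3+n bd ty tp)) (cyc qpr) (cyc (lyr (s≤s z≤n) bd tp)) (cyc qpy) (cyc lpq))
    (asym (cyc (xyy (s≤s z≤n) ℕ.≤-refl n<1+n (≤-pred (≤-pred (≤-pred bd))) ty tp)))

-- Polygons from combs all of whose sets are large

module LargeCombs {N : ℕ} (O : Orientation N) {K : ℕ} (comb : Comb O K)
  (n d s A : ℕ) (ES≤A : cupCapBound s n ≤ A) where
  open Chirotope O
  open Comb comb
  open Combs O comb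

  HasPolygon : Set
  HasPolygon = ∃[ u ] (Polygon u × n ≤ length u)

  private
    -- A partial polygon assembled from right to left. The last clause is the invariant that lets
    -- points be put in front: every point of a sufficiently early set sees all pairs of `u`
    -- counterclockwise.
    Tail : ℕ → List (Fin N) → Set
    Tail j u = Polygon u
      × All (λ q → ∃[ i ] (j ≤ i × i ≤ K × T i q)) u
      × AllPairs (λ q c → ∀ h p → 1 ≤ h → 3 + h ≤ j → T h p → Ccw p q c) u

    weaken : ∀ {i j u} → i ≤ j → Tail j u → Tail i u
    weaken i≤j (poly , t , left) = poly
      , All.map (λ (k , j≤k , rest) → k , ℕ.≤-trans i≤j j≤k , rest) t
      , AllPairs.map (λ f h p 1≤h h≤i → f h p 1≤h (ℕ.≤-trans h≤i i≤j)) left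

    -- Mixed triples with two points in `ys` are settled by `outside-right`, those with one by the
    -- last clause of `Tail`. That clause is renewed by `outside-left` for pairs in `ys` and by
    -- `yyy` for mixed pairs.
    append : ∀ {i j} → 1 ≤ i → 4 + i ≤ K → 4 + i ≤ j → ∀ ys u →
      Polygon ys → AllPairs (Outside i) ys → All (T (suc i)) ys → Tail j u → Tail (suc i) (ys ++ u)
    append {i} {j} 1≤i bd i<j ys u poly out tys (polyᵤ , tᵤ , leftᵤ) =
        AllTriples-++ ys u poly polyᵤ
          (AllPairs-mapWith (λ p q pq → All.map
            (λ (k , j≤k , k≤K , c) → outside-right 1≤i bd p q pq (ℕ.≤-trans i<j j≤k) k≤K c) tᵤ) tys out)
          (All.map (λ p → AllPairs.map (λ f → f _ _ (s≤s z≤n) i<j p) leftᵤ) tys)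
      , All.++⁺ (All.map (λ p → suc i , ℕ.≤-refl , ℕ.<⇒≤ (ℕ.<⇒≤ (ℕ.<⇒≤ bd)) , p) tys)
          (All.map (λ (k , j≤k , rest) → k , ℕ.≤-trans si≤j j≤k , rest) tᵤ)
      , AllPairs.++⁺
          (AllPairs-mapWith (λ p q pq h _ 1≤h h<i z → outside-left 1≤i bd p q pq (ℕ.<⇒≤ (ℕ.≤-pred h<i))
              z) tys out)
          (AllPairs.map (λ f h p 1≤h h≤i → f h p 1≤h (ℕ.≤-trans h≤i si≤j)) leftᵤ)
          (All.map (λ q → All.map (λ (k , j≤k , k≤K , c) h _ 1≤h h<i z →
            yyy 1≤h (ℕ.<⇒≤ (ℕ.<⇒≤ h<i)) (ℕ.≤-trans (ℕ.n≤1+n _) (ℕ.≤-trans i<j j≤k)) k≤K z q c) tᵤ) tys)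
      where
      si≤j : suc i ≤ j
      si≤j = ℕ.<⇒≤ (ℕ.<⇒≤ (ℕ.<⇒≤ i<j))

  OutsideCap InsideChain Large : ℕ → Set
  OutsideCap  i = ∃[ ys ] (Polygon ys × AllPairs (Outside i) ys × All (T (suc i)) ys × s ≤ length ys)
  InsideChain i = ∃[ ys ] (AllPairs (Inside i) ys × All (T (suc i)) ys × 2 ^ suc (n + d) ≤ length ys)
  Large       i = ∃[ ys ] (All (T (suc i)) ys × AllPairs _≢_ ys × A * 2 ^ suc (n + d) ≤ length ys)

  private
    2+≤ : ∀ {k m} → k ≡ 2 + m → m ≤ k
    2+≤ refl = ℕ.m≤n+m _ 2

    -- Only a cap keeps `Outside` in the order of its list; in a cup it is reversed. So a cup found
    -- in an antichain must be the `n`-gon itself, whereas `s` points are enough for a cap.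
    outcome : ∀ {i} → 1 ≤ i → 4 + i ≤ K → Large i → HasPolygon ⊎ OutsideCap i ⊎ InsideChain i
    outcome {i} 1≤i bd (xs , t , u , long) with dichotomy 1≤i bd A (2 ^ suc (n + d)) xs t u long
    ... | inj₂ chain = inj₂ (inj₂ chain)
    ... | inj₁ (ys , out , tys , big)
      with list-cups-caps (x i) s n ys (AllPairs.map proj₁ out) out tys (ℕ.≤-trans ES≤A big)
    ...   | inj₁ (u , poly , o , tu , len) = inj₂ (inj₁ (u , poly , o , tu , 2+≤ len))
    ...   | inj₂ (u , poly , _ , _ , len)  = inj₁ (u , poly , 2+≤ len)

    search : ∀ R i →
      (∀ j → i ≤ j → j < i + R → HasPolygon ⊎ OutsideCap j ⊎ InsideChain j) →
      HasPolygon ⊎ (∃[ j ] (i ≤ j × j < i + R × OutsideCap j)) ⊎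
      (∀ j → i ≤ j → j < i + R → InsideChain j)
    search zero    i f = inj₂ (inj₂ λ j i≤j j<i →
      contradiction i≤j (ℕ.<⇒≱ (subst (j <_) (ℕ.+-identityʳ i) j<i)))
    search (suc R) i f
      with f i ℕ.≤-refl (ℕ.m<m+n i (s≤s z≤n))
         | search R (suc i) (λ j i<j j<i+R → f j (ℕ.<⇒≤ i<j) (subst (j <_) (sym (ℕ.+-suc i R)) j<i+R))
    ... | inj₁ poly       | _         = inj₁ poly
    ... | inj₂ (inj₁ cap) | _         = inj₂ (inj₁ (i , ℕ.≤-refl , ℕ.m<m+n i (s≤s z≤n) , cap))
    ... | inj₂ (inj₂ _)   | inj₁ poly = inj₁ poly
    ... | inj₂ (inj₂ _)   | inj₂ (inj₁ (j , i<j , j<i+R , cap)) =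
      inj₂ (inj₁ (j , ℕ.<⇒≤ i<j , subst (j <_) (sym (ℕ.+-suc i R)) j<i+R , cap))
    ... | inj₂ (inj₂ chain) | inj₂ (inj₂ chains) = inj₂ (inj₂ all)
      where
      all : ∀ j → i ≤ j → j < i + suc R → InsideChain j
      all j i≤j j<i+R with ℕ.m≤n⇒m<n∨m≡n i≤j
      ... | inj₁ i<j  = chains j i<j (subst (j <_) (ℕ.+-suc i R) j<i+R)
      ... | inj₂ refl = chain

    InsideCup : ℕ → ℕ → Set
    InsideCup i e = ∃[ ys ] (Polygon ys × AllPairs (flip (Inside i)) ys × All (T (suc i)) ys × e ≤
        length ys)

    -- A single chain length admits every split of `n + d`. `climb` asks for a cap of `n ∸ e` points
    -- or a cup of `e + d` points, and this sum does not depend on `e`.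
    split-chain : ∀ {i} k l → k + l ≤ n + d → InsideChain i →
      (∃[ ys ] (Polygon ys × AllPairs (Inside i) ys × All (T (suc i)) ys × k ≤ length ys)) ⊎ InsideCup i l
    split-chain {i} k l k+l (xs , ins , t , long)
      with list-cups-caps (x i) k l xs (AllPairs.map proj₁ ins) ins t
             (ℕ.≤-trans (cupCapBound≤2^ k l) (ℕ.≤-trans (ℕ.^-monoʳ-≤ 2 (s≤s k+l)) long))
    ... | inj₁ (u , poly , o , tu , len) = inj₁ (u , poly , o , tu , 2+≤ len)
    ... | inj₂ (u , poly , o , tu , len) = inj₂ (u , poly , o , tu , 2+≤ len)

    -- A cup inside T (1 + i) followed by a cap inside T (2 + i) is a polygon, so either one is found
    -- or the size e of the cups can be increased by d from each chain to the next.
    climb : ∀ R i e → 1 ≤ i → 4 + (i + R) ≤ K → InsideCup i e →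
      (∀ j → i < j → j ≤ i + R → InsideChain j) → n ≤ e + R * d → HasPolygon
    climb zero i e 1≤i bd (ys , poly , _ , _ , long) chains h =
      ys , poly , ℕ.≤-trans (subst (n ≤_) (ℕ.+-identityʳ e) h) long
    climb (suc R) i e 1≤i bd cup@(ys , poly , ins , tys , long) chains h with n ℕ.≤? e
    ... | yes n≤e = ys , poly , ℕ.≤-trans n≤e long
    ... | no  n≰e with split-chain (n ∸ e) (e + d) (ℕ.≤-reflexive total-size)
        (chains (suc i) ℕ.≤-refl (ℕ.m<m+n i (s≤s z≤n)))
      where
      total-size : n ∸ e + (e + d) ≡ n + d
      total-size = trans (sym (ℕ.+-assoc (n ∸ e) e d)) (cong (_+ d) (ℕ.m∸n+n≡m (ℕ.<⇒≤ (ℕ.≰⇒> n≰e))))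
    ...   | inj₂ cup′ = climb R (suc i) (e + d) (s≤s z≤n) (subst (λ z → 4 + z ≤ K) (ℕ.+-suc i R) bd) cup′
      (λ j i<j j≤ → chains j (ℕ.<⇒≤ i<j) (subst (j ≤_) (sym (ℕ.+-suc i R)) j≤))
      (subst (n ≤_) (sym (ℕ.+-assoc e d (R * d))) h)
    ...   | inj₁ (zs , polyz , insz , tzs , longz) = ys ++ zs
      , AllTriples-++ ys zs poly polyz
          (AllPairs-mapWith (λ p q qp → All.map (inside-right 1≤i (ℕ.<⇒≤ bd′) q p qp) tzs) tys ins)
          (All.map (λ y → AllPairs-mapWith (inside-left 1≤i bd′ y) tzs insz) tys)
      , subst (n ≤_) (sym (List.length-++ ys))
          (ℕ.≤-trans (ℕ.≤-reflexive (trans (sym (ℕ.m∸n+n≡m (ℕ.<⇒≤ (ℕ.≰⇒> n≰e)))) (ℕ.+-comm (n ∸ e) e)))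
            (ℕ.+-mono-≤ long longz))
      where
      bd′ : 5 + i ≤ K
      bd′ = ℕ.≤-trans (s≤s (s≤s (s≤s (s≤s (ℕ.m<m+n i (s≤s z≤n)))))) bd

    run : ∀ R i → 1 ≤ i → 4 + (i + R) ≤ K → (∀ j → i ≤ j → j < i + suc R → InsideChain j) →
      n ≤ suc R * d → HasPolygon
    run R i 1≤i bd chains h with split-chain n d ℕ.≤-refl (chains i ℕ.≤-refl (ℕ.m<m+n i (s≤s z≤n)))
    ... | inj₁ (ys , poly , _ , _ , long) = ys , poly , long
    ... | inj₂ cup = climb R i d 1≤i bd cup
      (λ j i<j j≤ → chains j (ℕ.<⇒≤ i<j) (subst (j <_) (sym (ℕ.+-suc i R)) (s≤s j≤))) h

  module _ (R : ℕ) (n≤Rd : n ≤ suc R * d) (large : ∀ i → 1 ≤ i → 4 + i ≤ K → Large i) where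

    private
      -- Each block either consists of `suc R` consecutive chains, enough for `climb` to reach `n`,
      -- or contributes a cap of `s` points. The three further indices in its width `4 + R` separate
      -- its cap from those of later blocks, as `append` requires.
      blocks : ∀ m b → 1 ≤ b → b + m * (4 + R) ≤ K →
        HasPolygon ⊎ (∃[ u ] (Tail (suc b) u × m * s ≤ length u))
      blocks zero    b 1≤b bd = inj₂ ([] , (tt , [] , []) , z≤n)
      blocks (suc m) b 1≤b bd
        with search (suc R) b (λ j b≤j j<b+R → outcome (ℕ.≤-trans 1≤b b≤j) (room j<b+R)
               (large j (ℕ.≤-trans 1≤b b≤j) (room j<b+R)))
           | blocks m (b + (4 + R)) (ℕ.≤-trans 1≤b (ℕ.m≤m+n b _))
               (subst (_≤ K) (sym (ℕ.+-assoc b (4 + R) _)) bd)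
        where
        shift : 3 + (b + suc R) ≡ b + (4 + R)
        shift = solve 2 (λ b R → con 3 :+ (b :+ (con 1 :+ R)) := b :+ (con 4 :+ R)) refl b R
          where open +-*-Solver
        room : ∀ {j} → j < b + suc R → 4 + j ≤ K
        room j<b+R = ℕ.≤-trans (s≤s (s≤s (s≤s j<b+R))) (ℕ.≤-trans (ℕ.≤-reflexive shift)
          (ℕ.≤-trans (ℕ.+-monoʳ-≤ b (ℕ.m≤m+n (4 + R) _)) bd))
      ... | inj₁ poly            | _         = inj₁ poly
      ... | inj₂ (inj₂ chains)   | _         = inj₁ (run R b 1≤b bd′ chains n≤Rd)
        where
        bd′ : 4 + (b + R) ≤ K
        bd′ = ℕ.≤-trans (ℕ.≤-trans (ℕ.≤-reflexive
            (solve 2 (λ b R → con 4 :+ (b :+ R) := b :+ (con 4 :+ R)) refl b R))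
          (ℕ.+-monoʳ-≤ b (ℕ.m≤m+n (4 + R) _))) bd
          where open +-*-Solver
      ... | inj₂ (inj₁ _)        | inj₁ poly = inj₁ poly
      ... | inj₂ (inj₁ (j , b≤j , j<b+R , ys , poly , out , tys , long)) | inj₂ (u , tail , longᵤ) =
        inj₂ (ys ++ u
          , weaken (s≤s b≤j) (append (ℕ.≤-trans 1≤b b≤j)
              (ℕ.≤-trans gap (ℕ.≤-trans (ℕ.+-monoʳ-≤ b (ℕ.m≤m+n (4 + R) _)) bd))
              (ℕ.≤-trans gap (ℕ.n≤1+n _)) ys u poly out tys tail)
          , subst (s + m * s ≤_) (sym (List.length-++ ys)) (ℕ.+-mono-≤ long longᵤ))
        where
        gap : 4 + j ≤ b + (4 + R)
        gap = ℕ.≤-trans (s≤s (s≤s (s≤s j<b+R)))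
          (ℕ.≤-reflexive (solve 2 (λ b R → con 3 :+ (b :+ (con 1 :+ R)) := b :+ (con 4 :+ R)) refl b R))
          where open +-*-Solver

    large⇒polygon : ∀ t → n ≤ t * s → 1 + t * (4 + R) ≤ K → HasPolygon
    large⇒polygon t n≤ts bd with blocks t 1 ℕ.≤-refl bd
    ... | inj₁ poly = poly
    ... | inj₂ (u , (poly , _) , long) = u , poly , ℕ.≤-trans n≤ts long

-- Averaging

𝟙 : {P : Set} → Dec P → ℕ
𝟙 d = if does d then 1 else 0

𝟙-≤1 : {P : Set} (d : Dec P) → 𝟙 d ≤ 1
𝟙-≤1 (yes _) = ℕ.≤-refl
𝟙-≤1 (no  _) = z≤n

𝟙-true : {P : Set} (d : Dec P) → P → 𝟙 d ≡ 1
𝟙-true (yes _) _ = refl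
𝟙-true (no ¬p) p = contradiction p ¬p

sum-mono : ∀ {n} {f g : Fin n → ℕ} → (∀ i → f i ≤ g i) → sum f ≤ sum g
sum-mono {zero}  h = z≤n
sum-mono {suc n} h = ℕ.+-mono-≤ (h zero) (sum-mono (h ∘ suc))

sum-const : ∀ n c → sum {n} (λ _ → c) ≡ n * c
sum-const zero    c = refl
sum-const (suc n) c = cong (_+_ c) (sum-const n c)

sum-∋ : ∀ {n} (f : Fin n → ℕ) i → f i ≤ sum f
sum-∋ f zero    = ℕ.m≤m+n _ _
sum-∋ f (suc i) = ℕ.≤-trans (sum-∋ (f ∘ suc) i) (ℕ.m≤n+m _ (f zero))

argmax : ∀ {n} (f : Fin (suc n) → ℕ) → ∃[ i ] (∀ j → f j ≤ f i)
argmax {zero}  f = zero , λ where zero → ℕ.≤-refl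
argmax {suc n} f with argmax (f ∘ suc)
... | i , max with ℕ.≤-total (f zero) (f (suc i))
...   | inj₁ h = suc i , λ where zero → h ; (suc j) → max j
...   | inj₂ h = zero , λ where zero → ℕ.≤-refl ; (suc j) → ℕ.≤-trans (max j) h

length-filter-tabulate : ∀ {A : Set} {P : A → Set} (P? : ∀ x → Dec (P x)) {n} (f : Fin n → A) →
  length (filter P? (List.tabulate f)) ≡ sum (λ i → 𝟙 (P? (f i)))
length-filter-tabulate P? {zero}  f = refl
length-filter-tabulate P? {suc n} f with P? (f zero)
... | yes _ = cong suc (length-filter-tabulate P? (f ∘ suc))
... | no  _ = length-filter-tabulate P? (f ∘ suc)

vsum : ∀ {L} m → (Vec (Fin L) m → ℕ) → ℕ
vsum zero    F = F []
vsum (suc m) F = sum (λ x → vsum m (λ v → F (x ∷ v)))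

module _ {L : ℕ} where

  vsum-mono : ∀ m {F G : Vec (Fin L) m → ℕ} → (∀ v → F v ≤ G v) → vsum m F ≤ vsum m G
  vsum-mono zero    h = h []
  vsum-mono (suc m) h = sum-mono (λ x → vsum-mono m (λ v → h (x ∷ v)))

  vsum-cong : ∀ m {F G : Vec (Fin L) m → ℕ} → (∀ v → F v ≡ G v) → vsum m F ≡ vsum m G
  vsum-cong zero    h = h []
  vsum-cong (suc m) h = sum-cong-≗ (λ x → vsum-cong m (λ v → h (x ∷ v)))

  vsum-const : ∀ m c → vsum {L} m (λ _ → c) ≡ L ^ m * c
  vsum-const zero    c = sym (ℕ.*-identityˡ c)
  vsum-const (suc m) c = trans (sum-cong-≗ {L} (λ _ → vsum-const m c))
    (trans (sum-const L (L ^ m * c)) (sym (ℕ.*-assoc L (L ^ m) c)))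

  vsum-∋ : ∀ m (F : Vec (Fin L) m → ℕ) v → F v ≤ vsum m F
  vsum-∋ zero    F []      = ℕ.≤-refl
  vsum-∋ (suc m) F (x ∷ v) = ℕ.≤-trans (vsum-∋ m (F ∘ (x ∷_)) v)
    (sum-∋ (λ x → vsum m (λ v → F (x ∷ v))) x)

  *-distribˡ-vsum : ∀ m c (F : Vec (Fin L) m → ℕ) → c * vsum m F ≡ vsum m (λ v → c * F v)
  *-distribˡ-vsum zero    c F = refl
  *-distribˡ-vsum (suc m) c F = trans (*-distribˡ-sum {L} c (λ x → vsum m (F ∘ (x ∷_))))
    (sum-cong-≗ (λ x → *-distribˡ-vsum m c (F ∘ (x ∷_))))

  vsum-sum-comm : ∀ m {n} (F : Vec (Fin L) m → Fin n → ℕ) →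
    vsum m (λ v → sum (F v)) ≡ sum (λ i → vsum m (λ v → F v i))
  vsum-sum-comm zero    F = refl
  vsum-sum-comm (suc m) F = trans (sum-cong-≗ {L} (λ x → vsum-sum-comm m (F ∘ (x ∷_))))
      (∑-comm {L} (λ x i → vsum m (λ v → F (x ∷ v) i)))

  vsum-comm : ∀ {L′} m k (F : Vec (Fin L) m → Vec (Fin L′) k → ℕ) →
    vsum m (λ v → vsum k (F v)) ≡ vsum k (λ w → vsum m (λ v → F v w))
  vsum-comm m zero    F = refl
  vsum-comm m (suc k) F = trans (vsum-sum-comm m (λ v x → vsum k (λ w → F v (x ∷ w))))
    (sum-cong-≗ (λ x → vsum-comm m k (λ v w → F v (x ∷ w))))

  -- Each vector arises `L` times, once for every value that was overwritten at `j`.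
  resample : ∀ {m} (j : Fin m) (F : Vec (Fin L) m → ℕ) →
    vsum m (λ g → sum (λ x → F (g Vec.[ j ]≔ x))) ≡ L * vsum m F
  resample {suc m} zero F = trans
    (sum-cong-≗ {L} (λ _ → vsum-sum-comm m (λ g x → F (x ∷ g))))
    (sum-const L _)
  resample {suc m} (suc j) F = trans
    (sum-cong-≗ (λ y → resample j (F ∘ (y ∷_))))
    (sym (*-distribˡ-sum {L} L (λ y → vsum m (F ∘ (y ∷_)))))

  update : ∀ {M m} → Vec (Fin M) m → Vec (Fin L) m → Vec (Fin L) M → Vec (Fin L) M
  update []       []      g = g
  update (j ∷ js) (x ∷ v) g = update js v (g Vec.[ j ]≔ x)

  -- Repeated indices in `js` merely overwrite a coordinate that is already uniform. This matters
  -- because `supersaturation` sums over all `e`, including those with repetitions.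
  resample-all : ∀ {M m} (js : Vec (Fin M) m) (F : Vec (Fin L) M → ℕ) →
    vsum M (λ g → vsum m (λ v → F (update js v g))) ≡ L ^ m * vsum M F
  resample-all []           F = sym (ℕ.*-identityˡ _)
  resample-all {M} {suc m} (j ∷ js) F = trans
    (resample j (λ g → vsum m (λ v → F (update js v g))))
    (trans (cong (L *_) (resample-all js F)) (sym (ℕ.*-assoc L _ _)))

  lookup-update-∉ : ∀ {M m} (js : Vec (Fin M) m) v (g : Vec (Fin L) M) i →
    (∀ a → i ≢ Vec.lookup js a) → Vec.lookup (update js v g) i ≡ Vec.lookup g i
  lookup-update-∉ []       []      g i i∉ = refl
  lookup-update-∉ (j ∷ js) (x ∷ v) g i i∉ = trans
    (lookup-update-∉ js v (g Vec.[ j ]≔ x) i (i∉ ∘ suc))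
    (Vec.lookup∘update′ (i∉ zero) g x)

  lookup-update : ∀ {M m} (js : Vec (Fin M) m) v (g : Vec (Fin L) M) a →
    (∀ a b → a ≢ b → Vec.lookup js a ≢ Vec.lookup js b) →
    Vec.lookup (update js v g) (Vec.lookup js a) ≡ Vec.lookup v a
  lookup-update (j ∷ js) (x ∷ v) g zero    distinct = trans
    (lookup-update-∉ js v (g Vec.[ j ]≔ x) j (λ b → distinct zero (suc b) (λ ())))
    (Vec.lookup∘update j g x)
  lookup-update (j ∷ js) (x ∷ v) g (suc a) distinct =
    lookup-update js v (g Vec.[ j ]≔ x) a
      (λ a b a≢b → distinct (suc a) (suc b) (a≢b ∘ Fin.suc-injective))

vsum-max : ∀ {l} m (F : Vec (Fin (suc l)) m → ℕ) → ∃[ v ] (vsum m F ≤ suc l ^ m * F v)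
vsum-max     zero    F = [] , ℕ.≤-reflexive (sym (ℕ.*-identityˡ _))
vsum-max {l} (suc m) F = proj₁ best ∷ proj₁ (inner (proj₁ best)) , (begin
  sum G                                      ≤⟨ sum-mono (proj₂ best) ⟩
  sum {suc l} (λ _ → G x)                    ≡⟨ sum-const (suc l) (G x) ⟩
  suc l * G x                                ≤⟨ ℕ.*-monoʳ-≤ (suc l) (proj₂ (inner x)) ⟩
  suc l * (suc l ^ m * F (x ∷ proj₁ (inner x))) ≡⟨ ℕ.*-assoc (suc l) (suc l ^ m) _ ⟨
  suc l ^ suc m * F (x ∷ proj₁ (inner x))    ∎)
  where
  open ℕ.≤-Reasoning
  G = λ x → vsum m (λ v → F (x ∷ v))
  best = argmax G
  x = proj₁ best
  inner = λ x → vsum-max m (λ v → F (x ∷ v))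

-- Resampling the coordinates js e of a uniformly random g leaves it uniformly random, so e and g are
-- found by averaging.
supersaturation : ∀ {l k w m} (js : Vec (Fin (suc k)) w → Vec (Fin (suc k)) m)
  {W : Vec (Fin (suc k)) w → Vec (Fin (suc l)) (suc k) → Set} (W? : ∀ e g → Dec (W e g)) →
  (∀ g → ∃[ e ] W e g) →
  ∃[ e ] ∃[ g ] (suc l ^ m ≤ suc k ^ w * vsum m (λ v → 𝟙 (W? e (update (js e) v g))))
supersaturation {l} {k} {w} {m} js W? cover =
  e , g , ℕ.*-cancelʳ-≤ _ _ (L ^ M) {{ℕ.m^n≢0 L M}} (begin
    L ^ m * L ^ M                            ≡⟨ cong (L ^ m *_)
        (trans (sym (ℕ.*-identityʳ _)) (sym (vsum-const M 1))) ⟩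
    L ^ m * vsum M (λ g → 1)                 ≤⟨ ℕ.*-monoʳ-≤ (L ^ m) (vsum-mono M covered) ⟩
    L ^ m * vsum M (λ g → vsum w (λ e → 𝟙 (W? e g)))
      ≡⟨ cong (L ^ m *_) (vsum-comm M w (λ g e → 𝟙 (W? e g))) ⟩
    L ^ m * vsum w (λ e → vsum M (λ g → 𝟙 (W? e g)))
      ≡⟨ *-distribˡ-vsum w (L ^ m) _ ⟩
    vsum w (λ e → L ^ m * vsum M (λ g → 𝟙 (W? e g)))
      ≡⟨ vsum-cong w (λ e → sym (resample-all (js e) (λ g → 𝟙 (W? e g)))) ⟩
    vsum w (λ e → vsum M (λ g → H e g))      ≤⟨ proj₂ best ⟩
    M ^ w * vsum M (H e)                     ≤⟨ ℕ.*-monoʳ-≤ (M ^ w) (proj₂ best′) ⟩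
    M ^ w * (L ^ M * H e g)                  ≡⟨ solve 3 (λ a b c → a :* (b :* c) := a :* c :* b) refl
        (M ^ w) (L ^ M) (H e g) ⟩
    M ^ w * H e g * L ^ M                    ∎)
  where
  open ℕ.≤-Reasoning
  open +-*-Solver using (solve; _:*_; _:=_)
  L = suc l
  M = suc k
  H : Vec (Fin M) w → Vec (Fin L) M → ℕ
  H e g = vsum m (λ v → 𝟙 (W? e (update (js e) v g)))
  best = vsum-max w (λ e → vsum M (H e))
  e = proj₁ best
  best′ = vsum-max M (H e)
  g = proj₁ best′
  covered : ∀ g → 1 ≤ vsum w (λ e → 𝟙 (W? e g))
  covered g with cover g
  ... | e , h = ℕ.≤-trans (ℕ.≤-reflexive (sym (𝟙-true (W? e g) h))) (vsum-∋ w (λ e → 𝟙 (W? e g)) e)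

prod : ∀ {m} → (Fin m → ℕ) → ℕ
prod {zero}  f = 1
prod {suc m} f = f zero * prod (f ∘ suc)

vsum-prod : ∀ {L} m (f : Fin m → Fin L → ℕ) →
  vsum m (λ v → prod (λ a → f a (Vec.lookup v a))) ≡ prod (λ a → sum (f a))
vsum-prod zero    f = refl
vsum-prod (suc m) f = trans
  (sum-cong-≗ (λ x → trans (sym (*-distribˡ-vsum m (f zero x) _))
      (cong (f zero x *_) (vsum-prod m (f ∘ suc)))))
  (sym (*-distribʳ-sum _ (f zero)))

prod-𝟙 : ∀ {m} {C : Fin m → Set} (C? : ∀ a → Dec (C a)) → (∀ a → C a) → 1 ≤ prod (λ a → 𝟙 (C? a))
prod-𝟙 {zero}  C? h = ℕ.≤-refl
prod-𝟙 {suc m} C? h = ℕ.*-mono-≤ (ℕ.≤-reflexive (sym (𝟙-true (C? zero) (h zero))))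
    (prod-𝟙 (C? ∘ suc) (h ∘ suc))

-- The set `H` is contained in a box whose sides are the sets `C a`. This turns the density of good
-- resamplings into lower bounds for individual sides.
count-boxes : ∀ {L m} {H : Vec (Fin L) m → Set} (H? : ∀ v → Dec (H v))
  {C : Fin m → Fin L → Set} (C? : ∀ a x → Dec (C a x)) → (∀ v → H v → ∀ a → C a (Vec.lookup v a)) →
  vsum m (λ v → 𝟙 (H? v)) ≤ prod (λ a → sum (λ x → 𝟙 (C? a x)))
count-boxes {m = m} {H} H? C? h = ℕ.≤-trans (vsum-mono m bound) (ℕ.≤-reflexive (vsum-prod m _))
  where
  bound : ∀ v → 𝟙 (H? v) ≤ prod (λ a → 𝟙 (C? a (Vec.lookup v a)))
  bound v with H? v
  ... | yes p = prod-𝟙 (λ a → C? a (Vec.lookup v a)) (h v p)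
  ... | no  _ = z≤n

module _ (K L : ℕ) where

  big? : ∀ {m} (τ : Fin m → ℕ) a → Dec (L ≤ K * τ a)
  big? τ a = L ℕ.≤? K * τ a

  -- Every factor below `L / K` loses a factor `K` against the maximal product `L ^ m`, so a product
  -- that is not too small has few of them.
  small-factors : ∀ {m} (τ : Fin m → ℕ) → (∀ a → τ a ≤ L) →
    K ^ sum (λ a → 𝟙 (¬? (big? τ a))) * prod τ ≤ L ^ m
  small-factors {zero}  τ h = ℕ.≤-refl
  small-factors {suc m} τ h = go (τ zero) (h zero) (big? τ zero) (small-factors (τ ∘ suc) (h ∘ suc))
    where
    open +-*-Solver using (solve; _:*_; _:=_)
    go : ∀ t → t ≤ L → (d : Dec (L ≤ K * t)) → ∀ {b p l} → K ^ b * p ≤ l →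
      K ^ (𝟙 (¬? d) + b) * (t * p) ≤ L * l
    go t t≤L (yes _) {b} {p} ih = ℕ.≤-trans
      (ℕ.≤-reflexive (solve 3 (λ k t p → k :* (t :* p) := t :* (k :* p)) refl (K ^ b) t p))
      (ℕ.*-mono-≤ t≤L ih)
    go t t≤L (no few) {b} {p} ih = ℕ.≤-trans
      (ℕ.≤-reflexive (solve 4 (λ K k t p → K :* k :* (t :* p) := K :* t :* (k :* p)) refl K (K ^ b) t p))
      (ℕ.*-mono-≤ (ℕ.<⇒≤ (ℕ.≰⇒> few)) ih)

  many-big : .{{_ : NonZero L}} → .{{_ : NonZero K}} → ∀ {m} (τ : Fin m → ℕ) → (∀ a → τ a ≤ L) → ∀ E h →
    L ^ m ≤ E * prod τ → E < K ^ h → m ≤ length (filter (big? τ) (allFin m)) + h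
  many-big {m} τ bd E h large small = ℕ.≮⇒≥ λ few → ℕ.<⇒≱ small
    (ℕ.*-cancelʳ-≤ _ _ (L ^ m) {{ℕ.m^n≢0 L m}} (begin
      K ^ h * L ^ m          ≤⟨ ℕ.*-mono-≤ (ℕ.^-monoʳ-≤ K (h≤b few)) large ⟩
      K ^ b * (E * prod τ)   ≡⟨ solve 3 (λ k e p → k :* (e :* p) := e :* (k :* p)) refl (K ^ b) E (prod τ) ⟩
      E * (K ^ b * prod τ)   ≤⟨ ℕ.*-monoʳ-≤ E (small-factors τ bd) ⟩
      E * L ^ m              ∎))
    where
    open ℕ.≤-Reasoning
    open +-*-Solver using (solve; _:*_; _:=_)
    b = sum (λ a → 𝟙 (¬? (big? τ a)))
    split : m ≡ length (filter (big? τ) (allFin m)) + b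
    split = trans (sym (List.length-tabulate (λ i → i))) (trans (length-filter-split (big? τ) (allFin m))
      (cong (_+_ _) (length-filter-tabulate (¬? ∘ big? τ) (λ i → i))))
    h≤b : length (filter (big? τ) (allFin m)) + h < m → h ≤ b
    h≤b few = ℕ.<⇒≤ (ℕ.+-cancelˡ-< (length (filter (big? τ) (allFin m))) h b
        (subst (length (filter (big? τ) (allFin m)) + h <_) split few))

AllPairs-toList : {A : Set} {R : A → A → Set} → ∀ {n} (e : Vec A n) → AllPairs R (Vec.toList e) →
  ∀ {i j} → i Fin.< j → R (Vec.lookup e i) (Vec.lookup e j)
AllPairs-toList (x ∷ e) (p ∷ ps) {zero}  {suc j} _         = All-toList e p j
  where
  All-toList : {A : Set} {P : A → Set} → ∀ {n} (e : Vec A n) → All P (Vec.toList e) →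
    ∀ i → P (Vec.lookup e i)
  All-toList (x ∷ e) (p ∷ ps) zero    = p
  All-toList (x ∷ e) (p ∷ ps) (suc i) = All-toList e ps i
AllPairs-toList (x ∷ e) (p ∷ ps) {suc i} {suc j} (s≤s i<j) = AllPairs-toList e ps i<j

AllTriples-toList : {A : Set} {R : A → A → A → Set} → ∀ {n} (e : Vec A n) →
  AllTriples R (Vec.toList e) →
  ∀ {i j k} → i Fin.< j → j Fin.< k → R (Vec.lookup e i) (Vec.lookup e j) (Vec.lookup e k)
AllTriples-toList (x ∷ e) (p , t) {zero}  {suc j} {suc k} _         (s≤s j<k) = AllPairs-toList e p j<k
AllTriples-toList (x ∷ e) (p , t) {suc i} {suc j} {suc k} (s≤s i<j) (s≤s j<k) =
  AllTriples-toList e t i<j j<k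

list⇒vec : {A : Set} (u : List A) → ∀ {n} → length u ≡ n → ∃[ e ] (Vec.toList {n = n} e ≡ u)
list⇒vec u refl = Vec.fromList u , Vec.toList∘fromList u

-- Combs are indexed by all of `ℕ`; the default fills the irrelevant indices beyond the list.
at : {A : Set} → A → List A → ℕ → A
at d []       _       = d
at d (x ∷ xs) zero    = x
at d (x ∷ xs) (suc i) = at d xs i

All-at : {A : Set} {P : A → Set} {d : A} {xs : List A} → All P xs → ∀ {i} → i < length xs →
  P (at d xs i)
All-at (p ∷ ps) {zero}  _         = p
All-at (p ∷ ps) {suc i} (s≤s i<n) = All-at ps i<n

AllPairs-at : {A : Set} {R : A → A → Set} {d : A} {xs : List A} → AllPairs R xs →
  ∀ {i j} → i < j → j < length xs → R (at d xs i) (at d xs j)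
AllPairs-at (p ∷ ps) {zero}  {suc j} _         (s≤s j<n) = All-at p j<n
AllPairs-at (p ∷ ps) {suc i} {suc j} (s≤s i<j) (s≤s j<n) = AllPairs-at ps i<j j<n

𝟙-sound : {P : Set} (d : Dec P) → 0 < 𝟙 d → P
𝟙-sound (yes p) _ = p
𝟙-sound (no  _) ()

-- Extracting a comb from a radially sorted point set

module PositiveFraction {N : ℕ} (O : Orientation N) {k l : ℕ} (m′ : ℕ)
  (t : Fin N) (q : Fin (suc k * suc l) → Fin N)
  (sorted : ∀ {i j} → i Fin.< j → Orientation.Ccw O t (q i) (q j))
  (ES≤ : cupCapBound (m′ * 2) (m′ * 2) ≤ suc k) where
  open Chirotope O

  private
    m w M L : ℕ
    m = suc m′
    w = m * 2
    M = suc k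
    L = suc l

    pt : Fin M → Fin L → Fin N
    pt j a = q (Fin.combine j a)

    pt-injective : ∀ j {a b} → a ≢ b → pt j a ≢ pt j b
    pt-injective j {a} {b} a≢b eq with Fin.<-cmp (Fin.combine j a) (Fin.combine j b)
    ... | tri< lt _ _ = ccw⇒≢ (cyc (sorted lt)) eq
    ... | tri≈ _ e _  = a≢b (Fin.combine-injectiveʳ j a j b e)
    ... | tri> _ _ gt = ccw⇒≢ (cyc (sorted gt)) (sym eq)

    choice : Vec (Fin L) M → Fin M → Fin N
    choice g j = pt j (Vec.lookup g j)

    -- The blocks are listed in counterclockwise order of the polygon, increasing for a cap and
    -- decreasing for a cup, so one predicate covers both. Distinctness keeps the resampled blocks
    -- from interfering with the fixed ones.
    W : Vec (Fin M) w → Vec (Fin L) M → Set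
    W e g = AllPairs _≢_ (Vec.toList e)
      × AllTriples (λ i j k → Ccw (choice g i) (choice g j) (choice g k)) (Vec.toList e)

    abstract
      W? : ∀ e g → Dec (W e g)
      W? e g = AllPairs.allPairs? (λ i j → ¬? (i Fin.≟ j)) (Vec.toList e)
        ×-dec allTriples? (λ i j k → ccw? (choice g i) (choice g j) (choice g k)) (Vec.toList e)

    cover : ∀ g → ∃[ e ] W e g
    cover g with indexed-cups-caps t (choice g) (λ i<j → sorted (Fin.combine-monoˡ-< _ _ i<j)) _ _ ES≤
    ... | inj₁ (u , s , tr , len) with list⇒vec u len
    ...   | e , refl = e , AllPairs.map Fin.<⇒≢ s , tr
    cover g | inj₂ (u , s , tr , len) with list⇒vec u len
    ...   | e , refl = e , AllPairs.map (λ gt → ≢-sym (Fin.<⇒≢ gt)) s , tr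

    -- Points in blocks at even positions stay fixed and become the teeth; blocks at odd positions
    -- are resampled and become the sets between them.
    even odd : Fin m → Fin w
    even a = Fin.combine a zero
    odd  a = Fin.combine a (suc zero)

    even<even : ∀ {a b} → a Fin.< b → even a Fin.< even b
    even<even = Fin.combine-monoˡ-< zero zero

    odd<even : ∀ {a b} → a Fin.< b → odd a Fin.< even b
    odd<even = Fin.combine-monoˡ-< (suc zero) zero

    even<odd : ∀ {a b} → a Fin.≤ b → even a Fin.< odd b
    even<odd {a} {b} a≤b = subst₂ _<_ (sym (Fin.toℕ-combine a zero)) (sym (Fin.toℕ-combine b (suc zero)))
      (ℕ.+-mono-≤-< (ℕ.*-monoʳ-≤ 2 a≤b) (s≤s z≤n))

    js : Vec (Fin M) w → Vec (Fin M) m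
    js e = Vec.tabulate (λ a → Vec.lookup e (odd a))

    abundant : ∃[ e ] ∃[ g ] (L ^ m ≤ M ^ w * vsum m (λ v → 𝟙 (W? e (update (js e) v g))))
    abundant = supersaturation js W? cover

  module Pattern (e : Vec (Fin M) w) (g : Vec (Fin L) M)
    (many : L ^ m ≤ M ^ w * vsum m (λ v → 𝟙 (W? e (update (js e) v g)))) where

    private
      X : Fin m → Fin N
      X a = choice g (Vec.lookup e (even a))

      Y : Fin m → Fin L → Fin N
      Y a = pt (Vec.lookup e (odd a))

      H : Vec (Fin L) m → Set
      H v = W e (update (js e) v g)

      module _ (v : Vec (Fin L) m) (h : H v) where
        distinct : ∀ {i j} → i ≢ j → Vec.lookup e i ≢ Vec.lookup e j
        distinct {i} {j} i≢j with Fin.<-cmp i j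
        ... | tri< lt _ _ = AllPairs-toList e (proj₁ h) lt
        ... | tri≈ _ eq _ = contradiction eq i≢j
        ... | tri> _ _ gt = ≢-sym (AllPairs-toList e (proj₁ h) gt)

        even≢odd : ∀ a b → even a ≢ odd b
        even≢odd a b eq with Fin.combine-injectiveʳ a zero b (suc zero) eq
        ... | ()

        lookup-js : ∀ b → Vec.lookup (js e) b ≡ Vec.lookup e (odd b)
        lookup-js = Vec.lookup∘tabulate (λ a → Vec.lookup e (odd a))

        at-even : ∀ a → choice (update (js e) v g) (Vec.lookup e (even a)) ≡ X a
        at-even a = cong (pt (Vec.lookup e (even a))) (lookup-update-∉ (js e) v g _ λ b eq →
          distinct (even≢odd a b) (trans eq (lookup-js b)))

        at-odd : ∀ a → choice (update (js e) v g) (Vec.lookup e (odd a)) ≡ Y a (Vec.lookup v a)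
        at-odd a = cong (pt (Vec.lookup e (odd a))) (trans
          (cong (Vec.lookup (update (js e) v g)) (sym (lookup-js a)))
          (lookup-update (js e) v g a λ b c b≢c eq → distinct
            (λ o → b≢c (Fin.combine-injectiveˡ b (suc zero) c (suc zero) o))
            (trans (sym (lookup-js b)) (trans eq (lookup-js c)))))

        triple : ∀ {a b c} → a Fin.< b → b Fin.< c → ∀ {x y z} →
          choice (update (js e) v g) (Vec.lookup e a) ≡ x →
          choice (update (js e) v g) (Vec.lookup e b) ≡ y →
          choice (update (js e) v g) (Vec.lookup e c) ≡ z → Ccw x y z
        triple a<b b<c refl refl refl = AllTriples-toList e (proj₂ h) a<b b<c

      -- Each condition combines one varying point with fixed ones only. It is therefore a condition
      -- on a single coordinate of `v`, which is what makes a box out of them.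
      C : Fin m → Fin L → Set
      C a x = (∀ b c → b Fin.< c → c Fin.≤ a → Ccw (X b) (X c) (Y a x))
        × (∀ b c → b Fin.≤ a → a Fin.< c → Ccw (X b) (Y a x) (X c))
        × (∀ b c → a Fin.< b → b Fin.< c → Ccw (Y a x) (X b) (X c))

      abstract
        C? : ∀ a x → Dec (C a x)
        C? a x = Fin.all? (λ b → Fin.all? λ c → (b Fin.<? c) →-dec (c Fin.≤? a) →-dec ccw? (X b) (X c)
            (Y a x))
          ×-dec Fin.all? (λ b → Fin.all? λ c → (b Fin.≤? a) →-dec (a Fin.<? c) →-dec ccw? (X b) (Y a x)
              (X c))
          ×-dec Fin.all? (λ b → Fin.all? λ c → (a Fin.<? b) →-dec (b Fin.<? c) →-dec ccw? (Y a x) (X b)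
              (X c))

      H⇒C : ∀ v → H v → ∀ a → C a (Vec.lookup v a)
      H⇒C v h a =
          (λ b c b<c c≤a → triple v h (even<even b<c) (even<odd c≤a) (at-even v h b) (at-even v h c)
              (at-odd v h a))
        , (λ b c b≤a a<c → triple v h (even<odd b≤a) (odd<even a<c) (at-even v h b) (at-odd v h a)
            (at-even v h c))
        , (λ b c a<b b<c → triple v h (odd<even a<b) (even<even b<c) (at-odd v h a) (at-even v h b)
            (at-even v h c))

      -- The convexity of the fixed points `X` does not involve `v`, but it is asserted only by `H`;
      -- so one good resampling has to be exhibited.
      nonempty : ∃[ v ] H v
      nonempty = v , 𝟙-sound (W? e (update (js e) v g)) (ℕ.n≢0⇒n>0 λ eq →
        ℕ.<⇒≱ (ℕ.m^n>0 L m) (ℕ.≤-trans many (ℕ.≤-trans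
          (ℕ.*-monoʳ-≤ (M ^ w) (proj₂ max))
          (ℕ.≤-reflexive (trans (cong (λ z → M ^ w * (L ^ m * z)) eq)
            (trans (cong (M ^ w *_) (ℕ.*-zeroʳ (L ^ m))) (ℕ.*-zeroʳ (M ^ w))))))))
        where
        max = vsum-max m (λ v → 𝟙 (W? e (update (js e) v g)))
        v = proj₁ max

      X-convex : ∀ {a b c} → a Fin.< b → b Fin.< c → Ccw (X a) (X b) (X c)
      X-convex {a} {b} {c} a<b b<c = triple v h (even<even a<b) (even<even b<c) (at-even v h a)
          (at-even v h b) (at-even v h c)
        where
        v = proj₁ nonempty
        h = proj₂ nonempty

      τ : Fin m → ℕ
      τ a = sum (λ x → 𝟙 (C? a x))

      τ≤L : ∀ a → τ a ≤ L
      τ≤L a = ℕ.≤-trans (sum-mono (λ x → 𝟙-≤1 (C? a x)))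
        (ℕ.≤-reflexive (trans (sum-const L 1) (ℕ.*-identityʳ L)))

    pattern-comb : ∀ κ h K size → .{{_ : NonZero κ}} → M ^ w < κ ^ h → K + h < m → κ * size ≤ L →
      Σ[ comb ∈ Comb O K ] (∀ i → i ≤ K →
        ∃[ ys ] (All (Comb.T comb i) ys × AllPairs _≢_ ys × size ≤ length ys))
    pattern-comb κ h K size M^w< K+h<m κs≤L = comb , large
      where
      goods : List (Fin m)
      goods = filter (big? κ L τ) (allFin m)
      K<goods : K < length goods
      -- The box bound makes the product of all `τ a` at least `L ^ m / M ^ w`, and `M ^ w < κ ^ h`
      -- then leaves at most `h` positions with `κ * τ a < L`.
      K<goods = ℕ.+-cancelʳ-< h K (length goods) (ℕ.<-≤-trans K+h<m
        (many-big κ L τ τ≤L (M ^ w) h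
          (ℕ.≤-trans many (ℕ.*-monoʳ-≤ (M ^ w) (count-boxes (λ v → W? e (update (js e) v g)) C? H⇒C)))
              M^w<))
      s : ℕ → Fin m
      s = at zero goods
      s-mono : ∀ {i j} → i < j → j ≤ K → s i Fin.< s j
      s-mono i<j j≤K = AllPairs-at {R = Fin._<_} {d = zero} {xs = goods}
        (AllPairs.filter⁺ (big? κ L τ) (AllPairs.tabulate⁺-< {n = m} {f = λ i → i} (λ i<j → i<j)))
        i<j (ℕ.≤-<-trans j≤K K<goods)
      s-mono-≤ : ∀ {i j} → i ≤ j → j ≤ K → s i Fin.≤ s j
      s-mono-≤ i≤j j≤K with ℕ.m≤n⇒m<n∨m≡n i≤j
      ... | inj₁ i<j  = ℕ.<⇒≤ (s-mono i<j j≤K)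
      ... | inj₂ refl = ℕ.≤-refl
      comb : Comb O K
      comb = record
        { x   = X ∘ s
        ; T   = λ i y → ∃[ a ] (C (s i) a × Y (s i) a ≡ y)
        ; xxx = λ a<b b<c c≤K → X-convex (s-mono a<b (ℕ.<⇒≤ (ℕ.<-≤-trans b<c c≤K))) (s-mono b<c c≤K)
        ; xxy = λ where
          a<b b≤i i≤K (_ , (p , _) , refl) →
            p _ _ (s-mono a<b (ℕ.≤-trans b≤i i≤K)) (s-mono-≤ b≤i i≤K)
        ; xyx = λ where
          a≤i i<b b≤K (_ , (_ , p , _) , refl) →
            p _ _ (s-mono-≤ a≤i (ℕ.<⇒≤ (ℕ.<-≤-trans i<b b≤K))) (s-mono i<b b≤K)
        ; yxx = λ where
          i<a a<b b≤K (_ , (_ , _ , p) , refl) →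
            p _ _ (s-mono i<a (ℕ.<⇒≤ (ℕ.<-≤-trans a<b b≤K))) (s-mono a<b b≤K)
        }
      large : ∀ i → i ≤ K → ∃[ ys ] (All (Comb.T comb i) ys × AllPairs _≢_ ys × size ≤ length ys)
      large i i≤K = map (Y a) xs
        , All.map⁺ (All.map (λ c → _ , c , refl) (All.all-filter (C? a) (allFin L)))
        , AllPairs.map⁺ (AllPairs.filter⁺ (C? a) (AllPairs.tabulate⁺-< {n = L} {f = λ i → i}
            (λ i<j → pt-injective (Vec.lookup e (odd a)) (Fin.<⇒≢ i<j))))
        , ℕ.*-cancelˡ-≤ κ (ℕ.≤-trans κs≤L (subst (λ z → L ≤ κ * z) (sym count)
            (All-at (All.all-filter (big? κ L τ) (allFin m)) (ℕ.≤-<-trans i≤K K<goods))))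
        where
        a = s i
        xs = filter (C? a) (allFin L)
        count : length (map (Y a) xs) ≡ τ a
        count = trans (List.length-map (Y a) xs) (length-filter-tabulate (C? a) (λ x → x))

  positive-fraction : ∀ κ h K size → .{{_ : NonZero κ}} → M ^ w < κ ^ h → K + h < m → κ * size ≤ L →
    Σ[ comb ∈ Comb O K ] (∀ i → i ≤ K →
      ∃[ ys ] (All (Comb.T comb i) ys × AllPairs _≢_ ys × size ≤ length ys))
  positive-fraction = Pattern.pattern-comb (proj₁ abundant) (proj₁ (proj₂ abundant))
      (proj₂ (proj₂ abundant))

-- Choice of the parameters

2^-+ : ∀ a b → 2 ^ a * 2 ^ b ≡ 2 ^ (a + b)
2^-+ a b = sym (ℕ.^-distribˡ-+-* 2 a b)

-- The slack is given explicitly, so that a polynomial inequality becomes an identity for the ring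
-- solver.
≤-by : ∀ {a b} d → b ≡ a + d → a ≤ b
≤-by d refl = ℕ.m≤m+n _ d

module _ {N : ℕ} (O : Orientation N) where
  open Chirotope O

  comb-polygon : ∀ t (Q : List (Fin N)) → AllPairs (Ccw t) Q →
    ∀ n m R d s b K h κ A M L .{{_ : NonZero κ}} .{{_ : NonZero M}} .{{_ : NonZero L}} →
    cupCapBound (m * 2) (m * 2) ≤ M → M ^ (suc m * 2) < κ ^ h → K + h < suc m →
    κ * (A * 2 ^ suc (n + d)) ≤ L → cupCapBound s n ≤ A →
    n ≤ suc R * d → n ≤ b * s → 1 + b * (4 + R) ≤ K → M * L ≤ length Q →
    ∃[ u ] (Polygon u × n ≤ length u)
  comb-polygon t Q sorted n m R d s b K h κ A (suc k) (suc l) ES≤M M^< K+h< ≤L ES≤A n≤Rd n≤bs ≤K ≤Q =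
    large⇒polygon R n≤Rd
      (λ i 1≤i bd → proj₂ found (suc i) (ℕ.<⇒≤ (ℕ.<⇒≤ (ℕ.<⇒≤ bd)))) b n≤bs ≤K
    where
    q : Fin (suc k * suc l) → Fin N
    q i = lookup Q (Fin.inject≤ i ≤Q)
    q-sorted : ∀ {i j} → i Fin.< j → Ccw t (q i) (q j)
    q-sorted {i} {j} i<j = AllPairs-lookup Q sorted
      (subst₂ _<_ (sym (Fin.toℕ-inject≤ i ≤Q)) (sym (Fin.toℕ-inject≤ j ≤Q)) i<j)
    found = PositiveFraction.positive-fraction O m t q q-sorted ES≤M κ h K (A * 2 ^ suc (n + d)) M^< K+h< ≤L
    open LargeCombs O (proj₁ found) n d s A ES≤A

  -- The constants: combs of length 45 c² are found among 100 c² positions, of which less than 50 c² lose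
  -- more than 1601 c² bits.
  polygon : ∀ t (Q : List (Fin N)) → AllPairs (Ccw t) Q →
    ∀ n c g → 1 ≤ c → n < suc c ^ 3 → n < 2 ^ suc g → 502 ≤ g →
    2 ^ (n + 6 * (c * c) * g) ≤ suc (length Q) →
    ∃[ u ] (Polygon u × n ≤ length u)
  polygon t Q sorted n (suc v) g _ n<c³ n<2g 502≤g long = comb-polygon t Q sorted
    n m (v + 7 * c) u (2 * u) (4 * c) (45 * u) (50 * u) κ A M L
    {{ℕ.m^n≢0 2 (1601 * u)}} {{ℕ.m^n≢0 2 (400 * u)}}
    {{ℕ.m*n≢0 κ _ {{ℕ.m^n≢0 2 (1601 * u)}} {{ℕ.m*n≢0 A _ {{ℕ.m^n≢0 2 (1 + suc g * (2 * u))}}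
        {{ℕ.m^n≢0 2 (suc (n + u))}}}}}}
    -- Since `suc m` is `100 c²`, the exponent of this bound is `400 c² - 3`.
    (ℕ.≤-trans (cupCapBound≤2^ (m * 2) (m * 2)) (ℕ.^-monoʳ-≤ 2
      (≤-by 3 (solve 1 (λ v → con 400 :* ((con 1 :+ v) :* (con 1 :+ v)) := con 1 :+
          (m′ v :* con 2 :+ m′ v :* con 2) :+ con 3) refl v))))
    -- The exponents are `80000 c⁴` and `80050 c⁴`; with 1600 in place of 1601 they would be equal.
    (subst₂ _<_ (sym (ℕ.^-*-assoc 2 (400 * u) (suc m * 2))) (sym (ℕ.^-*-assoc 2 (1601 * u) (50 * u)))
      (ℕ.^-monoʳ-< 2 (s≤s (s≤s z≤n)) exponents))
    (≤-by (4 + 10 * v + 5 * (v * v)) (solve 1 (λ v → con 100 :* u′ v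
      := con 1 :+ (con 45 :* u′ v :+ con 50 :* u′ v) :+ (con 4 :+ con 10 :* v :+ con 5 :* (v :* v)))
          refl v))
    ℕ.≤-refl
    (ℕ.≤-trans (cupCapBound≤^ (2 * u) n) (ℕ.*-monoʳ-≤ 2 (ℕ.≤-trans (ℕ.^-monoˡ-≤ (2 * u) n<2g)
      (ℕ.≤-reflexive (ℕ.^-*-assoc 2 (suc g) (2 * u))))))
    -- In this and the next inequality the product is `8 c³`, that is `(2 c)³`, which is at least
    -- `(c + 1)³` because `1 ≤ c`.
    (ℕ.≤-trans (ℕ.<⇒≤ n<c³) (≤-by (7 * (v * v * v) + 18 * (v * v) + 12 * v) (solve 1 (λ v →
      (con 1 :+ (v :+ con 7 :* (con 1 :+ v))) :* u′ v
        := (con 2 :+ v) :^ 3 :+ (con 7 :* (v :* v :* v) :+ con 18 :* (v :* v) :+ con 12 :* v)) refl v)))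
    (ℕ.≤-trans (ℕ.<⇒≤ n<c³) (≤-by (7 * (v * v * v) + 18 * (v * v) + 12 * v) (solve 1 (λ v →
      (con 4 :* (con 1 :+ v)) :* (con 2 :* u′ v)
        := (con 2 :+ v) :^ 3 :+ (con 7 :* (v :* v :* v) :+ con 18 :* (v :* v) :+ con 12 :* v)) refl v)))
    -- Here `4 c` blocks of width `8 c + 3` take `32 c² + 12 c` teeth; adding one gives at most
    -- `45 c²`, with equality for `c = 1`.
    (≤-by (13 * (v * v) + 14 * v) (solve 1 (λ v → con 45 :* u′ v
      := con 1 :+ con 4 :* (con 1 :+ v) :* (con 4 :+ (v :+ con 7 :* (con 1 :+ v))) :+
          (con 13 :* (v :* v) :+ con 14 :* v)) refl v))
    -- The strict inequality of exponents pays for the point `t`, which is missing from `Q`.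
    (ℕ.≤-pred (ℕ.≤-trans (subst (_< 2 ^ (n + 6 * (c * c) * g)) (sym ML)
        (ℕ.^-monoʳ-< 2 (s≤s (s≤s z≤n)) exponent-bound)) long))
    where
    open +-*-Solver
    c u m M κ A L : ℕ
    c = suc v
    u = c * c
    m = v + v * suc v + 99 * u
    M = 2 ^ (400 * u)
    κ = 2 ^ (1601 * u)
    A = 2 ^ (1 + suc g * (2 * u))
    L = κ * (A * 2 ^ suc (n + u))
    m′ : ∀ {n} → Polynomial n → Polynomial n
    m′ v = v :+ v :* (con 1 :+ v) :+ con 99 :* ((con 1 :+ v) :* (con 1 :+ v))
    u′ : ∀ {n} → Polynomial n → Polynomial n
    u′ v = (con 1 :+ v) :* (con 1 :+ v)
    exponents : 400 * u * (suc m * 2) < 1601 * u * (50 * u)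
    exponents = ≤-by (49 + 200 * v + 300 * (v * v) + 200 * (v * v * v) + 50 * (v * v * v * v))
        (solve 1 (λ v →
      con 1601 :* u′ v :* (con 50 :* u′ v) := con 1 :+ con 400 :* u′ v :* ((con 1 :+ m′ v) :* con 2)
        :+ (con 49 :+ con 200 :* v :+ con 300 :* (v :* v) :+ con 200 :* (v :* v :* v) :+ con 50 :*
            (v :* v :* v :* v))) refl v)
    E : ℕ
    E = 400 * u + (1601 * u + ((1 + suc g * (2 * u)) + suc (n + u)))
    ML : M * L ≡ 2 ^ E
    ML = trans (cong (M *_) (trans (cong (κ *_) (2^-+ (1 + suc g * (2 * u)) (suc (n + u))))
      (2^-+ (1601 * u) _))) (2^-+ (400 * u) _)
    exponent-bound : E < n + 6 * (c * c) * g
    exponent-bound = subst (λ g → 400 * u + (1601 * u + ((1 + suc g * (2 * u)) + suc (n + u))) < n + 6 *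
        (c * c) * g)
      (ℕ.m+[n∸m]≡n 502≤g)
      -- Of `6 c² g`, the caps use `2 c² g`. The remaining `4 c² g` must exceed `2004 c² + 2`, and
      -- 502 is the least `g` for which it does.
      (≤-by (4 * (v * v) + 8 * v + 1 + 4 * (u * (g ∸ 502))) (solve 3 (λ n v e →
        n :+ con 6 :* u′ v :* (con 502 :+ e) := con 1 :+ (con 400 :* u′ v :+ (con 1601 :* u′ v
          :+ ((con 1 :+ (con 1 :+ (con 502 :+ e)) :* (con 2 :* u′ v)) :+ (con 1 :+ (n :+ u′ v)))))
          :+ (con 4 :* (v :* v) :+ con 8 :* v :+ con 1 :+ con 4 :* (u′ v :* e))) refl n v (g ∸ 502)))

-- Points with rational coordinates

cross : (ux uy vx vy : ℚ) → ℚ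
cross ux uy vx vy = ux ℚ.* vy ℚ.- vx ℚ.* uy

det : (ax ay bx by cx cy : ℚ) → ℚ
det ax ay bx by cx cy = cross (bx ℚ.- ax) (by ℚ.- ay) (cx ℚ.- ax) (cy ℚ.- ay)

det-cyc : ∀ ax ay bx by cx cy → det bx by cx cy ax ay ≡ det ax ay bx by cx cy
det-cyc = solve 6 (λ ax ay bx by cx cy →
    (cx :- bx) :* (ay :- by) :- (ax :- bx) :* (cy :- by)
    := (bx :- ax) :* (cy :- ay) :- (cx :- ax) :* (by :- ay)) refl
  where open ℚSolver.+-*-Solver

det-swap : ∀ ax ay bx by cx cy → det bx by ax ay cx cy ≡ ℚ.- det ax ay bx by cx cy
det-swap = solve 6 (λ ax ay bx by cx cy →
    (ax :- bx) :* (cy :- by) :- (cx :- bx) :* (ay :- by)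
    := :- ((bx :- ax) :* (cy :- ay) :- (cx :- ax) :* (by :- ay))) refl
  where open ℚSolver.+-*-Solver

plücker : ∀ sx sy px py qx qy rx ry →
  cross sx sy qx qy ℚ.* cross px py rx ry
  ≡ cross sx sy px py ℚ.* cross qx qy rx ry ℚ.+ cross sx sy rx ry ℚ.* cross px py qx qy
plücker = solve 8 (λ sx sy px py qx qy rx ry →
    (sx :* qy :- qx :* sy) :* (px :* ry :- rx :* py)
    := (sx :* py :- px :* sy) :* (qx :* ry :- rx :* qy) :+ (sx :* ry :- rx :* sy) :*
        (px :* qy :- qx :* py)) refl
  where open ℚSolver.+-*-Solver

cross-flip : ∀ ux uy vx vy → cross vx vy ux uy ≡ ℚ.- cross ux uy vx vy
cross-flip = solve 4 (λ ux uy vx vy → vx :* uy :- ux :* vy := :- (ux :* vy :- vx :* uy)) refl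
  where open ℚSolver.+-*-Solver

0<-* : ∀ {p q} → 0ℚ ℚ.< p → 0ℚ ℚ.< q → 0ℚ ℚ.< p ℚ.* q
0<-* {p} {q} h k = ℚ.positive⁻¹ (p ℚ.* q) {{ℚ.pos*pos⇒pos p {{ℚ.positive h}} q {{ℚ.positive k}}}}

0<-cancel : ∀ {p q} → 0ℚ ℚ.< p → 0ℚ ℚ.< p ℚ.* q → 0ℚ ℚ.< q
0<-cancel {p} {q} h k = ℚ.*-cancelˡ-<-nonNeg p {{ℚ.pos⇒nonNeg p {{ℚ.positive h}}}}
  (subst (ℚ._< p ℚ.* q) (sym (ℚ.*-zeroʳ p)) k)

0<⇒≮0 : ∀ {p} → 0ℚ ℚ.< p → ¬ (0ℚ ℚ.< ℚ.- p)
0<⇒≮0 {p} h k = ℚ.<-irrefl refl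
  (subst (0ℚ ℚ.<_) (ℚ.+-inverseʳ p) (0<-+ (ℚ.<⇒≤ h) k))

module RationalPoints {N : ℕ} (px py : Fin N → ℚ) where

  detᵖ : (a b c : Fin N) → ℚ
  detᵖ a b c = det (px a) (py a) (px b) (py b) (px c) (py c)

  private
    -- In each of the four axioms, after adjusting signs, five of the six determinants in a Plücker
    -- relation are positive, so the sixth is.
    product : ∀ {p q u v w z} → p ℚ.* q ≡ u ℚ.* v ℚ.+ w ℚ.* z →
      0ℚ ℚ.< p → 0ℚ ℚ.< u → 0ℚ ℚ.< v → 0ℚ ℚ.< w → 0ℚ ℚ.< z → 0ℚ ℚ.< q
    product eq hp hu hv hw hz =
      0<-cancel hp (subst (0ℚ ℚ.<_) (sym eq) (0<-+ (ℚ.<⇒≤ (0<-* hu hv)) (0<-* hw hz)))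

    pl : ∀ o s p q r → detᵖ o s q ℚ.* detᵖ o p r
      ≡ detᵖ o s p ℚ.* detᵖ o q r ℚ.+ detᵖ o s r ℚ.* detᵖ o p q
    pl o s p q r = plücker (px s ℚ.- px o) (py s ℚ.- py o) (px p ℚ.- px o) (py p ℚ.- py o)
      (px q ℚ.- px o) (py q ℚ.- py o) (px r ℚ.- px o) (py r ℚ.- py o)

    flipᵖ : ∀ o a b → detᵖ o b a ≡ ℚ.- detᵖ o a b
    flipᵖ o a b = cross-flip (px a ℚ.- px o) (py a ℚ.- py o) (px b ℚ.- px o) (py b ℚ.- py o)

    Ccwᵖ : Fin N → Fin N → Fin N → Set
    Ccwᵖ a b c = 0ℚ ℚ.< detᵖ a b c

    cycᵖ : ∀ {a b c} → Ccwᵖ a b c → Ccwᵖ b c a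
    cycᵖ {a} {b} {c} = subst (0ℚ ℚ.<_) (sym (det-cyc (px a) (py a) (px b) (py b) (px c) (py c)))

    asymᵖ : ∀ {a b c} → Ccwᵖ a b c → ¬ Ccwᵖ b a c
    asymᵖ {a} {b} {c} h k = 0<⇒≮0 h
      (subst (0ℚ ℚ.<_) (det-swap (px a) (py a) (px b) (py b) (px c) (py c)) k)

  private abstract
    gp₁ᵖ : ∀ {o s p q r} → Ccwᵖ o s p → Ccwᵖ o s q → Ccwᵖ o s r → Ccwᵖ o p q → Ccwᵖ o q r → Ccwᵖ o p r
    gp₁ᵖ {o} {s} {p} {q} {r} sp sq sr pq qr = product (pl o s p q r) sq sp qr sr pq

    gp₂ᵖ : ∀ {o s p q r} → Ccwᵖ s o p → Ccwᵖ s o q → Ccwᵖ s o r → Ccwᵖ o p q → Ccwᵖ o q r → Ccwᵖ o p r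
    gp₂ᵖ {o} {s} {p} {q} {r} sp sq sr pq qr = product
      (trans (ℚ.*-comm (detᵖ o q s) (detᵖ o p r)) (pl′ (detᵖ o q s) (detᵖ o s q) (flipᵖ o s q)
          (detᵖ o p s) (detᵖ o s p) (flipᵖ o s p)
                    (detᵖ o r s) (detᵖ o s r) (flipᵖ o s r) (detᵖ o p r) (detᵖ o q r) (detᵖ o p q)
                        (pl o s p q r)))
      (cycᵖ sq) (cycᵖ sp) qr (cycᵖ sr) pq
      where
      pl′ : ∀ a a′ → a ≡ ℚ.- a′ → ∀ b b′ → b ≡ ℚ.- b′ → ∀ c c′ → c ≡ ℚ.- c′ → ∀ x y z →
        a′ ℚ.* x ≡ b′ ℚ.* y ℚ.+ c′ ℚ.* z → x ℚ.* a ≡ b ℚ.* y ℚ.+ c ℚ.* z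
      pl′ _ a refl _ b refl _ c refl x y z h = trans (neg-*ʳ x a) (trans (cong ℚ.-_ h) (neg-+* b y c z))
        where
        open ℚSolver.+-*-Solver
        neg-*ʳ : ∀ x a → x ℚ.* (ℚ.- a) ≡ ℚ.- (a ℚ.* x)
        neg-*ʳ = solve 2 (λ x a → x :* (:- a) := :- (a :* x)) refl
        neg-+* : ∀ a b c d → ℚ.- (a ℚ.* b ℚ.+ c ℚ.* d) ≡ (ℚ.- a) ℚ.* b ℚ.+ (ℚ.- c) ℚ.* d
        neg-+* = solve 4 (λ a b c d → :- (a :* b :+ c :* d) := (:- a) :* b :+ (:- c) :* d) refl

    flip-flip : ∀ o a b c d → detᵖ o a b ℚ.* detᵖ o c d ≡ detᵖ o b a ℚ.* detᵖ o d c
    flip-flip o a b c d = trans (cong₂ ℚ._*_ (flipᵖ o b a) (flipᵖ o d c))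
        (neg-neg (detᵖ o b a) (detᵖ o d c))
      where
      open ℚSolver.+-*-Solver
      neg-neg : ∀ a b → (ℚ.- a) ℚ.* (ℚ.- b) ≡ a ℚ.* b
      neg-neg = solve 2 (λ a b → (:- a) :* (:- b) := a :* b) refl

    gp₃ᵖ : ∀ {o s p q r} → Ccwᵖ o s p → Ccwᵖ o p q → Ccwᵖ o q s → Ccwᵖ o s r → Ccwᵖ o p r → Ccwᵖ o r q
    gp₃ᵖ {o} {s} {p} {q} {r} sp pq qs sr pr = product
      (trans (pl o s r p q) (cong₂ ℚ._+_ (ℚ.*-comm (detᵖ o s r) (detᵖ o p q)) (flip-flip o s q r p))) sp
          pq sr qs pr

    gp₄ᵖ : ∀ {o s p q r} → Ccwᵖ o s p → Ccwᵖ o p q → Ccwᵖ o q s → Ccwᵖ o r s → Ccwᵖ o r p → Ccwᵖ o q r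
    gp₄ᵖ {o} {s} {p} {q} {r} sp pq qs rs rp = product
      (trans (pl o s q p r) (cong₂ ℚ._+_ (flip-flip o s q p r) (flip-flip o s r q p))) sp qs rp rs pq

  orientation : (∀ {a b c} → a ≢ b → b ≢ c → a ≢ c → Ccwᵖ a b c ⊎ Ccwᵖ b a c) → Orientation N
  orientation total = record
    { Ccw = Ccwᵖ ; ccw? = λ a b c → 0ℚ ℚ.<? detᵖ a b c ; cyc = cycᵖ ; asym = asymᵖ ; total = total
    ; gp₁ = gp₁ᵖ ; gp₂ = gp₂ᵖ ; gp₃ = gp₃ᵖ ; gp₄ = gp₄ᵖ }

  _≼_ : Fin N → Fin N → Set
  a ≼ b = px a ℚ.< px b ⊎ (px a ≡ px b × py a ℚ.≤ py b)

  ≼-total : ∀ a b → a ≼ b ⊎ b ≼ a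
  ≼-total a b with ℚ.<-cmp (px a) (px b) | ℚ.≤-total (py a) (py b)
  ... | tri< lt _ _ | _      = inj₁ (inj₁ lt)
  ... | tri> _ _ gt | _      = inj₂ (inj₁ gt)
  ... | tri≈ _ eq _ | inj₁ h = inj₁ (inj₂ (eq , h))
  ... | tri≈ _ eq _ | inj₂ h = inj₂ (inj₂ (sym eq , h))

  ≼-trans : ∀ {a b c} → a ≼ b → b ≼ c → a ≼ c
  ≼-trans (inj₁ h)       (inj₁ k)       = inj₁ (ℚ.<-trans h k)
  ≼-trans {a} (inj₁ h)   (inj₂ (e , _)) = inj₁ (subst (px a ℚ.<_) e h)
  ≼-trans {c = c} (inj₂ (e , _)) (inj₁ k) = inj₁ (subst (ℚ._< px c) (sym e) k)
  ≼-trans (inj₂ (e , h)) (inj₂ (f , k)) = inj₂ (trans e f , ℚ.≤-trans h k)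

  least : ∀ {n} (f : Fin (suc n) → Fin N) → ∃[ i ] (∀ j → f i ≼ f j)
  least {zero}  f = zero , λ where zero → inj₂ (refl , ℚ.≤-refl)
  least {suc n} f with least (f ∘ suc)
  ... | i , min with ≼-total (f zero) (f (suc i))
  ...   | inj₁ h = zero , λ where zero → inj₂ (refl , ℚ.≤-refl) ; (suc j) → ≼-trans h (min j)
  ...   | inj₂ h = suc i , λ where zero → h ; (suc j) → min j

  0≤-diff : ∀ {a b} → a ℚ.≤ b → 0ℚ ℚ.≤ b ℚ.- a
  0≤-diff {a} {b} h = subst (ℚ._≤ b ℚ.- a) (ℚ.+-inverseʳ a) (ℚ.+-monoˡ-≤ (ℚ.- a) h)

  0<-diff : ∀ {a b} → a ℚ.< b → 0ℚ ℚ.< b ℚ.- a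
  0<-diff {a} {b} h = subst (ℚ._< b ℚ.- a) (ℚ.+-inverseʳ a) (ℚ.+-monoˡ-< (ℚ.- a) h)

  ≼⇒≤ : ∀ {a b} → a ≼ b → px a ℚ.≤ px b
  ≼⇒≤ (inj₁ h)       = ℚ.<⇒≤ h
  ≼⇒≤ (inj₂ (e , _)) = ℚ.≤-reflexive e

  -- All directions from the lexicographically least point lie in a half-plane, so three of them
  -- cannot surround it. The sum of first coordinates weighted by opposite cross products vanishes,
  -- which is contradictory if `q` lies strictly to the right of `t`; if it lies directly above, `r`
  -- would have to lie to the left.
  half-plane : ∀ {t p q r} → t ≼ p → t ≼ q → t ≼ r → Ccwᵖ t p q → Ccwᵖ t q r → ¬ Ccwᵖ t r p
  half-plane {t} {p} {q} {r} tp (inj₁ tq) tr tpq tqr trp = ℚ.<-irrefl refl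
    (ℚ.<-≤-trans (0<-* (0<-diff tq) trp) (ℚ.≤-trans
      (ℚ.≤-reflexive (identity (px p ℚ.- px t) (py p ℚ.- py t) (px q ℚ.- px t) (py q ℚ.- py t)
          (px r ℚ.- px t) (py r ℚ.- py t)))
      (ℚ.neg-antimono-≤ (ℚ.+-mono-≤ (0≤-* (0≤-diff (≼⇒≤ tp)) (ℚ.<⇒≤ tqr))
          (0≤-* (0≤-diff (≼⇒≤ tr)) (ℚ.<⇒≤ tpq))))))
    where
    identity : ∀ ux uy vx vy wx wy →
      vx ℚ.* cross wx wy ux uy ≡ ℚ.- (ux ℚ.* cross vx vy wx wy ℚ.+ wx ℚ.* cross ux uy vx vy)
    identity = solve 6 (λ ux uy vx vy wx wy → vx :* (wx :* uy :- ux :* wy)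
      := :- (ux :* (vx :* wy :- wx :* vy) :+ wx :* (ux :* vy :- vx :* uy))) refl
      where open ℚSolver.+-*-Solver
  half-plane {t} {p} {q} {r} tp (inj₂ (e , tq)) tr tpq tqr trp = ℚ.<-irrefl refl
    (ℚ.<-≤-trans tqr (ℚ.≤-trans (ℚ.≤-reflexive (trans
        (cong (λ z → cross z (py q ℚ.- py t) (px r ℚ.- px t) (py r ℚ.- py t))
            (trans (cong (ℚ._- px t) (sym e)) (ℚ.+-inverseʳ (px t))))
        (vertical (py q ℚ.- py t) (px r ℚ.- px t) (py r ℚ.- py t))))
      (ℚ.neg-antimono-≤ (0≤-* (0≤-diff (≼⇒≤ tr)) (0≤-diff tq)))))
    where
    vertical : ∀ vy wx wy → cross 0ℚ vy wx wy ≡ ℚ.- (wx ℚ.* vy)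
    vertical = solve 3 (λ vy wx wy → con 0ℚ :* wy :- wx :* vy := :- (wx :* vy)) refl
      where open ℚSolver.+-*-Solver

module _ {N : ℕ} (px py : Fin (suc N) → ℚ) where
  open RationalPoints px py

  module _ (total : ∀ {a b c} → a ≢ b → b ≢ c → a ≢ c → 0ℚ ℚ.< detᵖ a b c ⊎ 0ℚ ℚ.< detᵖ b a c) where
    open Chirotope (orientation total) hiding (total)

    radial-order : ∃[ t ] ∃[ Q ] (AllPairs (Ccw t) Q × length Q ≡ N)
    radial-order = t , proj₁ sorted , proj₁ (proj₂ sorted) , trans (proj₂ (proj₂ (proj₂ sorted)))
      (trans (List.length-map (Fin.punchIn t) (allFin N)) (List.length-tabulate {n = N} (λ i → i)))
      where
      t : Fin (suc N)
      t = proj₁ (least (λ i → i))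
      min : ∀ p → t ≼ p
      min = proj₂ (least (λ i → i))
      ccw-trans : ∀ {p q r} → t ≢ p → t ≢ q → t ≢ r → Ccw t p q → Ccw t q r → Ccw t p r
      ccw-trans {p} {q} {r} t≢p t≢q t≢r tpq tqr =
        [ (λ tpr → tpr) , (λ ptr → contradiction (cyc ptr) (half-plane (min p) (min q) (min r) tpq tqr)) ]′
        (total t≢p (λ where refl → asym (cyc tpq) (cyc tqr)) t≢r)
      sorted = sort (t ≢_) (Ccw t) ccw-trans
        (λ t≢p t≢q p≢q → [ inj₁ , (λ h → inj₂ (cyc h)) ]′ (total t≢p p≢q t≢q))
        (map (Fin.punchIn t) (allFin N))
        (All.map⁺ (All.universal (λ i e → Fin.punchInᵢ≢i t i (sym e)) (allFin N)))
        (AllPairs.map⁺ (AllPairs.tabulate⁺-< {n = N} {f = λ i → i}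
          (λ i<j e → Fin.<⇒≢ i<j (Fin.punchIn-injective t _ _ e))))

    rational-polygon : ∀ n c g → 1 ≤ c → n < suc c ^ 3 → n < 2 ^ suc g → 502 ≤ g →
      2 ^ (n + 6 * (c * c) * g) ≤ suc N → ∃[ u ] (Polygon u × n ≤ length u)
    rational-polygon n c g h₁ h₂ h₃ h₄ h₅ = go radial-order
      where
      go : ∃[ t ] ∃[ Q ] (AllPairs (Ccw t) Q × length Q ≡ N) → ∃[ u ] (Polygon u × n ≤ length u)
      go (t , Q , sorted , len) = polygon (orientation total) t Q sorted n c g h₁ h₂ h₃ h₄
        (subst (λ z → 2 ^ (n + 6 * (c * c) * g) ≤ suc z) (sym len) h₅)

-- Points with real coordinates

-- These conditions are stated for bare sequences, so that combinations can be rearranged by the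
-- ring solver at each index.
AsymptoticallyNonNegative Null : (ℕ → ℚ) → Set
AsymptoticallyNonNegative z = ∀ ε → 0ℚ ℚ.< ε → ∃[ N ] (∀ n → N ≤ n → ℚ.- ε ℚ.≤ z n)
Null z = ∀ ε → 0ℚ ℚ.< ε → ∃[ N ] (∀ n → N ≤ n → ℚ.∣ z n ∣ ℚ.≤ ε)

null⇒nonneg- : ∀ {z} → Null z → AsymptoticallyNonNegative (λ n → ℚ.- z n)
null⇒nonneg- h ε 0<ε with h ε 0<ε
... | N , small = N , λ n N≤n → ℚ.neg-antimono-≤ (ℚ.≤-trans (≤∣∣ _) (small n N≤n))

≃⇒null : ∀ {x y} → x ≃ y → Null (λ n → seq x n ℚ.- seq y n)
≃⇒null (x≤y , y≤x) ε 0<ε with x≤y ε 0<ε | y≤x ε 0<ε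
... | M , h | N , k = M ⊔ N , λ n le →
  ∣-∣-≤ (h n (ℕ.m⊔n≤o⇒m≤o M N le)) (k n (ℕ.m⊔n≤o⇒n≤o M N le))

nonneg-+ : ∀ {y z} → AsymptoticallyNonNegative y → AsymptoticallyNonNegative z →
  AsymptoticallyNonNegative (λ n → y n ℚ.+ z n)
nonneg-+ {y} {z} hy hz ε 0<ε = M ⊔ N , λ n le → subst (ℚ._≤ y n ℚ.+ z n)
    (solve 1 (λ e → :- (con ℚ.½ :* e) :+ :- (con ℚ.½ :* e) := :- e) refl ε)
    (ℚ.+-mono-≤ (proj₂ (hy ½ε 0<½ε) n (ℕ.m⊔n≤o⇒m≤o M N le)) (proj₂ (hz ½ε 0<½ε) n (ℕ.m⊔n≤o⇒n≤o M N le)))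
  where
  open ℚSolver.+-*-Solver
  ½ε = ℚ.½ ℚ.* ε
  0<½ε : 0ℚ ℚ.< ½ε
  0<½ε = 0<-* (ℚ.positive⁻¹ ℚ.½) 0<ε
  M = proj₁ (hy ½ε 0<½ε)
  N = proj₁ (hz ½ε 0<½ε)

Boundᴿ : ℝ → Set
Boundᴿ x = ∃[ B ] (0ℚ ℚ.< B × ∃[ N ] (∀ n → N ≤ n → ℚ.∣ seq x n ∣ ℚ.≤ B))

null-* : ∀ x {z} → Null z → Null (λ n → seq x n ℚ.* z n)
null-* x {z} hz ε 0<ε = go (bounded x)
  where
  go : Boundᴿ x → ∃[ N ] (∀ n → N ≤ n → ℚ.∣ seq x n ℚ.* z n ∣ ℚ.≤ ε)
  go (B , 0<B , N , bd) = small (archimedes* ε B 0<ε 0<B)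
    where
    small : ∃[ k ] (δ k ℚ.* B ℚ.≤ ε) → _
    small (k , δB≤ε) = proj₁ tail ⊔ N , λ n le → ℚ.≤-trans
      (ℚ.≤-reflexive (trans (ℚ.∣p*q∣≡∣p∣*∣q∣ (seq x n) (z n)) (ℚ.*-comm ℚ.∣ seq x n ∣ ℚ.∣ z n ∣)))
      (ℚ.≤-trans (*-mono (ℚ.0≤∣p∣ (seq x n)) (ℚ.<⇒≤ (0<δ k))
        (proj₂ tail n (ℕ.m⊔n≤o⇒m≤o (proj₁ tail) N le)) (bd n (ℕ.m⊔n≤o⇒n≤o (proj₁ tail) N le))) δB≤ε)
      where tail = hz (δ k) (0<δ k)

nonneg-* : ∀ w G K → 0ᴿ ≤ᴿ w → (∀ n → K ≤ n → 0ℚ ℚ.≤ seq G n) →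
  AsymptoticallyNonNegative (seq (w *ᴿ G))
nonneg-* w G K hw hG ε 0<ε = go (bounded G)
  where
  open ℚSolver.+-*-Solver
  go : Boundᴿ G → ∃[ N ] (∀ n → N ≤ n → ℚ.- ε ℚ.≤ seq w n ℚ.* seq G n)
  go (B , 0<B , N , bd) = small (archimedes* ε B 0<ε 0<B)
    where
    small : ∃[ k ] (δ k ℚ.* B ℚ.≤ ε) → _
    small (k , δB≤ε) = M ⊔ (N ⊔ K) , λ n le → bound (seq w n) (seq G n)
        (proj₂ (hw (δ k) (0<δ k)) n (ℕ.m⊔n≤o⇒m≤o M (N ⊔ K) le))
        (hG n (ℕ.m⊔n≤o⇒n≤o N K (ℕ.m⊔n≤o⇒n≤o M (N ⊔ K) le)))
        (ℚ.≤-trans (≤∣∣ (seq G n)) (bd n (ℕ.m⊔n≤o⇒m≤o N K (ℕ.m⊔n≤o⇒n≤o M (N ⊔ K) le))))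
      where
      M = proj₁ (hw (δ k) (0<δ k))
      bound : ∀ w G → 0ℚ ℚ.≤ w ℚ.+ δ k → 0ℚ ℚ.≤ G → G ℚ.≤ B → ℚ.- ε ℚ.≤ w ℚ.* G
      bound w G 0≤w+δ 0≤G G≤B = ℚ.≤-trans (ℚ.neg-antimono-≤ (ℚ.≤-trans
          (*-mono 0≤G (ℚ.<⇒≤ (0<δ k)) ℚ.≤-refl G≤B) δB≤ε))
        (subst₂ ℚ._≤_ (ℚ.+-identityˡ (ℚ.- (δ k ℚ.* G)))
          (solve 3 (λ w d G → (w :+ d) :* G :+ :- (d :* G) := w :* G) refl w (δ k) G)
          (ℚ.+-monoˡ-≤ (ℚ.- (δ k ℚ.* G)) (0≤-* 0≤w+δ 0≤G)))

nonneg-sum : ∀ {m} (v : Fin m → ℝ) → (∀ j → AsymptoticallyNonNegative (seq (v j))) →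
  AsymptoticallyNonNegative (seq (sumᴿ v))
nonneg-sum {zero}  v h ε 0<ε = 0 , λ _ _ → ℚ.neg-antimono-≤ (ℚ.<⇒≤ 0<ε)
nonneg-sum {suc m} v h = nonneg-+ (h zero) (nonneg-sum (v ∘ suc) (h ∘ suc))

¬nonneg-neg : ∀ {ε z} → 0ℚ ℚ.< ε → (∀ n → z n ≡ ℚ.- ε) → ¬ AsymptoticallyNonNegative z
¬nonneg-neg {ε} {z} 0<ε eq h = ℚ.<-irrefl refl (ℚ.<-≤-trans 0<½ε
    (subst₂ ℚ._≤_ (solve 1 (λ e → e :+ :- (con ℚ.½ :* e) := con ℚ.½ :* e) refl ε) (ℚ.+-inverseʳ ε)
      (ℚ.+-monoʳ-≤ ε (subst (ℚ.- (ℚ.½ ℚ.* ε) ℚ.≤_) (eq N) (proj₂ (h (ℚ.½ ℚ.* ε) 0<½ε) N ℕ.≤-refl)))))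
  where
  open ℚSolver.+-*-Solver
  0<½ε : 0ℚ ℚ.< ℚ.½ ℚ.* ε
  0<½ε = 0<-* (ℚ.positive⁻¹ ℚ.½) 0<ε
  N = proj₁ (h (ℚ.½ ℚ.* ε) 0<½ε)

sum-affine : ∀ {m} (w G x y : Fin m → ℝ) a b c n →
  (∀ j → seq (G j) n ≡ a ℚ.* seq (x j) n ℚ.+ b ℚ.* seq (y j) n ℚ.+ c) →
  seq (sumᴿ (λ j → w j *ᴿ G j)) n
  ≡ a ℚ.* seq (sumᴿ (λ j → w j *ᴿ x j)) n ℚ.+ b ℚ.* seq (sumᴿ (λ j → w j *ᴿ y j)) n
      ℚ.+ c ℚ.* seq (sumᴿ w) n
sum-affine {zero}  w G x y a b c n h = solve 3
    (λ a b c → con 0ℚ := a :* con 0ℚ :+ b :* con 0ℚ :+ c :* con 0ℚ) refl a b c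
  where open ℚSolver.+-*-Solver
sum-affine {suc m} w G x y a b c n h = trans
  (cong₂ (λ g s → seq (w zero) n ℚ.* g ℚ.+ s) (h zero) (sum-affine (w ∘ suc) (G ∘ suc) (x ∘ suc)
      (y ∘ suc) a b c n (h ∘ suc)))
  (solve 9 (λ a b c w x y X Y W →
    w :* (a :* x :+ b :* y :+ c) :+ (a :* X :+ b :* Y :+ c :* W)
      := a :* (w :* x :+ X) :+ b :* (w :* y :+ Y) :+ c :* (w :+ W)) refl
    a b c (seq (w zero) n) (seq (x zero) n) (seq (y zero) n)
    (seq (sumᴿ (λ j → w (suc j) *ᴿ x (suc j))) n) (seq (sumᴿ (λ j → w (suc j) *ᴿ y (suc j))) n)
    (seq (sumᴿ (w ∘ suc)) n))
  where open ℚSolver.+-*-Solver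

-1ᴿ : ℝ
-1ᴿ = fromℚ (ℚ.- 1ℚ)

module _ {m} (p : Fin m → Point) (q : Point) (α β : ℝ) (ε : ℚ) (0<ε : 0ℚ ℚ.< ε) (K : ℕ)
  (separates : ∀ j n → K ≤ n → ε ℚ.≤ seq α n ℚ.* (seq (xᶜ (p j)) n ℚ.- seq (xᶜ q) n)
                                  ℚ.+ seq β n ℚ.* (seq (yᶜ (p j)) n ℚ.- seq (yᶜ q) n)) where

  private
    γ : ℝ
    γ = -1ᴿ *ᴿ (α *ᴿ xᶜ q +ᴿ β *ᴿ yᶜ q) +ᴿ fromℚ (ℚ.- ε)

    G : Fin m → ℝ
    G j = α *ᴿ xᶜ (p j) +ᴿ β *ᴿ yᶜ (p j) +ᴿ γ

    0≤G : ∀ j n → K ≤ n → 0ℚ ℚ.≤ seq (G j) n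
    0≤G j n K≤n = subst₂ ℚ._≤_ (ℚ.+-inverseʳ ε)
      (solve 7 (λ a b x y qx qy e →
        a :* (x :- qx) :+ b :* (y :- qy) :+ :- e
          := a :* x :+ b :* y :+ (con (ℚ.- 1ℚ) :* (a :* qx :+ b :* qy) :+ :- e)) refl
        (seq α n) (seq β n) (seq (xᶜ (p j)) n) (seq (yᶜ (p j)) n) (seq (xᶜ q) n) (seq (yᶜ q) n) ε)
      (ℚ.+-monoˡ-≤ (ℚ.- ε) (separates j n K≤n))
      where open ℚSolver.+-*-Solver

  -- The affine function `G` is nonnegative at all the points and tends to `-ε` at `q`. A convex
  -- combination equal to `q` would make its weighted sum both asymptotically nonnegative and, up to
  -- null sequences, equal to `-ε`.
  separated : ¬ InConvexHull p q
  separated (w , 0≤w , Σw , Σx , Σy) = ¬nonneg-neg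
      {z = λ n → s n ℚ.+ (ℚ.- zx n ℚ.+ (ℚ.- zy n ℚ.+ ℚ.- zw n))} 0<ε total
    (nonneg-+ {s} {λ n → ℚ.- zx n ℚ.+ (ℚ.- zy n ℚ.+ ℚ.- zw n)} s-nonneg
      (nonneg-+ {λ n → ℚ.- zx n} {λ n → ℚ.- zy n ℚ.+ ℚ.- zw n}
          (null⇒nonneg- {zx} (null-* α {dx} (≃⇒null {Sx} {xᶜ q} Σx)))
        (nonneg-+ {λ n → ℚ.- zy n} {λ n → ℚ.- zw n}
            (null⇒nonneg- {zy} (null-* β {dy} (≃⇒null {Sy} {yᶜ q} Σy)))
          (null⇒nonneg- {zw} (null-* γ {dw} (≃⇒null {S} {1ᴿ} Σw))))))
    where
    open ℚSolver.+-*-Solver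
    S Sx Sy : ℝ
    S = sumᴿ w
    Sx = sumᴿ (λ j → w j *ᴿ xᶜ (p j))
    Sy = sumᴿ (λ j → w j *ᴿ yᶜ (p j))
    s dx dy dw zx zy zw : ℕ → ℚ
    s = seq (sumᴿ (λ j → w j *ᴿ G j))
    dx n = seq Sx n ℚ.- seq (xᶜ q) n
    dy n = seq Sy n ℚ.- seq (yᶜ q) n
    dw n = seq S n ℚ.- seq 1ᴿ n
    zx n = seq α n ℚ.* dx n
    zy n = seq β n ℚ.* dy n
    zw n = seq γ n ℚ.* dw n
    s-nonneg : AsymptoticallyNonNegative s
    s-nonneg = nonneg-sum (λ j → w j *ᴿ G j) (λ j → nonneg-* (w j) (G j) K (0≤w j) (0≤G j))
    identity : ∀ a b c qx qy e X Y W o → o ≡ 1ℚ → c ≡ (ℚ.- 1ℚ) ℚ.* (a ℚ.* qx ℚ.+ b ℚ.* qy) ℚ.+ ℚ.- e →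
      a ℚ.* X ℚ.+ b ℚ.* Y ℚ.+ c ℚ.* W ℚ.+ (ℚ.- (a ℚ.* (X ℚ.- qx)) ℚ.+
          (ℚ.- (b ℚ.* (Y ℚ.- qy)) ℚ.+ ℚ.- (c ℚ.* (W ℚ.- o)))) ≡ ℚ.- e
    identity a b _ qx qy e X Y W _ refl refl = solve 8 (λ a b qx qy e X Y W →
      let c = con (ℚ.- 1ℚ) :* (a :* qx :+ b :* qy) :+ :- e in
      a :* X :+ b :* Y :+ c :* W :+ (:- (a :* (X :- qx)) :+
          (:- (b :* (Y :- qy)) :+ :- (c :* (W :- con 1ℚ)))) := :- e)
      refl a b qx qy e X Y W
    total : ∀ n → s n ℚ.+ (ℚ.- zx n ℚ.+ (ℚ.- zy n ℚ.+ ℚ.- zw n)) ≡ ℚ.- ε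
    total n = trans (cong (λ z → z ℚ.+ (ℚ.- zx n ℚ.+ (ℚ.- zy n ℚ.+ ℚ.- zw n)))
        (sum-affine w G (λ j → xᶜ (p j)) (λ j → yᶜ (p j)) (seq α n) (seq β n) (seq γ n) n (λ _ → refl)))
      (identity (seq α n) (seq β n) (seq γ n) (seq (xᶜ q) n) (seq (yᶜ q) n) ε (seq Sx n) (seq Sy n)
          (seq S n) (seq 1ᴿ n) refl refl)

-- Orientations of real points at a common stage

uniform : ∀ {N} {P : Fin N → ℕ → Set} → (∀ i {K L} → K ≤ L → P i K → P i L) →
  (∀ i → ∃[ K ] P i K) → ∃[ K ] (∀ i → P i K)
uniform {zero}  mono h = 0 , λ ()
uniform {suc N} mono h = proj₁ (h zero) ⊔ proj₁ rest , λ where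
    zero    → mono zero (ℕ.m≤m⊔n _ _) (proj₂ (h zero))
    (suc i) → mono (suc i) (ℕ.m≤n⊔m (proj₁ (h zero)) _) (proj₂ rest i)
  where rest = uniform (mono ∘ suc) (h ∘ suc)

third : ∀ {n} (i j : Fin (3 + n)) → ∃[ k ] (k ≢ i × k ≢ j)
third zero          zero          = suc zero , (λ ()) , (λ ())
third zero          (suc zero)    = suc (suc zero) , (λ ()) , (λ ())
third zero          (suc (suc _)) = suc zero , (λ ()) , (λ ())
third (suc zero)    zero          = suc (suc zero) , (λ ()) , (λ ())
third (suc (suc _)) zero          = suc zero , (λ ()) , (λ ())
third (suc _)       (suc _)       = zero , (λ ()) , (λ ())

module _ {N : ℕ} (p : Fin N → Point) where

  detᴿ : ℕ → (i j k : Fin N) → ℚ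
  detᴿ m = RationalPoints.detᵖ (λ i → seq (xᶜ (p i)) m) (λ i → seq (yᶜ (p i)) m)

  -- One number `K` is both the stage and the margin `δ K`. The condition is thus monotone in `K`,
  -- and finitely many of its instances can share one `K`.
  Positive : ℕ → (i j k : Fin N) → Set
  Positive K i j k = ∀ m → K ≤ m → δ K ℚ.≤ detᴿ m i j k

  positive-mono : ∀ {K L i j k} → K ≤ L → Positive K i j k → Positive L i j k
  positive-mono K≤L h m L≤m = ℚ.≤-trans (δ-anti K≤L) (h m (ℕ.≤-trans K≤L L≤m))

  positive⇒0< : ∀ {K i j k} → Positive K i j k → 0ℚ ℚ.< detᴿ K i j k
  positive⇒0< {K} h = ℚ.<-≤-trans (0<δ K) (h K ℕ.≤-refl)

  positive-cyc : ∀ {K i j k} → Positive K i j k → Positive K j k i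
  positive-cyc {K} {i} {j} {k} h m K≤m = subst (δ K ℚ.≤_)
    (sym (det-cyc (seq (xᶜ (p i)) m) (seq (yᶜ (p i)) m) (seq (xᶜ (p j)) m) (seq (yᶜ (p j)) m)
        (seq (xᶜ (p k)) m) (seq (yᶜ (p k)) m)))
    (h m K≤m)

  det-degenerate : ∀ m i j → detᴿ m i j j ≡ 0ℚ
  det-degenerate m i j = solve 2 (λ u v → u :* v :- u :* v := con 0ℚ) refl
    (seq (xᶜ (p j)) m ℚ.- seq (xᶜ (p i)) m) (seq (yᶜ (p j)) m ℚ.- seq (yᶜ (p i)) m)
    where open ℚSolver.+-*-Solver

  det-degenerate′ : ∀ m i j → detᴿ m i j i ≡ 0ℚ
  det-degenerate′ m i j = solve 4 (λ x y u v → u :* (y :- y) :- (x :- x) :* v := con 0ℚ) refl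
    (seq (xᶜ (p i)) m) (seq (yᶜ (p i)) m)
    (seq (xᶜ (p j)) m ℚ.- seq (xᶜ (p i)) m) (seq (yᶜ (p j)) m ℚ.- seq (yᶜ (p i)) m)
    where open ℚSolver.+-*-Solver

  positive-asym : ∀ {K i j k} → Positive K i j k → ¬ Positive K j i k
  positive-asym {K} {i} {j} {k} h h′ = 0<⇒≮0 (positive⇒0< {K} {i} {j} {k} h) (subst (0ℚ ℚ.<_)
    (det-swap (seq (xᶜ (p i)) K) (seq (yᶜ (p i)) K) (seq (xᶜ (p j)) K) (seq (yᶜ (p j)) K)
        (seq (xᶜ (p k)) K) (seq (yᶜ (p k)) K))
    (positive⇒0< {K} {j} {i} {k} h′))

module _ {n : ℕ} (r : Fin (3 + n) → Point) (K : ℕ)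
  (convex : ∀ {a b c} → a Fin.< b → b Fin.< c → Positive r K a b c) where

  private
    cyc₁ : ∀ {a b c} → Positive r K a b c → Positive r K b c a
    cyc₁ {a} {b} {c} = positive-cyc r {K} {a} {b} {c}

    cyc₂ : ∀ {a b c} → Positive r K a b c → Positive r K c a b
    cyc₂ {a} {b} {c} h = cyc₁ {b} {c} {a} (cyc₁ {a} {b} {c} h)

    around : ∀ {i j k : Fin (3 + n)} → toℕ j ≡ suc (toℕ i) → k ≢ i → k ≢ j → k Fin.< i ⊎ j Fin.< k
    around {i} {j} {k} eq k≢i k≢j with Fin.<-cmp k i | Fin.<-cmp j k
    ... | tri< lt _ _ | _           = inj₁ lt
    ... | tri≈ _ e _  | _           = contradiction e k≢i
    ... | tri> _ _ gt | tri< lt _ _ = inj₂ lt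
    ... | tri> _ _ gt | tri≈ _ e _  = contradiction (sym e) k≢j
    ... | tri> _ _ gt | tri> _ _ k<j = contradiction gt (ℕ.≤⇒≯ (ℕ.≤-pred (subst (toℕ k <_) eq k<j)))

    consecutive : ∀ {i j k} → toℕ j ≡ suc (toℕ i) → k ≢ i → k ≢ j → Positive r K i j k
    consecutive {i} {j} {k} eq k≢i k≢j =
      [ (λ k<i → cyc₁ {k} {i} {j} (convex k<i i<j)) , (λ j<k → convex i<j j<k) ]′ (around eq k≢i k≢j)
      where
      i<j : i Fin.< j
      i<j = ℕ.≤-reflexive (sym eq)

    top : Fin (3 + n)
    top = Fin.fromℕ (2 + n)

    last-first : ∀ {k} → k ≢ top → k ≢ zero → Positive r K top zero k
    last-first {zero}  _     k≢0 = contradiction refl k≢0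
    last-first {suc k} k≢top _   = cyc₂ {zero} {suc k} {top} (convex (s≤s z≤n)
      (Fin.≤∧≢⇒< (Fin.≤fromℕ (suc k)) k≢top))

    next : ∀ i → ∃[ j ] (j ≢ i × (∀ k → k ≢ i → k ≢ j → Positive r K i j k))
    next i with suc (toℕ i) ℕ.<? 3 + n
    ... | yes h = Fin.fromℕ< h
                , (λ e → ℕ.1+n≢n (trans (sym (Fin.toℕ-fromℕ< h)) (cong toℕ e)))
                , λ k → consecutive (Fin.toℕ-fromℕ< h)
    ... | no  h with Fin.toℕ-injective {i = i} {j = top} (trans
                       (ℕ.≤-antisym (ℕ.≤-pred (Fin.toℕ<n i)) (ℕ.≤-pred (ℕ.≤-pred (ℕ.≰⇒> h))))
                           (sym (Fin.toℕ-fromℕ (2 + n))))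
    ...   | refl = zero , (λ ()) , λ k → last-first

    prev : ∀ i → ∃[ j ] (j ≢ i × (∀ k → k ≢ i → k ≢ j → Positive r K j i k))
    prev zero    = top , (λ ()) , λ k k≢0 k≢top → last-first k≢top k≢0
    prev (suc i) = Fin.inject₁ i
      , (λ e → ℕ.1+n≢n (trans (sym (cong toℕ e)) (Fin.toℕ-inject₁ i)))
      , λ k k≢i k≢j → consecutive (cong suc (sym (Fin.toℕ-inject₁ i))) k≢j k≢i

  -- Each vertex is separated from the others by a line parallel to the line through its neighbours.
  polygon⇒convexPosition : ConvexPosition r
  polygon⇒convexPosition i = go (next i) (prev i)
    where
    go : ∃[ j ] (j ≢ i × (∀ k → k ≢ i → k ≢ j → Positive r K i j k)) →
         ∃[ j ] (j ≢ i × (∀ k → k ≢ i → k ≢ j → Positive r K j i k)) → ¬ InConvexHull (removeAt r i) (r i)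
    go (a , a≢i , after) (b , b≢i , before) =
      separated (removeAt r i) (r i) (yᶜ (r b) +ᴿ -1ᴿ *ᴿ yᶜ (r a)) (xᶜ (r a) +ᴿ -1ᴿ *ᴿ xᶜ (r b))
        (δ K) (0<δ K) K (λ j m K≤m → subst (δ K ℚ.≤_) (identity m (Fin.punchIn i j))
          (away m K≤m (Fin.punchIn i j) (Fin.punchInᵢ≢i i j)))
      where
      -- If both neighbours coincided, a third vertex would lie on both sides of the line through
      -- them and `i`.
      a≢b : a ≢ b
      a≢b refl with third i a
      ... | k , k≢i , k≢a = positive-asym r {K} {i} {a} {k} (after k k≢i k≢a) (before k k≢i k≢a)
      -- The sum is the cross product of `r a - r b` with `r k - r i`, a linear function constant
      -- along parallels to the line through the neighbours. At a neighbour one of the two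
      -- determinants vanishes and the other supplies the margin.
      identity : ∀ m k → detᴿ r m i a k ℚ.+ detᴿ r m b i k ≡
        (seq (yᶜ (r b)) m ℚ.+ (ℚ.- 1ℚ) ℚ.* seq (yᶜ (r a)) m) ℚ.* (seq (xᶜ (r k)) m ℚ.- seq (xᶜ (r i)) m)
        ℚ.+ (seq (xᶜ (r a)) m ℚ.+ (ℚ.- 1ℚ) ℚ.* seq (xᶜ (r b)) m) ℚ.* (seq (yᶜ (r k)) m ℚ.- seq (yᶜ (r i)) m)
      identity m k = solve 8 (λ ax ay bx by ix iy kx ky →
        (ax :- ix) :* (ky :- iy) :- (kx :- ix) :* (ay :- iy) :+
            ((ix :- bx) :* (ky :- by) :- (kx :- bx) :* (iy :- by))
        := (by :+ con (ℚ.- 1ℚ) :* ay) :* (kx :- ix) :+ (ax :+ con (ℚ.- 1ℚ) :* bx) :* (ky :- iy)) refl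
        (seq (xᶜ (r a)) m) (seq (yᶜ (r a)) m) (seq (xᶜ (r b)) m) (seq (yᶜ (r b)) m)
        (seq (xᶜ (r i)) m) (seq (yᶜ (r i)) m) (seq (xᶜ (r k)) m) (seq (yᶜ (r k)) m)
        where open ℚSolver.+-*-Solver
      away : ∀ m → K ≤ m → ∀ k → k ≢ i → δ K ℚ.≤ detᴿ r m i a k ℚ.+ detᴿ r m b i k
      away m K≤m k k≢i with k Fin.≟ a | k Fin.≟ b
      ... | yes refl | _ = subst (ℚ._≤ detᴿ r m i a a ℚ.+ detᴿ r m b i a) (ℚ.+-identityˡ (δ K))
        (ℚ.+-mono-≤ (ℚ.≤-reflexive (sym (det-degenerate r m i a))) (before a a≢i a≢b m K≤m))
      ... | no k≢a | yes refl = subst (ℚ._≤ detᴿ r m i a b ℚ.+ detᴿ r m b i b) (ℚ.+-identityʳ (δ K))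
        (ℚ.+-mono-≤ (after b b≢i (≢-sym a≢b) m K≤m) (ℚ.≤-reflexive (sym (det-degenerate′ r m b i))))
      ... | no k≢a | no k≢b = subst (ℚ._≤ detᴿ r m i a k ℚ.+ detᴿ r m b i k) (ℚ.+-identityˡ (δ K))
        (ℚ.+-mono-≤ (ℚ.≤-trans (ℚ.<⇒≤ (0<δ K)) (after k k≢i k≢a m K≤m)) (before k k≢i k≢b m K≤m))

gap : ∀ {x y} → x <ᴿ y → ∃[ K ] (∀ m → K ≤ m → δ K ℚ.≤ seq y m ℚ.- seq x m)
gap {x} {y} (ε , 0<ε , M , h) = go (archimedes ε 0<ε)
  where
  go : ∃[ k ] (δ k ℚ.≤ ε) → ∃[ K ] (∀ m → K ≤ m → δ K ℚ.≤ seq y m ℚ.- seq x m)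
  go (k , δ≤ε) = M ⊔ k , λ m le → ℚ.≤-trans (δ-anti (ℕ.m≤n⊔m M k)) (ℚ.≤-trans δ≤ε
    (subst (ℚ._≤ seq y m ℚ.- seq x m) (cancel (seq x m) ε)
      (ℚ.+-monoˡ-≤ (ℚ.- seq x m) (h m (ℕ.m⊔n≤o⇒m≤o M k le)))))
    where
    cancel : ∀ x e → x ℚ.+ e ℚ.- x ≡ e
    cancel = solve 2 (λ x e → x :+ e :- x := e) refl
      where open ℚSolver.+-*-Solver

<ᴿ⇒≢ : ∀ {x y} → x <ᴿ y → ¬ (∀ n → seq x n ≡ seq y n)
<ᴿ⇒≢ {x} {y} (ε , 0<ε , M , h) eq = ℚ.<-irrefl refl (ℚ.<-≤-trans 0<ε
  (subst₂ ℚ._≤_ (cancel (seq x M) ε) (trans (cong (ℚ._- seq x M) (sym (eq M))) (ℚ.+-inverseʳ (seq x M)))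
    (ℚ.+-monoˡ-≤ (ℚ.- seq x M) (h M ℕ.≤-refl))))
  where
  cancel : ∀ x e → x ℚ.+ e ℚ.- x ≡ e
  cancel = solve 2 (λ x e → x :+ e :- x := e) refl
    where open ℚSolver.+-*-Solver

#⇒≢ : ∀ {x y} → x # y → ¬ (∀ n → seq x n ≡ seq y n)
#⇒≢ {x} {y} (inj₁ h) eq = <ᴿ⇒≢ {x} {y} h eq
#⇒≢ {x} {y} (inj₂ h) eq = <ᴿ⇒≢ {y} {x} h (λ n → sym (eq n))

difference-# : ∀ {x y} → x # y → (x +ᴿ -1ᴿ *ᴿ y) # 0ᴿ
difference-# {x} {y} (inj₁ (ε , 0<ε , M , h)) = inj₁ (ε , 0<ε , M , λ n le →
  subst₂ ℚ._≤_ (identity (seq x n) (seq y n) ε) (ℚ.+-inverseʳ (seq y n))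
      (ℚ.+-monoˡ-≤ (ℚ.- seq y n) (h n le)))
  where
  identity : ∀ x y e → x ℚ.+ e ℚ.- y ≡ x ℚ.+ (ℚ.- 1ℚ) ℚ.* y ℚ.+ e
  identity = solve 3 (λ x y e → x :+ e :- y := x :+ con (ℚ.- 1ℚ) :* y :+ e) refl
    where open ℚSolver.+-*-Solver
difference-# {x} {y} (inj₂ (ε , 0<ε , M , h)) = inj₂ (ε , 0<ε , M , λ n le →
  subst₂ ℚ._≤_ (identity (seq y n) ε) (identity′ (seq x n) (seq y n)) (ℚ.+-monoˡ-≤ (ℚ.- seq y n) (h n le)))
  where
  open ℚSolver.+-*-Solver
  identity : ∀ y e → y ℚ.+ e ℚ.- y ≡ 0ℚ ℚ.+ e
  identity = solve 2 (λ y e → y :+ e :- y := con 0ℚ :+ e) refl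
  identity′ : ∀ x y → x ℚ.- y ≡ x ℚ.+ (ℚ.- 1ℚ) ℚ.* y
  identity′ = solve 2 (λ x y → x :- y := x :+ con (ℚ.- 1ℚ) :* y) refl

lineThrough : ∀ p q → p #ᴾ q → Line
lineThrough p q p#q = record
  { a = a ; b = b ; c = a *ᴿ xᶜ p +ᴿ b *ᴿ yᶜ p
  ; nondegenerate = nondegenerate p#q }
  where
  a b : ℝ
  a = yᶜ p +ᴿ -1ᴿ *ᴿ yᶜ q
  b = xᶜ q +ᴿ -1ᴿ *ᴿ xᶜ p
  flip-# : ∀ {x y} → x # y → y # x
  flip-# {x} {y} (inj₁ h) = inj₂ h
  flip-# {x} {y} (inj₂ h) = inj₁ h
  nondegenerate : p #ᴾ q → a # 0ᴿ ⊎ b # 0ᴿ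
  nondegenerate (inj₁ x#) = inj₂ (difference-# {xᶜ q} {xᶜ p} (flip-# {xᶜ p} {xᶜ q} x#))
  nondegenerate (inj₂ y#) = inj₁ (difference-# {yᶜ p} {yᶜ q} y#)

module _ {N : ℕ} (p : Vector Point N) (distinct : Distinct p) (general : GeneralPosition p) where

  Signed : ℕ → (i j k : Fin N) → Set
  Signed K i j k = i ≢ j → j ≢ k → i ≢ k → Positive p K i j k ⊎ Positive p K j i k

  private
    module _ (i j k : Fin N) where
      X Y : Fin N → ℕ → ℚ
      X a = seq (xᶜ (p a))
      Y a = seq (yᶜ (p a))

      value : Fin N → ℕ → ℚ
      value c m = (Y i m ℚ.+ (ℚ.- 1ℚ) ℚ.* Y j m) ℚ.* X c m ℚ.+ (X j m ℚ.+ (ℚ.- 1ℚ) ℚ.* X i m) ℚ.* Y c m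

      value-j : ∀ m → value j m ≡ value i m
      value-j m = solve 4 (λ xi yi xj yj →
        (yi :+ con (ℚ.- 1ℚ) :* yj) :* xj :+ (xj :+ con (ℚ.- 1ℚ) :* xi) :* yj
        := (yi :+ con (ℚ.- 1ℚ) :* yj) :* xi :+ (xj :+ con (ℚ.- 1ℚ) :* xi) :* yi) refl (X i m) (Y i m)
            (X j m) (Y j m)
        where open ℚSolver.+-*-Solver

      value-k : ∀ m → value k m ℚ.- value i m ≡ detᴿ p m i j k
      value-k m = solve 6 (λ xi yi xj yj xk yk →
        (yi :+ con (ℚ.- 1ℚ) :* yj) :* xk :+ (xj :+ con (ℚ.- 1ℚ) :* xi) :* yk
          :- ((yi :+ con (ℚ.- 1ℚ) :* yj) :* xi :+ (xj :+ con (ℚ.- 1ℚ) :* xi) :* yi)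
        := (xj :- xi) :* (yk :- yi) :- (xk :- xi) :* (yj :- yi)) refl
        (X i m) (Y i m) (X j m) (Y j m) (X k m) (Y k m)
        where open ℚSolver.+-*-Solver

      value-k′ : ∀ m → value i m ℚ.- value k m ≡ detᴿ p m j i k
      value-k′ m = trans (neg-diff (value i m) (value k m)) (trans (cong ℚ.-_ (value-k m))
        (sym (det-swap (X i m) (Y i m) (X j m) (Y j m) (X k m) (Y k m))))
        where
        neg-diff : ∀ a b → a ℚ.- b ≡ ℚ.- (b ℚ.- a)
        neg-diff = solve 2 (λ a b → a :- b := :- (b :- a)) refl
          where open ℚSolver.+-*-Solver

      -- The line through points `i` and `j` takes termwise equal values at both, so it can miss
      -- neither. General position then makes it miss point `k`, and the direction of the apartness
      -- is the sign of the determinant.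
      signed : i ≢ j → j ≢ k → i ≢ k → ∃[ K ] (Positive p K i j k ⊎ Positive p K j i k)
      signed i≢j j≢k i≢k = go (general i j k i≢j j≢k i≢k ℓ)
        where
        ℓ : Line
        ℓ = lineThrough (p i) (p j) (distinct i j i≢j)
        valueᴿ : Fin N → ℝ
        valueᴿ c = Line.a ℓ *ᴿ xᶜ (p c) +ᴿ Line.b ℓ *ᴿ yᶜ (p c)
        go : ℓ Misses p i ⊎ ℓ Misses p j ⊎ ℓ Misses p k → ∃[ K ] (Positive p K i j k ⊎ Positive p K j i k)
        go (inj₁ h)               = ⊥-elim (#⇒≢ {valueᴿ i} {Line.c ℓ} h (λ _ → refl))
        go (inj₂ (inj₁ h))        = ⊥-elim (#⇒≢ {valueᴿ j} {Line.c ℓ} h value-j)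
        go (inj₂ (inj₂ (inj₁ h))) = proj₁ g , inj₂ (λ m le → subst (δ (proj₁ g) ℚ.≤_) (value-k′ m)
            (proj₂ g m le))
          where g = gap {valueᴿ k} {Line.c ℓ} h
        go (inj₂ (inj₂ (inj₂ h))) = proj₁ g , inj₁ (λ m le → subst (δ (proj₁ g) ℚ.≤_) (value-k m)
            (proj₂ g m le))
          where g = gap {Line.c ℓ} {valueᴿ k} h

      signed′ : ∃[ K ] Signed K i j k
      signed′ with i Fin.≟ j | j Fin.≟ k | i Fin.≟ k
      ... | yes e | _     | _     = 0 , λ i≢j _ _ → contradiction e i≢j
      ... | no  _ | yes e | _     = 0 , λ _ j≢k _ → contradiction e j≢k
      ... | no  _ | no  _ | yes e = 0 , λ _ _ i≢k → contradiction e i≢k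
      ... | no  a | no  b | no  c = proj₁ (signed a b c) , λ _ _ _ → proj₂ (signed a b c)

    signed-mono : ∀ i j k {K L} → K ≤ L → Signed K i j k → Signed L i j k
    signed-mono i j k {K} {L} K≤L h a b c =
      [ (λ q → inj₁ (positive-mono p {K} {L} {i} {j} {k} K≤L q))
      , (λ q → inj₂ (positive-mono p {K} {L} {j} {i} {k} K≤L q)) ]′ (h a b c)

  stage : ∃[ K ] (∀ i j k → Signed K i j k)
  stage = uniform (λ i K≤L h j k → signed-mono i j k K≤L (h j k)) λ i →
          uniform (λ j K≤L h k → signed-mono i j k K≤L (h k)) λ j →
          uniform (λ k → signed-mono i j k) λ k → signed′ i j k

convexPosition : ∀ {n} → 3 ≤ n → (r : Vector Point n) (K : ℕ) →
  (∀ {a b c} → a Fin.< b → b Fin.< c → Positive r K a b c) → ConvexPosition r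
convexPosition (s≤s (s≤s (s≤s z≤n))) r K h = polygon⇒convexPosition r K h

third′ : ∀ {n} → 3 ≤ n → (i j : Fin n) → ∃[ k ] (k ≢ i × k ≢ j)
third′ (s≤s (s≤s (s≤s z≤n))) = third

forces : ∀ n c g N → 3 ≤ n → 1 ≤ c → n < suc c ^ 3 → n < 2 ^ suc g → 502 ≤ g →
  2 ^ (n + 6 * (c * c) * g) ≤ N → Forces (n) N
forces n c g zero    _   _  _  _  _  h₅ = contradiction h₅ (ℕ.<⇒≱ (ℕ.m^n>0 2 (n + 6 * (c * c) * g)))
forces n c g (suc N) 3≤n h₁ h₂ h₃ h₄ h₅ p distinct general = go (stage p distinct general)
  where
  go : ∃[ K ] (∀ i j k → Signed p distinct general K i j k) →
    Σ[ f ∈ (Fin n → Fin (suc N)) ] Injective _≡_ _≡_ f × ConvexPosition (p ∘ f)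
  go (K , signs) = found (rational-polygon x y total n c g h₁ h₂ h₃ h₄ h₅)
    where
    x y : Fin (suc N) → ℚ
    x i = seq (xᶜ (p i)) K
    y i = seq (yᶜ (p i)) K
    open RationalPoints x y using (detᵖ; orientation)
    total : ∀ {a b c} → a ≢ b → b ≢ c → a ≢ c → 0ℚ ℚ.< detᵖ a b c ⊎ 0ℚ ℚ.< detᵖ b a c
    total {a} {b} {c} ab bc ac =
      [ (λ h → inj₁ (positive⇒0< p {K} {a} {b} {c} h)) , (λ h → inj₂ (positive⇒0< p {K} {b} {a} {c} h)) ]′
      (signs a b c ab bc ac)
    open Chirotope (orientation total) hiding (total)
    -- The sign at stage `K` decides which alternative of `signs` holds, and hence the sign at all
    -- later stages.
    positive : ∀ {a b c} → Ccw a b c → Positive p K a b c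
    positive {a} {b} {c} h =
      [ (λ q → q) , (λ q → contradiction (positive⇒0< p {K} {b} {a} {c} q) (asym h)) ]′
      (signs a b c (ccw⇒≢ h) (ccw⇒≢ (cyc h)) (≢-sym (ccw⇒≢ (cyc² h))))
    found : ∃[ u ] (Polygon u × n ≤ length u) →
      Σ[ f ∈ (Fin n → Fin (suc N)) ] Injective _≡_ _≡_ f × ConvexPosition (p ∘ f)
    found (u , poly , long) = f , f-injective
      , convexPosition 3≤n (p ∘ f) K (λ a<b b<c → positive (f-polygon a<b b<c))
      where
      f : Fin n → Fin (suc N)
      f i = lookup u (Fin.inject≤ i long)
      f-polygon : ∀ {a b c} → a Fin.< b → b Fin.< c → Ccw (f a) (f b) (f c)
      f-polygon {a} {b} {c} a<b b<c = AllTriples-lookup u poly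
        (subst₂ _<_ (sym (Fin.toℕ-inject≤ a long)) (sym (Fin.toℕ-inject≤ b long)) a<b)
        (subst₂ _<_ (sym (Fin.toℕ-inject≤ b long)) (sym (Fin.toℕ-inject≤ c long)) b<c)
      -- `Polygon` speaks of triples only, so two vertices are told apart with the help of a third.
      f-< : ∀ {a b} → a Fin.< b → f a ≢ f b
      f-< {a} {b} a<b with third′ 3≤n a b
      ... | c , c≢a , c≢b with Fin.<-cmp c a | Fin.<-cmp c b
      ...   | tri< c<a _ _ | _            = ccw⇒≢ (cyc (f-polygon c<a a<b))
      ...   | tri≈ _ e _   | _            = contradiction e c≢a
      ...   | tri> _ _ a<c | tri< c<b _ _ = ≢-sym (ccw⇒≢ (cyc² (f-polygon a<c c<b)))
      ...   | tri> _ _ _   | tri≈ _ e _   = contradiction e c≢b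
      ...   | tri> _ _ _   | tri> _ _ b<c = ccw⇒≢ (f-polygon a<b b<c)
      f-injective : ∀ {i j} → f i ≡ f j → i ≡ j
      f-injective {i} {j} eq with Fin.<-cmp i j
      ... | tri< i<j _ _ = contradiction eq (f-< i<j)
      ... | tri≈ _ e _   = e
      ... | tri> _ _ j<i = contradiction (sym eq) (f-< j<i)

-- The bound

-- The bound holds at every stage and not only in the limit: `2 ^ e * suc k` is an integer, so
-- taking the floor in the definition of the power does not spoil it.
power-lower : ∀ x e → (∀ k → + e / 1 ℚ.≤ seq x k) → ∀ {N} → N ≤ 2 ^ e → fromℕ N ≤ᴿ (2 ^ᴿ x)
power-lower x e e≤x {N} N≤ ε 0<ε = 0 , λ k _ → ℚ.≤-trans
    (/-mono N (⌊·^⌋ (suc k) 2 (seq x k)) 0 k (ℕ.≤-trans (ℕ.*-monoˡ-≤ (suc k) N≤)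
      (ℕ.≤-trans (floor k (seq x k) (e≤x k)) (ℕ.≤-reflexive (sym (ℕ.*-identityʳ _))))))
    (subst (ℚ._≤ approx 2 k (seq x k) ℚ.+ ε) (ℚ.+-identityʳ (approx 2 k (seq x k)))
      (ℚ.+-monoʳ-≤ (approx 2 k (seq x k)) (ℚ.<⇒≤ 0<ε)))
  where
  open ℕ.≤-Reasoning
  below : ∀ k P d → e * suc d ≤ P →
    (2 ^ e * suc k) ^ suc d * 2 ^ 0 ≤ suc k ^ suc d * 2 ^ P
  below k P d h = begin
    (2 ^ e * suc k) ^ suc d * 2 ^ 0     ≡⟨ ℕ.*-identityʳ _ ⟩
    (2 ^ e * suc k) ^ suc d             ≡⟨ ^-distribʳ-* (2 ^ e) (suc k) (suc d) ⟩
    (2 ^ e) ^ suc d * suc k ^ suc d     ≡⟨ ℕ.*-comm ((2 ^ e) ^ suc d) (suc k ^ suc d) ⟩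
    suc k ^ suc d * (2 ^ e) ^ suc d     ≡⟨ cong (suc k ^ suc d *_) (ℕ.^-*-assoc 2 e (suc d)) ⟩
    suc k ^ suc d * 2 ^ (e * suc d)     ≤⟨ ℕ.*-monoʳ-≤ (suc k ^ suc d) (ℕ.^-monoʳ-≤ 2 h) ⟩
    suc k ^ suc d * 2 ^ P               ∎
  cross-multiply : ∀ r → + e / 1 ℚ.≤ r → + e ℤ.* ℚ.↧ r ℤ.≤ ℚ.↥ r ℤ.* + 1
  cross-multiply r@record{} h = ℚᵘ.drop-*≤* (ℚᵘ.≤-respˡ-≃ (ℚ.toℚᵘ-fromℚᵘ (mkℚᵘ (+ e) 0)) (ℚ.toℚᵘ-mono-≤ h))
  floor : ∀ k r → + e / 1 ℚ.≤ r → 2 ^ e * suc k ≤ ⌊·^⌋ (suc k) 2 r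
  floor k r@(ℚ.mkℚ (+ P) d _) h = greatest-max (below? (suc k) 2 r) (suc k * 2 ^ P) (2 ^ e * suc k)
    (ℕ.≤-trans (ℕ.≤-reflexive (ℕ.*-comm (2 ^ e) (suc k)))
      (ℕ.*-monoʳ-≤ (suc k) (ℕ.^-monoʳ-≤ 2 (ℕ.≤-trans (ℕ.m≤m*n e (suc d)) e*d≤P))))
    (below k P d e*d≤P)
    where
    e*d≤P : e * suc d ≤ P
    e*d≤P = ℤ.drop‿+≤+ (subst₂ ℤ._≤_ (sym (ℤ.pos-* e (suc d))) (ℤ.*-identityʳ (+ P)) (cross-multiply r h))
  floor k r@(ℚ.mkℚ (ℤ.-[1+ P ]) d _) h =
    contradiction (subst₂ ℤ._≤_ (sym (ℤ.pos-* e (suc d))) (ℤ.*-identityʳ ℤ.-[1+ P ])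
        (cross-multiply r h)) λ ()

module _ (n : ℕ) .{{_ : NonZero n}} (c g : ℕ) (c³≤n : c ^ 3 ≤ n) (2^g≤n : 2 ^ g ≤ n) where

  log₂-lower : ∀ k → + g / 1 ℚ.≤ seq (log₂ n) k
  log₂-lower k = /-mono g (⌊log₂^⌋ n (suc k)) 0 k (ℕ.≤-trans
    (greatest-max (λ a → 2 ^ a ℕ.≤? n ^ suc k) (n ^ suc k) (g * suc k)
      (ℕ.≤-trans (ℕ.<⇒≤ (n<2^n (g * suc k))) bound) bound)
    (ℕ.≤-reflexive (sym (ℕ.*-identityʳ _))))
    where
    bound : 2 ^ (g * suc k) ≤ n ^ suc k
    bound = ℕ.≤-trans (ℕ.≤-reflexive (sym (ℕ.^-*-assoc 2 g (suc k)))) (ℕ.^-monoˡ-≤ (suc k) 2^g≤n)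

  -- The cube of `c²` is the square of `c³`, which is at most `n ^ 2`.
  n^⅔-lower : ∀ k → + (c * c) / 1 ℚ.≤ seq (n ^ᴿ fromℚ (+ 2 / 3)) k
  n^⅔-lower k = /-mono (c * c) (⌊·^⌋ (suc k) n (+ 2 / 3)) 0 k (ℕ.≤-trans
    (greatest-max (below? (suc k) n (+ 2 / 3)) (suc k * n ^ 2) (c * c * suc k)
      (^-cancel-≤ 3 (ℕ.≤-trans bound (ℕ.≤-trans
          (ℕ.*-monoʳ-≤ (suc k ^ 3) (ℕ.m≤m*n (n ^ 2) ((n ^ 2) ^ 2) {{ℕ.m^n≢0 (n ^ 2) 2 {{ℕ.m^n≢0 n 2}}}}))
        (ℕ.≤-reflexive (sym (^-distribʳ-* (suc k) (n ^ 2) 3))))))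
      (ℕ.≤-trans (ℕ.≤-reflexive (ℕ.*-identityʳ _)) bound))
    (ℕ.≤-reflexive (sym (ℕ.*-identityʳ _))))
    where
    bound : (c * c * suc k) ^ 3 ≤ suc k ^ 3 * n ^ 2
    bound = ℕ.≤-trans
      (ℕ.≤-reflexive (solve 2 (λ c k → (c :* c :* k) :^ 3 := k :^ 3 :* (c :^ 3) :^ 2) refl c (suc k)))
      (ℕ.*-monoʳ-≤ (suc k ^ 3) (ℕ.^-monoˡ-≤ 2 c³≤n))
      where open +-*-Solver

  exponent-lower : ∀ k → + (n + 6 * (c * c) * g) / 1 ℚ.≤
    seq (fromℕ n +ᴿ fromℕ 6 *ᴿ (n ^ᴿ fromℚ (+ 2 / 3)) *ᴿ log₂ n) k
  exponent-lower k = ℚ.≤-trans (ℚ.≤-reflexive (trans (/-+ n (6 * (c * c) * g) 0)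
      (cong (ℚ._+_ (+ n / 1)) (trans (/-* (6 * (c * c)) g 0 0)
          (cong (ℚ._* (+ g / 1)) (/-* 6 (c * c) 0 0))))))
    (ℚ.+-monoʳ-≤ (+ n / 1) (*-mono (/-0≤ g 0) (0≤-* (/-0≤ 6 0) (ℚ.≤-trans (/-0≤ (c * c) 0) (n^⅔-lower k)))
      (ℚ.*-monoˡ-≤-nonNeg (+ 6 / 1) (n^⅔-lower k)) (log₂-lower k)))

-- The integer cube root `c` and the integer logarithm `g` of `n` replace the real functions.
-- Rounding down is harmless, as it only makes the number of points that suffices smaller. The
-- threshold is what `502 ≤ g` amounts to.
large-n : ∀ n .{{_ : NonZero n}} → n ≥ 2 ^ 502 →
  ES[ n ]≤ (2 ^ᴿ (fromℕ n +ᴿ fromℕ 6 *ᴿ (n ^ᴿ fromℚ (+ 2 / 3)) *ᴿ log₂ n))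
large-n n n≥ = (N , forces′ , bound ℕ.≤-refl) , λ M isES → bound (proj₂ isES N forces′)
  where
  502≤n : 502 ≤ n
  502≤n = ℕ.≤-trans (ℕ.<⇒≤ (n<2^n 502)) n≥
  cube? : ∀ a → Dec (a ^ 3 ≤ n)
  cube? a = a ^ 3 ℕ.≤? n
  power? : ∀ a → Dec (2 ^ a ≤ n)
  power? a = 2 ^ a ℕ.≤? n
  c g N : ℕ
  c = greatest cube? n
  g = greatest power? n
  N = 2 ^ (n + 6 * (c * c) * g)
  1≤n : 1 ≤ n
  1≤n = ℕ.≤-trans (s≤s z≤n) 502≤n
  c³≤n : c ^ 3 ≤ n
  c³≤n = greatest-holds cube? n z≤n
  2^g≤n : 2 ^ g ≤ n
  2^g≤n = greatest-holds power? n 1≤n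
  a≤a³ : ∀ a → a ≤ a ^ 3
  a≤a³ zero    = z≤n
  a≤a³ (suc a) = ℕ.m≤m*n (suc a) (suc a ^ 2) {{ℕ.m^n≢0 (suc a) 2}}
  forces′ : Forces n N
  forces′ = forces n c g N (ℕ.≤-trans (s≤s (s≤s (s≤s z≤n))) 502≤n)
    (greatest-max cube? n 1 1≤n 1≤n)
    (ℕ.≰⇒> (greatest-fails cube? n (λ a h → ℕ.≤-trans (a≤a³ a) h)))
    (ℕ.≰⇒> (greatest-fails power? n (λ a h → ℕ.≤-trans (ℕ.<⇒≤ (n<2^n a)) h)))
    (greatest-max power? n 502 502≤n n≥) ℕ.≤-refl
  bound : ∀ {M} → M ≤ N → fromℕ M ≤ᴿ (2 ^ᴿ (fromℕ n +ᴿ fromℕ 6 *ᴿ (n ^ᴿ fromℚ (+ 2 / 3)) *ᴿ log₂ n))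
  bound = power-lower (fromℕ n +ᴿ fromℕ 6 *ᴿ (n ^ᴿ fromℚ (+ 2 / 3)) *ᴿ log₂ n) (n + 6 * (c * c) * g)
    (exponent-lower n c g c³≤n 2^g≤n)

theorem1p1 : ∃[ n₀ ] (∀ (n : ℕ) .{{_ : NonZero n}} → n ≥ n₀ →
    ES[ n ]≤ (2 ^ᴿ (fromℕ n +ᴿ fromℕ 6 *ᴿ (n ^ᴿ fromℚ (+ 2 / 3)) *ᴿ log₂ n)))
theorem1p1 = 2 ^ 502 , large-n
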